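{- For every $\eta\in(0,1)$ there are $n_0\in\mathbb N$ and $\gamma>0$ such that for each $n\ge n_0$, each $h\le \gamma\sqrt n$ and each $k\ge \eta n$ the following holds: every oriented graph $D$ on $n$ vertices with $\delta^0(D)>(1+\eta)\frac k2$ contains every long $k$-edge antisubdivision of $K_h$.
   Context: An oriented graph is a digraph with no loops and at most one edge between any pair of vertices. The minimum semidegree $\delta^0(D)$ is the minimum over all vertices of $D$ of their in-degrees and out-degrees. An oriented graph is antidirected if it contains no directed path with 2 edges. For $h,k\in\mathbb N$, consider a function $g:E(K_h)\to\mathbb N^+$ with $\sum_{e\in E(K_h)}g(e)=k$, and the subdivision of the complete graph $K_h$ in which each edge $e$ is replaced by a path of length $g(e)$ (internally disjoint paths between the $h$ branch vertices). Any antidirected orientation of such a subdivision is called a $k$-edge antisubdivision of $K_h$. It is called long if the edges $e$ of $K_h$ with $g(e)<3$ form (the edge set of) a forest in $K_h$. -}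

module Defs where

open import Data.Nat as ℕ using (ℕ; zero; suc)
open import Data.Fin using (Fin; zero; suc; inject₁; fromℕ; _<?_) renaming (_<_ to _<ᶠ_)
open import Data.List using (List; map; allFin)
open import Data.Nat.ListAction using (sum)
open import Data.Bool using (Bool; true; false; if_then_else_; _∨_)
open import Data.Product using (Σ; ∃; _×_; _,_)
open import Data.Sum using (_⊎_)
open import Relation.Binary.PropositionalEquality using (_≡_)
open import Relation.Nullary using (¬_; does)
open import Data.Integer using (+_)
open import Data.Rational using (ℚ; _/_)

-- A digraph on vertex set Fin n, given by its (Boolean) arc relation:
-- A u v ≡ true  means there is an arc u → v.
Digraph : ℕ → Set
Digraph n = Fin n → Fin n → Bool

Oriented : ∀ {n} → Digraph n → Set
Oriented {n} A = (∀ (u : Fin n) → A u u ≡ false)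
               × (∀ (u v : Fin n) → A u v ≡ true → A v u ≡ false)

Antidirected : ∀ {n} → Digraph n → Set
Antidirected {n} A = ∀ (u v w : Fin n) → A u v ≡ true → A v w ≡ false

countB : ∀ {n} → (Fin n → Bool) → ℕ
countB {n} f = sum (map (λ v → if f v then 1 else 0) (allFin n))

outdeg : ∀ {n} → Digraph n → Fin n → ℕ
outdeg A u = countB (λ v → A u v)

indeg : ∀ {n} → Digraph n → Fin n → ℕ
indeg A u = countB (λ v → A v u)

ℕ→ℚ : ℕ → ℚ
ℕ→ℚ m = (+ m) / 1

MinSemidegreeAbove : ∀ {n} → Digraph n → ℚ → Set
MinSemidegreeAbove {n} A q =
  ∀ (v : Fin n) → (q Data.Rational.< ℕ→ℚ (outdeg A v)) × (q Data.Rational.< ℕ→ℚ (indeg A v))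

-- Edge-length functions on K_h: an edge {i,j} of K_h with i < j gets g i j.
-- (values g i j with ¬ i < j are irrelevant)
EdgeFun : ℕ → Set
EdgeFun h = Fin h → Fin h → ℕ

sumEdges : ∀ {h} → EdgeFun h → ℕ
sumEdges {h} g =
  sum (map (λ i → sum (map (λ j → if does (i <? j) then g i j else 0) (allFin h))) (allFin h))

Positive : ∀ {h} → EdgeFun h → Set
Positive {h} g = ∀ (i j : Fin h) → i <ᶠ j → 1 ℕ.≤ g i j

Short : ∀ {h} → EdgeFun h → Fin h → Fin h → Set
Short g i j = (i <ᶠ j × g i j ℕ.< 3) ⊎ (j <ᶠ i × g j i ℕ.< 3)

ShortEdgesForest : ∀ {h} → EdgeFun h → Set
ShortEdgesForest {h} g =
  ∀ (l : ℕ) → 2 ℕ.≤ l → (c : Fin (suc l) → Fin h) →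
    (∀ s t → c s ≡ c t → s ≡ t) →
    (∀ (t : Fin l) → Short g (c (inject₁ t)) (c (suc t))) →
    ¬ Short g (c (fromℕ l)) (c zero)

record IsAntisubdivision (h : ℕ) (g : EdgeFun h) {m : ℕ} (H : Digraph m) : Set where
  field
    branch      : Fin h → Fin m
    path        : (i j : Fin h) → i <ᶠ j → Fin (suc (g i j)) → Fin m
    path-start  : ∀ i j (p : i <ᶠ j) → path i j p zero ≡ branch i
    path-end    : ∀ i j (p : i <ᶠ j) → path i j p (fromℕ (g i j)) ≡ branch j
    branch-inj  : ∀ i j → branch i ≡ branch j → i ≡ j
    internal-not-branch :
      ∀ i j (p : i <ᶠ j) (t : Fin (suc (g i j))) →
        ¬ t ≡ zero → ¬ t ≡ fromℕ (g i j) → ∀ l → ¬ path i j p t ≡ branch l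
    internal-unique :
      ∀ i j (p : i <ᶠ j) (t : Fin (suc (g i j))) →
        ¬ t ≡ zero → ¬ t ≡ fromℕ (g i j) →
        ∀ i' j' (p' : i' <ᶠ j') (t' : Fin (suc (g i' j'))) →
          path i j p t ≡ path i' j' p' t' →
          Σ (i ≡ i') λ _ → Σ (j ≡ j') λ _ → Data.Fin.toℕ t ≡ Data.Fin.toℕ t'
    covers      : ∀ (u : Fin m) →
                    (∃ λ l → branch l ≡ u) ⊎
                    (∃ λ i → ∃ λ j → Σ (i <ᶠ j) λ p → ∃ λ t → path i j p t ≡ u)
    adjacent-on-path :
      ∀ (u v : Fin m) → (H u v ∨ H v u) ≡ true →
        ∃ λ i → ∃ λ j → Σ (i <ᶠ j) λ p → ∃ λ (t : Fin (g i j)) →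
          (path i j p (inject₁ t) ≡ u × path i j p (suc t) ≡ v) ⊎
          (path i j p (inject₁ t) ≡ v × path i j p (suc t) ≡ u)
    path-adjacent :
      ∀ i j (p : i <ᶠ j) (t : Fin (g i j)) →
        (H (path i j p (inject₁ t)) (path i j p (suc t)) ∨
         H (path i j p (suc t)) (path i j p (inject₁ t))) ≡ true
    oriented    : Oriented H
    antidirected : Antidirected H

record IsLongAntisubdivision (h k : ℕ) (g : EdgeFun h) {m : ℕ} (H : Digraph m) : Set where
  field
    positive : Positive g
    total    : sumEdges g ≡ k
    long     : ShortEdgesForest g
    anti     : IsAntisubdivision h g H

Contains : ∀ {n m} → Digraph n → Digraph m → Set
Contains {n} {m} D H =
  Σ (Fin m → Fin n) λ φ →
    (∀ u v → φ u ≡ φ v → u ≡ v) × (∀ u v → H u v ≡ true → D (φ u) (φ v) ≡ true)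

{-# OPTIONS --safe #-}
module Submission where

-- Give every vertex two roles ("sides"), tail and head of arcs.  An antidirected path alternates between the sides, so it
-- is a path of the bipartite double cover of D whose vertices lie over distinct vertices of D.  Splitting off badly
-- connected parts leaves a pair Z of vertex sets that keeps almost all degrees and in which any two vertices are joined by
-- short alternating paths avoiding any small set.  A density increment inside Z gives a hub, in which paths of every exact
-- length ≥ 3 exist.  The branch vertices are placed greedily in the hub, along an order in which each has at most one
-- earlier neighbour by a short edge; such an order exists because the short edges form a forest.
-- Since D is oriented, the two sides of Z together have at least twice the minimum degree many vertices, and repeatedly
-- rebuilding disjoint copies of K_{s,s} (tiles) covers almost that many, hence more than k, with s a constant; pigeonhole
-- on neighbourhoods replaces the regularity lemma.  A long path runs from tile to tile along short connections and ends in
-- the hub, where its length is adjusted.  The tiles are traversed only after all connections have been chosen, and tiles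
-- that connections hit too often are avoided afterwards, so each visited tile can still be traversed almost completely.

open import Defs
open import Data.Bool using (Bool; true; false; if_then_else_; _∨_; _∧_; not; _xor_)
import Data.Bool.Properties as Boolₚ
open import Data.Empty using (⊥; ⊥-elim)
open import Data.Fin using (Fin; toℕ; fromℕ; fromℕ<; inject₁) renaming (zero to fzero; suc to fsuc; _<_ to _<ᶠ_)
open import Data.Fin.Induction using (<-weakInduction)
import Data.Fin.Properties as Finₚ
open import Data.Fin.Subset using (Subset)
open import Data.Fin.Subset.Properties using (anySubset?)
import Data.Integer as ℤ
import Data.Integer.Properties as ℤₚ
open import Data.List using (List; []; _∷_; map; allFin; length; _++_; filterᵇ; take; drop; concatMap; lookup)
open import Data.List.Properties using (length-++; length-take; length-drop; length-tabulate; take++drop≡id; ++-assoc; concatMap-++)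
open import Data.List.Membership.Propositional using (_∈_; _∉_; find; lose)
open import Data.List.Membership.Propositional.Properties using (∈-++⁺ˡ; ∈-++⁺ʳ; ∈-++⁻; ∈-allFin; ∈-map⁺; ∈-∃++; ∈-lookup)
open import Data.List.Relation.Binary.Permutation.Propositional using (_↭_; prep; swap; ↭-refl; ↭-sym; ↭-trans; ↭-reflexive)
import Data.List.Relation.Binary.Permutation.Propositional as ↭
import Data.List.Relation.Binary.Permutation.Propositional.Properties as ↭ₚ
open import Data.List.Relation.Unary.All using (All; []; _∷_)
import Data.List.Relation.Unary.All as All
import Data.List.Relation.Unary.All.Properties as Allₚ
open import Data.List.Relation.Unary.AllPairs using ([]; _∷_)
open import Data.List.Relation.Unary.Any using (here; there; any?)
open import Data.List.Relation.Unary.Unique.Propositional using (Unique)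
import Data.List.Relation.Unary.Unique.Propositional.Properties as Uniqueₚ
open import Data.Nat using (ℕ; zero; suc; z≤n; s≤s; NonZero; >-nonZero; >-nonZero⁻¹)
import Data.Nat as ℕ
open import Data.Nat.DivMod using (m/n*n≤m; m<n*o⇒m/o<n; m≡m%n+[m/n]*n; m%n<n)
open import Data.Nat.ListAction using (sum)
import Data.Nat.Properties as ℕₚ
open import Data.Nat.Tactic.RingSolver using (solve-∀)
open import Data.Product using (Σ; ∃; _×_; _,_; proj₁; proj₂)
open import Data.Sum using (_⊎_; inj₁; inj₂; [_,_]′)
import Data.Sum as Sum
import Data.Rational
import Data.Rational.Properties as ℚₚ
open import Data.Rational.Solver using (module +-*-Solver)
import Data.Rational.Unnormalised as ℚᵘ
import Data.Rational.Unnormalised.Properties as ℚᵘₚ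
import Data.Vec as Vec
import Data.Vec.Properties as Vecₚ
import Algebra.Solver.CommutativeMonoid as CMSolver
open import Function using (id)
open import Relation.Binary.PropositionalEquality using (_≡_; _≢_; refl; sym; trans; cong; cong₂; subst; subst₂)
open import Relation.Nullary using (¬_; ¬?; Dec; yes; no; does; _×-dec_; _→-dec_; _⊎-dec_)
open import Relation.Nullary.Decidable using (map′)

-- The constants must be nested in the right order. Let `1/N` bound η from below. Connections have
-- at most `L` interior vertices, with `L` depending on `N` alone, and each of them buys the `J`
-- edges of a tile, where `J` is almost `2 * s`. Once `s` is large against `L`, all connections
-- together use at most `cap` vertices, a small fraction of `n`. This must stay small against the
-- number `f` of vertices that connections and hub can avoid, although every tile hit `θ` times is
-- avoided as a whole. Such tiles add `2 * s` vertices per `θ` hits, so only the ratio `s / θ`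
-- enters. It is fixed as `64 * N * N`; hence `f` and `cap` are determined before `θ` and `s`, which
-- can then be taken as large as needed. The branch vertices have prescribed sides, read off from
-- `H`, and the parity of each path length matches them. Two prescribed hub vertices can be joined
-- by a path of any matching length from 3 on, but not by one of length 1 or 2. A short path can
-- only be grown from one placed end, and its other end becomes a new branch vertex. That is
-- possible for every short edge exactly along an order with at most one short edge backwards.

module Combinatorics where
  open import Data.Nat using (_+_; _*_; _∸_; _≤_; _<_; _^_; _≤?_; _<?_; _/_)
  open import Data.Nat.Properties hiding (_≤?_; _<?_)

  -- A certificate for linear arithmetic: the hypotheses, scaled and added up, form `l ≤ r`, the
  -- number `s` is the slack, and the remaining identity is a matter for the ring solver.
  ≤-by : ∀ {a b l r} s → l ≤ r → a + r + s ≡ b + l → a ≤ b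
  ≤-by {a} {b} {l} {r} s l≤r eq = +-cancelʳ-≤ l a b
    (≤-trans (+-monoʳ-≤ a l≤r) (≤-trans (m≤m+n (a + r) s) (≤-reflexive eq)))

  ∧-true : ∀ a {b} → a ∧ b ≡ true → a ≡ true × b ≡ true
  ∧-true true {true} _ = refl , refl

  ∧-false : ∀ {a b} → a ≡ true → a ∧ b ≡ false → b ≡ false
  ∧-false refl e = e

  ∧-intro : ∀ {a b} → a ≡ true → b ≡ true → a ∧ b ≡ true
  ∧-intro refl refl = refl

  not-true : ∀ {a} → not a ≡ true → a ≡ false
  not-true {false} _ = refl

  true≢false : ∀ {a} {X : Set} → a ≡ true → a ≡ false → X
  true≢false refl ()

  bool-dec : ∀ b → b ≡ true ⊎ b ≡ false
  bool-dec true = inj₁ refl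
  bool-dec false = inj₂ refl

  -- Sums and counts over lists

  private variable
    A B : Set

  ∑ : (A → ℕ) → List A → ℕ
  ∑ f [] = 0
  ∑ f (x ∷ xs) = f x + ∑ f xs

  ∑-sum : ∀ (f : A → ℕ) xs → sum (map f xs) ≡ ∑ f xs
  ∑-sum f [] = refl
  ∑-sum f (x ∷ xs) = cong (f x +_) (∑-sum f xs)

  cnt : (A → Bool) → List A → ℕ
  cnt p = ∑ (λ v → if p v then 1 else 0)

  ind≤1 : ∀ b → (if b then 1 else 0) ≤ 1
  ind≤1 true = ≤-refl
  ind≤1 false = z≤n

  ind-mono : ∀ {a b} → (a ≡ true → b ≡ true) → (if a then 1 else 0) ≤ (if b then 1 else 0)
  ind-mono {false} _ = z≤n
  ind-mono {true} f rewrite f refl = ≤-refl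

  ∑-mono : ∀ {f g : A → ℕ} xs → (∀ x → x ∈ xs → f x ≤ g x) → ∑ f xs ≤ ∑ g xs
  ∑-mono [] h = z≤n
  ∑-mono (x ∷ xs) h = +-mono-≤ (h x (here refl)) (∑-mono xs λ y m → h y (there m))

  ∑-cong : ∀ {f g : A → ℕ} xs → (∀ x → f x ≡ g x) → ∑ f xs ≡ ∑ g xs
  ∑-cong [] h = refl
  ∑-cong (x ∷ xs) h = cong₂ _+_ (h x) (∑-cong xs h)

  ∑-+ : ∀ (f g : A → ℕ) xs → ∑ (λ x → f x + g x) xs ≡ ∑ f xs + ∑ g xs
  ∑-+ f g [] = refl
  ∑-+ f g (x ∷ xs) rewrite ∑-+ f g xs = lem (f x) (g x) (∑ f xs) (∑ g xs)
    where
    lem : ∀ a b c d → a + b + (c + d) ≡ a + c + (b + d)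
    lem = solve-∀

  ∑-const : ∀ c (xs : List A) → ∑ (λ _ → c) xs ≡ length xs * c
  ∑-const c [] = refl
  ∑-const c (x ∷ xs) = cong (c +_) (∑-const c xs)

  ∑-* : ∀ c (f : A → ℕ) xs → ∑ (λ x → c * f x) xs ≡ c * ∑ f xs
  ∑-* c f [] = sym (*-zeroʳ c)
  ∑-* c f (x ∷ xs) rewrite ∑-* c f xs = sym (*-distribˡ-+ c (f x) (∑ f xs))

  ∑-swap : ∀ (f : A → B → ℕ) xs ys → ∑ (λ x → ∑ (f x) ys) xs ≡ ∑ (λ y → ∑ (λ x → f x y) xs) ys
  ∑-swap f [] ys = sym (trans (∑-const 0 ys) (*-zeroʳ (length ys)))
  ∑-swap f (x ∷ xs) ys rewrite ∑-swap f xs ys = sym (∑-+ (f x) (λ y → ∑ (λ z → f z y) xs) ys)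

  ∑-++ : ∀ (f : A → ℕ) xs ys → ∑ f (xs ++ ys) ≡ ∑ f xs + ∑ f ys
  ∑-++ f [] ys = refl
  ∑-++ f (x ∷ xs) ys rewrite ∑-++ f xs ys = sym (+-assoc (f x) _ _)

  ∑-≤-const : ∀ {f : A → ℕ} xs c → (∀ x → x ∈ xs → f x ≤ c) → ∑ f xs ≤ length xs * c
  ∑-≤-const xs c h = ≤-trans (∑-mono xs h) (≤-reflexive (∑-const c xs))

  ∑-≥-const : ∀ {f : A → ℕ} xs c → (∀ x → x ∈ xs → c ≤ f x) → length xs * c ≤ ∑ f xs
  ∑-≥-const xs c h = ≤-trans (≤-reflexive (sym (∑-const c xs))) (∑-mono xs h)

  ∑-pigeonhole : ∀ (f : A → ℕ) xs c → length xs * c < ∑ f xs → ∃ λ x → x ∈ xs × c < f x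
  ∑-pigeonhole f (x ∷ xs) c h with c <? f x
  ... | yes p = x , here refl , p
  ... | no ¬p with ∑-pigeonhole f xs c (+-cancelˡ-< c _ _ (<-≤-trans h (+-monoˡ-≤ _ (≮⇒≥ ¬p))))
  ...   | y , m , q = y , there m , q

  cnt-mono : ∀ {p q : A → Bool} xs → (∀ x → x ∈ xs → p x ≡ true → q x ≡ true) → cnt p xs ≤ cnt q xs
  cnt-mono xs h = ∑-mono xs λ x m → ind-mono (h x m)

  cnt≤length : ∀ (p : A → Bool) xs → cnt p xs ≤ length xs
  cnt≤length p xs = ≤-trans (∑-≤-const xs 1 λ x _ → ind≤1 (p x)) (≤-reflexive (*-identityʳ _))

  cnt-∈ : ∀ (p : A → Bool) xs → 0 < cnt p xs → ∃ λ x → x ∈ xs × p x ≡ true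
  cnt-∈ p (x ∷ xs) h with p x in eq
  ... | true = x , here refl , eq
  ... | false with cnt-∈ p xs h
  ...   | y , m , e = y , there m , e

  cnt-pos : ∀ (p : A → Bool) xs {x} → x ∈ xs → p x ≡ true → 0 < cnt p xs
  cnt-pos p (x ∷ xs) (here refl) e rewrite e = s≤s z≤n
  cnt-pos p (x ∷ xs) (there m) e = ≤-trans (cnt-pos p xs m e) (m≤n+m _ _)

  cnt-split : ∀ (p q : A → Bool) xs → cnt p xs ≡ cnt (λ x → p x ∧ q x) xs + cnt (λ x → p x ∧ not (q x)) xs
  cnt-split p q xs = trans (∑-cong xs λ x → lem (p x) (q x)) (∑-+ _ _ xs)
    where
    lem : ∀ a b → (if a then 1 else 0) ≡ (if a ∧ b then 1 else 0) + (if a ∧ not b then 1 else 0)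
    lem true true = refl
    lem true false = refl
    lem false _ = refl

  cnt-∨-≤ : ∀ (p q : A → Bool) xs → cnt (λ x → p x ∨ q x) xs ≤ cnt p xs + cnt q xs
  cnt-∨-≤ p q xs = ≤-trans (∑-mono xs λ x _ → lem (p x) (q x)) (≤-reflexive (∑-+ _ _ xs))
    where
    lem : ∀ a b → (if a ∨ b then 1 else 0) ≤ (if a then 1 else 0) + (if b then 1 else 0)
    lem true _ = s≤s z≤n
    lem false _ = ≤-refl

  cnt-disjoint-+ : ∀ (p q r : A → Bool) xs → (∀ x → p x ≡ true → r x ≡ true) → (∀ x → q x ≡ true → r x ≡ true) →
    (∀ x → p x ≡ true → q x ≡ true → ⊥) → cnt p xs + cnt q xs ≤ cnt r xs
  cnt-disjoint-+ p q r xs pr qr pq = ≤-trans (≤-reflexive (sym (∑-+ _ _ xs))) (∑-mono xs λ x _ → lem (p x) (q x) (r x) (pr x) (qr x) (pq x))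
    where
    lem : ∀ a b c → (a ≡ true → c ≡ true) → (b ≡ true → c ≡ true) → (a ≡ true → b ≡ true → ⊥) →
      (if a then 1 else 0) + (if b then 1 else 0) ≤ (if c then 1 else 0)
    lem true true c _ _ h = ⊥-elim (h refl refl)
    lem true false c h _ _ rewrite h refl = ≤-refl
    lem false true c _ h _ rewrite h refl = ≤-refl
    lem false false c _ _ _ = z≤n

  ∑-≤-exceptional : ∀ (f : A → ℕ) (p : A → Bool) xs c d → (∀ x → p x ≡ false → f x ≤ c) → (∀ x → f x ≤ d) →
    ∑ f xs ≤ length xs * c + d * cnt p xs
  ∑-≤-exceptional f p xs c d small large = begin
    ∑ f xs ≤⟨ ∑-mono xs (λ x _ → each x) ⟩
    ∑ (λ x → c + d * (if p x then 1 else 0)) xs ≡⟨ ∑-+ (λ _ → c) (λ x → d * (if p x then 1 else 0)) xs ⟩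
    ∑ (λ _ → c) xs + ∑ (λ x → d * (if p x then 1 else 0)) xs ≡⟨ cong₂ _+_ (∑-const c xs) (∑-* d (λ x → if p x then 1 else 0) xs) ⟩
    length xs * c + d * cnt p xs ∎
    where
    open ≤-Reasoning
    each : ∀ x → f x ≤ c + d * (if p x then 1 else 0)
    each x with p x in eq
    ... | true = ≤-trans (≤-trans (large x) (≤-reflexive (sym (*-identityʳ d)))) (m≤n+m (d * 1) c)
    ... | false = ≤-trans (small x eq) (m≤m+n c (d * 0))

  length-filterᵇ : ∀ (p : A → Bool) xs → length (filterᵇ p xs) ≡ cnt p xs
  length-filterᵇ p [] = refl
  length-filterᵇ p (x ∷ xs) with p x
  ... | true = cong suc (length-filterᵇ p xs)
  ... | false = length-filterᵇ p xs

  ∈-filterᵇ⁻ : ∀ (p : A → Bool) xs {x} → x ∈ filterᵇ p xs → x ∈ xs × p x ≡ true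
  ∈-filterᵇ⁻ p (y ∷ xs) m with p y in eq
  ∈-filterᵇ⁻ p (y ∷ xs) (here refl) | true = here refl , eq
  ∈-filterᵇ⁻ p (y ∷ xs) (there m) | true = let a , b = ∈-filterᵇ⁻ p xs m in there a , b
  ... | false = let a , b = ∈-filterᵇ⁻ p xs m in there a , b

  ∈-filterᵇ⁺ : ∀ (p : A → Bool) xs {x} → x ∈ xs → p x ≡ true → x ∈ filterᵇ p xs
  ∈-filterᵇ⁺ p (y ∷ xs) m e with p y in eq
  ∈-filterᵇ⁺ p (y ∷ xs) (here refl) e | true = here refl
  ∈-filterᵇ⁺ p (y ∷ xs) (there m) e | true = there (∈-filterᵇ⁺ p xs m e)
  ∈-filterᵇ⁺ p (y ∷ xs) (here refl) e | false = true≢false e eq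
  ∈-filterᵇ⁺ p (y ∷ xs) (there m) e | false = ∈-filterᵇ⁺ p xs m e

  unique-filterᵇ : ∀ (p : A → Bool) {xs} → Unique xs → Unique (filterᵇ p xs)
  unique-filterᵇ p [] = []
  unique-filterᵇ p {x ∷ xs} (a ∷ u) with p x
  ... | true = All.tabulate (λ m → All.lookup a (proj₁ (∈-filterᵇ⁻ p xs m))) ∷ unique-filterᵇ p u
  ... | false = unique-filterᵇ p u

  ∈-take⁻ : ∀ c (xs : List A) {x} → x ∈ take c xs → x ∈ xs
  ∈-take⁻ (suc c) (y ∷ xs) (here e) = here e
  ∈-take⁻ (suc c) (y ∷ xs) (there m) = there (∈-take⁻ c xs m)

  length-take-≤ : ∀ c (xs : List A) → c ≤ length xs → length (take c xs) ≡ c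
  length-take-≤ c xs h = trans (length-take c xs) (m≤n⇒m⊓n≡m h)

  -- Vertices and lists of vertices

  module _ {n : ℕ} where

    infix 5 _==_ _∈ᵇ_

    _==_ : Fin n → Fin n → Bool
    u == v = does (u Finₚ.≟ v)

    ==-refl : ∀ u → (u == u) ≡ true
    ==-refl u with u Finₚ.≟ u
    ... | yes _ = refl
    ... | no ¬p = ⊥-elim (¬p refl)

    ==-≡ : ∀ {u v} → (u == v) ≡ true → u ≡ v
    ==-≡ {u} {v} h with u Finₚ.≟ v
    ... | yes p = p

    _∈ᵇ_ : Fin n → List (Fin n) → Bool
    v ∈ᵇ [] = false
    v ∈ᵇ (c ∷ C) = (v == c) ∨ (v ∈ᵇ C)

    ∈ᵇ⁺ : ∀ {v C} → v ∈ C → (v ∈ᵇ C) ≡ true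
    ∈ᵇ⁺ {v} (here refl) rewrite ==-refl v = refl
    ∈ᵇ⁺ {v} {c ∷ C} (there m) with v == c
    ... | true = refl
    ... | false = ∈ᵇ⁺ m

    ∈ᵇ⁻ : ∀ {v C} → (v ∈ᵇ C) ≡ true → v ∈ C
    ∈ᵇ⁻ {v} {c ∷ C} h with v == c in eq
    ... | true = here (==-≡ eq)
    ... | false = there (∈ᵇ⁻ h)

    ∉ᵇ⁻ : ∀ {v C} → not (v ∈ᵇ C) ≡ true → v ∉ C
    ∉ᵇ⁻ h m = true≢false (∈ᵇ⁺ m) (not-true h)

    Vs : List (Fin n)
    Vs = allFin n

    ∣_∣ : (Fin n → Bool) → ℕ
    ∣ p ∣ = cnt p Vs

    ∣∣-∈ : ∀ p → 0 < ∣ p ∣ → ∃ λ v → p v ≡ true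
    ∣∣-∈ p h = let v , _ , e = cnt-∈ p Vs h in v , e

    ∣∣-pos : ∀ p {v} → p v ≡ true → 0 < ∣ p ∣
    ∣∣-pos p {v} = cnt-pos p Vs (∈-allFin v)

    ∣∣-mono : ∀ {p q} → (∀ v → p v ≡ true → q v ≡ true) → ∣ p ∣ ≤ ∣ q ∣
    ∣∣-mono h = cnt-mono Vs λ v _ → h v

    length-Vs : length Vs ≡ n
    length-Vs = length-tabulate {n = n} id

    ∣∣≤n : ∀ p → ∣ p ∣ ≤ n
    ∣∣≤n p = ≤-trans (cnt≤length p Vs) (≤-reflexive length-Vs)

    private
      cnt-none : ∀ (p : Fin n → Bool) c {xs} → All (c ≢_) xs → cnt (λ v → p v ∧ (v == c)) xs ≡ 0
      cnt-none p c [] = refl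
      cnt-none p c {x ∷ xs} (a ∷ as) with x Finₚ.≟ c
      ... | yes e = ⊥-elim (a (sym e))
      ... | no _ with p x
      ...   | true = cnt-none p c as
      ...   | false = cnt-none p c as

      cnt-one : ∀ (p : Fin n → Bool) c {xs} → Unique xs → cnt (λ v → p v ∧ (v == c)) xs ≤ (if p c then 1 else 0)
      cnt-one p c [] = z≤n
      cnt-one p c {x ∷ xs} (a ∷ u) with x Finₚ.≟ c
      ... | yes refl rewrite cnt-none p c a with p c
      ...   | true = ≤-refl
      ...   | false = z≤n
      cnt-one p c {x ∷ xs} (a ∷ u) | no _ with p x
      ...   | true = cnt-one p c u
      ...   | false = cnt-one p c u

    -- One entry of `C` removes at most one element of `xs`, as `xs` has no repetitions; the entries
    -- of `C` are counted with multiplicity.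
    cnt-remove : ∀ p {xs} C → Unique xs → cnt p xs ≤ cnt (λ v → p v ∧ not (v ∈ᵇ C)) xs + cnt p C
    cnt-remove p {xs} [] un = ≤-trans (cnt-mono xs (λ v _ e → ∧-intro e refl)) (m≤m+n _ _)
    cnt-remove p {xs} (c ∷ C) un = begin
      cnt p xs                                ≤⟨ cnt-remove p C un ⟩
      cnt q xs + cnt p C                      ≡⟨ cong (_+ cnt p C) (cnt-split q (_== c) xs) ⟩
      cnt (λ v → q v ∧ (v == c)) xs + cnt (λ v → q v ∧ not (v == c)) xs + cnt p C
                                              ≤⟨ +-monoˡ-≤ (cnt p C) (+-mono-≤ (≤-trans (cnt-mono xs stronger) (cnt-one p c un)) (cnt-mono xs reassoc)) ⟩
      (if p c then 1 else 0) + cnt r xs + cnt p C ≡⟨ lem (if p c then 1 else 0) (cnt r xs) (cnt p C) ⟩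
      cnt r xs + cnt p (c ∷ C)                ∎
      where
      open ≤-Reasoning
      q r : Fin n → Bool
      q v = p v ∧ not (v ∈ᵇ C)
      r v = p v ∧ not (v ∈ᵇ (c ∷ C))
      stronger : ∀ v → v ∈ xs → q v ∧ (v == c) ≡ true → p v ∧ (v == c) ≡ true
      stronger v _ e = let a , b = ∧-true (q v) e in ∧-intro (proj₁ (∧-true (p v) a)) b
      reassoc : ∀ v → v ∈ xs → q v ∧ not (v == c) ≡ true → r v ≡ true
      reassoc v _ e with p v | v ∈ᵇ C | v == c
      ... | true | false | false = refl
      lem : ∀ a b c → a + b + c ≡ b + (a + c)
      lem = solve-∀

    ∣∣-remove : ∀ p C → ∣ p ∣ ≤ ∣ (λ v → p v ∧ not (v ∈ᵇ C)) ∣ + cnt p C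
    ∣∣-remove p C = cnt-remove p C (Uniqueₚ.allFin⁺ n)

    ∣∣-avoid : ∀ p C → ∣ p ∣ ≤ ∣ (λ v → p v ∧ not (v ∈ᵇ C)) ∣ + length C
    ∣∣-avoid p C = ≤-trans (∣∣-remove p C) (+-monoʳ-≤ _ (cnt≤length p C))

    pick : ∀ p C → length C < ∣ p ∣ → ∃ λ v → p v ≡ true × v ∉ C
    pick p C h = let v , e = ∣∣-∈ _ (+-cancelʳ-< (length C) 0 _ (<-≤-trans h (∣∣-avoid p C)))
                     a , b = ∧-true (p v) e
                 in v , a , ∉ᵇ⁻ b

  dec-true : ∀ {P : Set} (d : Dec P) → does d ≡ true → P
  dec-true (yes p) _ = p

  dec-false : ∀ {P : Set} (d : Dec P) → does d ≡ false → ¬ P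
  dec-false (no ¬p) _ = ¬p

  true-dec : ∀ {P : Set} (d : Dec P) → P → does d ≡ true
  true-dec (yes _) _ = refl
  true-dec (no ¬p) p = ⊥-elim (¬p p)

  ∨-right : ∀ a {b} → b ≡ true → a ∨ b ≡ true
  ∨-right true _ = refl
  ∨-right false e = e

  bool-all? : ∀ {P : Bool → Set} → (∀ b → Dec (P b)) → Dec (∀ b → P b)
  bool-all? P? = map′ (λ { (p , q) true → p ; (p , q) false → q }) (λ f → f true , f false) (P? true ×-dec P? false)

  -- The bipartite double cover, separations and robust subpairs.

  module Graph {n : ℕ} (D : Digraph n) where

    V : Set
    V = Fin n

    -- Vertices play two roles: side true (tail of its arcs) and side false (head of its arcs).
    E : Bool → V → V → Bool
    E true u v = D u v
    E false u v = D v u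

    E-sym : ∀ b u v → E b u v ≡ true → E (not b) v u ≡ true
    E-sym true u v e = e
    E-sym false u v e = e

    E-sym′ : ∀ b u v → E (not b) u v ≡ true → E b v u ≡ true
    E-sym′ true u v e = e
    E-sym′ false u v e = e

    Pair : Set
    Pair = Bool → V → Bool

    deg : Bool → V → (V → Bool) → ℕ
    deg b v S = ∣ (λ w → E b v w ∧ S w) ∣

    deg-mono : ∀ b v {S S'} → (∀ w → S w ≡ true → S' w ≡ true) → deg b v S ≤ deg b v S'
    deg-mono b v h = ∣∣-mono λ w e → let x , y = ∧-true (E b v w) e in ∧-intro x (h w y)

    deg-split : ∀ b v (S S₁ S₂ : V → Bool) → (∀ w → S w ≡ true → S₁ w ≡ false → S₂ w ≡ true) →
      deg b v S ≤ deg b v S₁ + deg b v S₂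
    deg-split b v S S₁ S₂ h = ≤-trans (∣∣-mono λ w e → lem w (∧-true (E b v w) e)) (cnt-∨-≤ (λ w → E b v w ∧ S₁ w) (λ w → E b v w ∧ S₂ w) (Vs {n}))
      where
      lem : ∀ w → E b v w ≡ true × S w ≡ true → (E b v w ∧ S₁ w) ∨ (E b v w ∧ S₂ w) ≡ true
      lem w (e , s) with S₁ w in eq
      ... | true rewrite e = refl
      ... | false rewrite e | h w s eq = refl

    deg≤∣∣ : ∀ b v S → deg b v S ≤ ∣ S ∣
    deg≤∣∣ b v S = ∣∣-mono λ w e → proj₂ (∧-true (E b v w) e)

    size : Pair → ℕ
    size Z = ∣ Z true ∣ + ∣ Z false ∣

    size≤ : ∀ Z → size Z ≤ n + n
    size≤ Z = +-mono-≤ (∣∣≤n (Z true)) (∣∣≤n (Z false))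

    infix 4 _⊑_
    _⊑_ : Pair → Pair → Set
    Z ⊑ Z' = ∀ b v → Z b v ≡ true → Z' b v ≡ true

    NonEmpty : Pair → Set
    NonEmpty Z = ∃ λ b → ∃ λ v → Z b v ≡ true

    MinDeg : ℕ → Pair → Set
    MinDeg d Z = ∀ b v → Z b v ≡ true → d ≤ deg b v (Z (not b))

    side-large : ∀ {d Z} → NonEmpty Z → MinDeg d Z → 0 < d → ∀ b → d ≤ ∣ Z b ∣
    side-large {d} {Z} (b₀ , v₀ , e₀) md d>0 = lem b₀ v₀ e₀
      where
      opposite : ∀ b v → Z b v ≡ true → d ≤ ∣ Z (not b) ∣
      opposite b v e = ≤-trans (md b v e) (deg≤∣∣ b v (Z (not b)))
      lem : ∀ b v → Z b v ≡ true → ∀ c → d ≤ ∣ Z c ∣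
      lem true v e false = opposite true v e
      lem false v e true = opposite false v e
      lem true v e true = let w , e' = ∣∣-∈ (Z false) (≤-trans d>0 (opposite true v e)) in opposite false w e'
      lem false v e false = let w , e' = ∣∣-∈ (Z true) (≤-trans d>0 (opposite false v e)) in opposite true w e'

    _∖_ : Pair → Pair → Pair
    (Z ∖ Z') b v = Z b v ∧ not (Z' b v)

    -- `Z'` is the part that would be kept. Passing to it costs each of its vertices at most `τ`
    -- neighbours, while the size drops by at least `d`. Nothing is asked of the discarded rest.
    record Separation (d τ : ℕ) (Z Z' : Pair) : Set where
      constructor sep
      field
        sub : Z' ⊑ Z
        nonempty : NonEmpty Z'
        large : d + size Z' ≤ size Z
        few : ∀ b v → Z' b v ≡ true → deg b v ((Z ∖ Z') (not b)) ≤ τ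

    Robust : ℕ → ℕ → Pair → Set
    Robust d τ Z = ∀ Z' → ¬ Separation d τ Z Z'

    private
      bool-any? : ∀ {P : Bool → Set} → (∀ b → Dec (P b)) → Dec (∃ P)
      bool-any? P? with P? true | P? false
      ... | yes p | _ = yes (true , p)
      ... | no _ | yes q = yes (false , q)
      ... | no ¬p | no ¬q = no λ { (true , p) → ¬p p ; (false , q) → ¬q q }

      pairOf : Subset n → Subset n → Pair
      pairOf S T true = Vec.lookup S
      pairOf S T false = Vec.lookup T

      pairOf-tabulate : ∀ (Z : Pair) b v → pairOf (Vec.tabulate (Z true)) (Vec.tabulate (Z false)) b v ≡ Z b v
      pairOf-tabulate Z true v = Vecₚ.lookup∘tabulate (Z true) v
      pairOf-tabulate Z false v = Vecₚ.lookup∘tabulate (Z false) v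

    -- Makes case distinctions over all pairs constructive by running through Boolean vectors. A
    -- pair and its tabulation agree only pointwise, which is why `P` has to respect pointwise
    -- equality.
    any-pair? : ∀ {P : Pair → Set} → (∀ Z → Dec (P Z)) → (∀ {Z₁ Z₂} → (∀ b v → Z₂ b v ≡ Z₁ b v) → P Z₁ → P Z₂) → Dec (∃ P)
    any-pair? P? resp = map′ (λ { (S , T , p) → pairOf S T , p })
      (λ { (Z , p) → Vec.tabulate (Z true) , Vec.tabulate (Z false) , resp (pairOf-tabulate Z) p })
      (anySubset? λ S → anySubset? λ T → P? (pairOf S T))

    private
      separation? : ∀ d τ Z Z' → Dec (Separation d τ Z Z')
      separation? d τ Z Z' = map′ (λ { (a , b , c , e) → sep a b c e }) (λ { (sep a b c e) → a , b , c , e })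
        (bool-all? (λ b → Finₚ.all? λ v → (Z' b v Boolₚ.≟ true) →-dec (Z b v Boolₚ.≟ true))
        ×-dec bool-any? (λ b → Finₚ.any? λ v → Z' b v Boolₚ.≟ true)
        ×-dec (d + size Z' ≤? size Z)
        ×-dec bool-all? (λ b → Finₚ.all? λ v → (Z' b v Boolₚ.≟ true) →-dec (deg b v ((Z ∖ Z') (not b)) ≤? τ)))

      separation-resp : ∀ {d τ Z Z₁ Z₂} → (∀ b v → Z₂ b v ≡ Z₁ b v) → Separation d τ Z Z₁ → Separation d τ Z Z₂
      separation-resp {d} {τ} {Z} {Z₁} {Z₂} eq (sep s (b₀ , v₀ , e₀) l f) = sep
        (λ b v e → s b v (trans (sym (eq b v)) e))
        (b₀ , v₀ , trans (eq b₀ v₀) e₀)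
        (≤-trans (+-monoʳ-≤ d (+-mono-≤ (∣∣-mono λ v → trans (sym (eq true v))) (∣∣-mono λ v → trans (sym (eq false v))))) l)
        (λ b v e → ≤-trans (deg-mono b v λ w h → subst (λ x → Z (not b) w ∧ not x ≡ true) (eq (not b) w) h) (f b v (trans (sym (eq b v)) e)))

      separated? : ∀ d τ Z → Dec (∃ (Separation d τ Z))
      separated? d τ Z = any-pair? (separation? d τ Z) separation-resp

    -- Separations are followed as long as they exist. Each costs `τ` of the minimum degree and at
    -- least `d` of the size; size at most `r * d` allows fewer than `r` of them before a nonempty
    -- pair would be used up, and the surplus `r * τ` pays for the degrees.
    robust-subpair : ∀ r d τ Z → NonEmpty Z → MinDeg (d + r * τ) Z → size Z ≤ r * d →
      ∃ λ Z' → NonEmpty Z' × MinDeg d Z' × Robust d τ Z'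
    robust-subpair zero d τ Z (true , v , e) _ s = ⊥-elim (<⇒≱ (∣∣-pos (Z true) e) (≤-trans (m≤m+n _ _) s))
    robust-subpair zero d τ Z (false , v , e) _ s = ⊥-elim (<⇒≱ (∣∣-pos (Z false) e) (≤-trans (m≤n+m _ _) s))
    robust-subpair (suc r) d τ Z ne md s with separated? d τ Z
    ... | no ¬p = Z , ne , (λ b v e → ≤-trans (m≤m+n d _) (md b v e)) , λ Z' p → ¬p (Z' , p)
    ... | yes (Z' , sep sub ne' l few) = robust-subpair r d τ Z' ne'
      (λ b v e → +-cancelʳ-≤ τ _ _ (begin
        d + r * τ + τ     ≡⟨ lem d r τ ⟩
        d + suc r * τ     ≤⟨ md b v (sub b v e) ⟩
        deg b v (Z (not b)) ≤⟨ deg-split b v _ (Z' (not b)) ((Z ∖ Z') (not b)) (λ w z z' → ∧-intro z (cong not z')) ⟩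
        deg b v (Z' (not b)) + deg b v ((Z ∖ Z') (not b)) ≤⟨ +-monoʳ-≤ _ (few b v e) ⟩
        deg b v (Z' (not b)) + τ ∎))
      (+-cancelˡ-≤ d _ _ (≤-trans l s))
      where
      open ≤-Reasoning
      lem : ∀ d r τ → d + r * τ + τ ≡ d + suc r * τ
      lem = solve-∀

    data Walk : Bool → V → List V → Bool → V → Set where
      arc : ∀ {b u v} → E b u v ≡ true → Walk b u [] (not b) v
      _⟶_ : ∀ {b u w ps c v} → E b u w ≡ true → Walk (not b) w ps c v → Walk b u (w ∷ ps) c v

    -- Short alternating paths in a robust pair.

    module Connect (Z : Pair) (d σ : ℕ) (robust : Robust d (σ + σ) Z) (mindeg : MinDeg d Z) where

      next : Pair → Pair
      next R b v = R b v ∨ (Z b v ∧ does (σ ≤? deg b v (R (not b))))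

      iterate : ℕ → Pair → Pair
      iterate zero R = R
      iterate (suc f) R = iterate f (next R)

      next⁺ : ∀ R → R ⊑ next R
      next⁺ R b v e rewrite e = refl

      next⊑ : ∀ R → R ⊑ Z → next R ⊑ Z
      next⊑ R s b v e with R b v in eq
      ... | true = s b v eq
      ... | false = proj₁ (∧-true (Z b v) e)

      iterate⁺ : ∀ f R → R ⊑ iterate f R
      iterate⁺ zero R b v e = e
      iterate⁺ (suc f) R b v e = iterate⁺ f (next R) b v (next⁺ R b v e)

      -- If `next R` misses part of `Z` and gains fewer than `σ` vertices, then that missing part is
      -- a separation. Its vertices have at most `σ` neighbours in `R`, since they were not added,
      -- and at most `σ` among the new vertices, since there are so few of them; `R` itself supplies
      -- the `d` discarded vertices.
      grow : ∀ R → R ⊑ Z → d ≤ size R → Z ⊑ next R ⊎ (size R + σ ≤ size (next R))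
      grow R sub dR with size R + σ ≤? size (next R)
      ... | yes p = inj₂ p
      ... | no ¬p = inj₁ λ b v z → lem b v z
        where
        lt : size (next R) < size R + σ
        lt = ≰⇒> ¬p
        new : Bool → ℕ
        new b = ∣ (λ v → next R b v ∧ not (R b v)) ∣
        new-part : ∀ b → ∣ R b ∣ + new b ≤ ∣ next R b ∣
        new-part b = cnt-disjoint-+ _ _ _ Vs (λ v → next⁺ R b v) (λ v e → proj₁ (∧-true (next R b v) e))
          (λ v e e' → true≢false e (not-true (proj₂ (∧-true (next R b v) e'))))
        arith : ∀ a b x y s p q → a + x ≤ p → b + y ≤ q → p + q < a + b + s → x + y < s
        arith a b x y s p q h₁ h₂ h₃ = +-cancelˡ-< (a + b) _ _ (≤-<-trans (≤-trans (≤-reflexive (eq a b x y)) (+-mono-≤ h₁ h₂)) h₃)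
          where
          eq : ∀ a b x y → a + b + (x + y) ≡ a + x + (b + y)
          eq = solve-∀
        new-small : ∀ b → new b ≤ σ
        new-small true = ≤-trans (m≤m+n _ _) (<⇒≤ (arith (∣ R true ∣) (∣ R false ∣) (new true) (new false) _ _ _ (new-part true) (new-part false) lt))
        new-small false = ≤-trans (m≤n+m _ _) (<⇒≤ (arith (∣ R true ∣) (∣ R false ∣) (new true) (new false) _ _ _ (new-part true) (new-part false) lt))
        Z' : Pair
        Z' = Z ∖ next R
        thin : ∀ b v → Z' b v ≡ true → deg b v (R (not b)) ≤ σ
        thin b v e with ∧-true (Z b v) e
        ... | z , h with ≤-total (deg b v (R (not b))) σ
        ...   | inj₁ q = q
        ...   | inj₂ q = true≢false (∨-right (R b v) (∧-intro z (true-dec (σ ≤? deg b v (R (not b))) q))) (not-true h)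
        few : ∀ b v → Z' b v ≡ true → deg b v ((Z ∖ Z') (not b)) ≤ σ + σ
        few b v e = ≤-trans (deg-split b v _ (R (not b)) (λ w → next R (not b) w ∧ not (R (not b) w)) outside)
          (+-mono-≤ (thin b v e) (≤-trans (deg≤∣∣ b v _) (new-small (not b))))
          where
          outside : ∀ w → (Z ∖ Z') (not b) w ≡ true → R (not b) w ≡ false → next R (not b) w ∧ not (R (not b) w) ≡ true
          outside w h r with Z (not b) w | next R (not b) w
          ... | true | true rewrite r = refl
        side : ∀ b → ∣ R b ∣ + ∣ Z' b ∣ ≤ ∣ Z b ∣
        side b = cnt-disjoint-+ _ _ _ Vs (sub b) (λ v e → proj₁ (∧-true (Z b v) e))
          (λ v e e' → true≢false (next⁺ R b v e) (not-true (proj₂ (∧-true (Z b v) e'))))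
        large : d + size Z' ≤ size Z
        large = ≤-trans (+-monoˡ-≤ _ dR) (≤-trans (≤-reflexive (eq (∣ R true ∣) _ _ _)) (+-mono-≤ (side true) (side false)))
          where
          eq : ∀ a b x y → a + b + (x + y) ≡ a + x + (b + y)
          eq = solve-∀
        lem : ∀ b v → Z b v ≡ true → next R b v ≡ true
        lem b v z with next R b v in eq
        ... | true = refl
        ... | false = ⊥-elim (robust Z' (sep (λ b v e → proj₁ (∧-true (Z b v) e)) (b , v , ∧-intro z (cong not eq)) large few))

      exhaust : ∀ f R → R ⊑ Z → d ≤ size R → n + n < size R + f * σ → Z ⊑ iterate f R
      exhaust zero R s dR h = ⊥-elim (<⇒≱ h (≤-trans (≤-reflexive (+-identityʳ _)) (size≤ R)))
      exhaust (suc f) R s dR h with grow R s dR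
      ... | inj₁ all = λ b v z → iterate⁺ f (next R) b v (all b v z)
      ... | inj₂ g = exhaust f (next R) (next⊑ R s) (≤-trans dR (≤-trans (m≤m+n _ σ) g))
        (<-≤-trans h (≤-trans (≤-reflexive (sym (+-assoc (size R) σ (f * σ)))) (+-monoˡ-≤ (f * σ) g)))

      module _ (b : Bool) (u : V) (zu : Z b u ≡ true) where

        -- The budget `length F + i ≤ σ` lets `F` absorb one vertex per step: the vertex just chosen
        -- joins the forbidden list, which makes the path repetition-free. At each step there are
        -- `σ` candidates, more than the forbidden ones.
        Reach : ℕ → Bool → V → Set
        Reach i c v = ∀ F → length F + i ≤ σ →
          ∃ λ ps → Walk c v ps b u × length ps ≤ i × Unique ps × All (_∉ F) ps

        reach-next : ∀ i R → (∀ c v → R c v ≡ true → Reach i c v) → ∀ c v → next R c v ≡ true → Reach (suc i) c v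
        reach-next i R hyp c v e F lF with R c v in eq
        ... | true = let ps , w , l , un , av = hyp c v eq F (≤-trans (+-monoʳ-≤ _ (n≤1+n i)) lF)
                     in ps , w , m≤n⇒m≤1+n l , un , av
        ... | false with pick _ F (≤-trans (≤-trans (≤-trans (s≤s (m≤m+n _ i)) (≤-reflexive (sym (+-suc _ i)))) lF) (dec-true (σ ≤? _) (proj₂ (∧-true (Z c v) e))))
        ...   | w , ew , w∉F with ∧-true (E c v w) ew
        ...     | e₁ , e₂ with hyp (not c) w e₂ (w ∷ F) (≤-trans (≤-reflexive (sym (+-suc _ i))) lF)
        ...       | ps , wk , l , un , av = w ∷ ps , e₁ ⟶ wk , s≤s l
                    , All.map (λ h e → h (here (sym e))) av ∷ un , w∉F ∷ All.map (λ h m → h (there m)) av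

        reach-iterate : ∀ f i R → (∀ c v → R c v ≡ true → Reach i c v) → ∀ c v → iterate f R c v ≡ true → Reach (f + i) c v
        reach-iterate zero i R hyp = hyp
        reach-iterate (suc f) i R hyp c v e = subst (λ j → Reach j c v) (+-suc f i)
          (reach-iterate f (suc i) (next R) (reach-next i R hyp) c v e)

        start : Pair
        start c v = (b xor c) ∧ (E b u v ∧ Z c v)

        start-size : d ≤ size start
        start-size = ≤-trans (mindeg b u zu) (lem b refl)
          where
          lem : ∀ b' → b ≡ b' → deg b u (Z (not b)) ≤ size start
          lem true refl = m≤n+m _ _
          lem false refl = m≤m+n _ _

        xor-not : ∀ b c → b xor c ≡ true → b ≡ not c
        xor-not true false _ = refl
        xor-not false true _ = refl

        reach-start : ∀ c v → start c v ≡ true → Reach 0 c v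
        reach-start c v e F _ with ∧-true (b xor c) e
        ... | x , y with xor-not b c x
        ...   | refl = [] , arc (E-sym′ c u v (proj₁ (∧-true (E (not c) u v) y))) , z≤n , [] , []

        -- Starting from the at least `d` neighbours of `u`, every round adds `σ` vertices or
        -- finishes. Since `Z` has size at most `n + n`, the `f` rounds exhaust it.
        connect : ∀ f → n + n < f * σ → ∀ c v → Z c v ≡ true → Reach f c v
        connect f h c v z = subst (λ j → Reach j c v) (+-identityʳ f)
          (reach-iterate f 0 start reach-start c v
            (exhaust f start (λ c v e → proj₂ (∧-true (E b u v) (proj₂ (∧-true (b xor c) e)))) start-size (<-≤-trans h (m≤n+m _ _)) c v z))

  -- Density increment and hubs.

  module Hubs {n : ℕ} (D : Digraph n) where
    open Graph D

    edges : Pair → ℕ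
    edges Z = ∑ (λ a → cnt (λ b → Z true a ∧ (D a b ∧ Z false b)) Vs) Vs

    edges-deg : ∀ b Z → edges Z ≡ ∑ (λ v → cnt (λ w → Z b v ∧ (E b v w ∧ Z (not b) w)) Vs) Vs
    edges-deg true Z = refl
    edges-deg false Z = trans (∑-swap (λ a b → if Z true a ∧ (D a b ∧ Z false b) then 1 else 0) Vs Vs)
      (∑-cong Vs λ v → ∑-cong Vs λ w → cong (λ x → if x then 1 else 0) (lem (Z true w) (D w v) (Z false v)))
      where
      lem : ∀ x y z → x ∧ (y ∧ z) ≡ z ∧ (y ∧ x)
      lem true true true = refl
      lem true true false = refl
      lem true false true = refl
      lem true false false = refl
      lem false true true = refl
      lem false true false = refl
      lem false false true = refl
      lem false false false = refl

    row-false : ∀ (p : V → Bool) → cnt (λ w → false ∧ p w) (Vs {n}) ≡ 0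
    row-false p = trans (∑-const 0 (Vs {n})) (*-zeroʳ (length (Vs {n})))

    edges-upper : ∀ b Z x c → (∀ v → Z b v ≡ true → x * deg b v (Z (not b)) ≤ c) → x * edges Z ≤ ∣ Z b ∣ * c
    edges-upper b Z x c h = begin
      x * edges Z ≡⟨ cong (x *_) (edges-deg b Z) ⟩
      x * ∑ row Vs ≡⟨ sym (∑-* x row Vs) ⟩
      ∑ (λ v → x * row v) Vs ≤⟨ ∑-mono Vs (λ v _ → lem v) ⟩
      ∑ (λ v → c * (if Z b v then 1 else 0)) Vs ≡⟨ ∑-* c (λ v → if Z b v then 1 else 0) Vs ⟩
      c * ∣ Z b ∣ ≡⟨ *-comm c _ ⟩
      ∣ Z b ∣ * c ∎
      where
      open ≤-Reasoning
      row : V → ℕ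
      row v = cnt (λ w → Z b v ∧ (E b v w ∧ Z (not b) w)) Vs
      lem : ∀ v → x * row v ≤ c * (if Z b v then 1 else 0)
      lem v with Z b v in eq
      ... | true = ≤-trans (h v eq) (≤-reflexive (sym (*-identityʳ c)))
      ... | false = ≤-trans (≤-reflexive (trans (cong (x *_) (row-false (λ w → E b v w ∧ Z (not b) w))) (*-zeroʳ x))) z≤n

    edges-lower : ∀ b Z c → (∀ v → Z b v ≡ true → c ≤ deg b v (Z (not b))) → ∣ Z b ∣ * c ≤ edges Z
    edges-lower b Z c h = begin
      ∣ Z b ∣ * c ≡⟨ *-comm _ c ⟩
      c * ∣ Z b ∣ ≡⟨ sym (∑-* c (λ v → if Z b v then 1 else 0) Vs) ⟩
      ∑ (λ v → c * (if Z b v then 1 else 0)) Vs ≤⟨ ∑-mono Vs (λ v _ → lem v) ⟩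
      ∑ row Vs ≡⟨ sym (edges-deg b Z) ⟩
      edges Z ∎
      where
      open ≤-Reasoning
      row : V → ℕ
      row v = cnt (λ w → Z b v ∧ (E b v w ∧ Z (not b) w)) Vs
      lem : ∀ v → c * (if Z b v then 1 else 0) ≤ row v
      lem v with Z b v in eq
      ... | true = ≤-trans (≤-reflexive (*-identityʳ c)) (h v eq)
      ... | false = ≤-trans (≤-reflexive (*-zeroʳ c)) z≤n

    edges≤ : ∀ Z → edges Z ≤ ∣ Z true ∣ * ∣ Z false ∣
    edges≤ Z = ≤-trans (≤-reflexive (sym (*-identityˡ (edges Z))))
      (edges-upper true Z 1 (∣ Z false ∣) λ v _ → ≤-trans (≤-reflexive (*-identityˡ _)) (deg≤∣∣ true v (Z false)))

    edges-∈ : ∀ b Z → 0 < edges Z → ∃ λ x → ∃ λ y → Z b x ≡ true × E b x y ≡ true × Z (not b) y ≡ true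
    edges-∈ b Z h with ∑-pigeonhole (λ v → cnt (λ w → Z b v ∧ (E b v w ∧ Z (not b) w)) Vs) Vs 0
      (≤-<-trans (≤-reflexive (*-zeroʳ (length (Vs {n})))) (<-≤-trans h (≤-reflexive (edges-deg b Z))))
    ... | x , _ , p with cnt-∈ (λ w → Z b x ∧ (E b x w ∧ Z (not b) w)) Vs p
    ...   | y , _ , e with ∧-true (Z b x) e
    ...     | e₁ , e₂ with ∧-true (E b x y) e₂
    ...       | e₃ , e₄ = x , y , e₁ , e₃ , e₄

    pair : (V → Bool) → (V → Bool) → Pair
    pair A B true = A
    pair A B false = B

    edges-split : ∀ Z Z' → edges Z ≤ edges (pair ((Z ∖ Z') true) (Z false)) + edges (pair (Z' true) ((Z ∖ Z') false)) + edges Z'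
    edges-split Z Z' = begin
      edges Z ≤⟨ ∑-mono Vs (λ a _ → ∑-mono Vs λ b _ → lem (Z true a) (Z' true a) (D a b) (Z false b) (Z' false b)) ⟩
      ∑ (λ a → ∑ (λ b → f₁ a b + f₂ a b + f₃ a b) Vs) Vs
        ≡⟨ ∑-cong Vs (λ a → trans (∑-+ (λ b → f₁ a b + f₂ a b) (f₃ a) Vs) (cong (_+ ∑ (f₃ a) Vs) (∑-+ (f₁ a) (f₂ a) Vs))) ⟩
      ∑ (λ a → ∑ (f₁ a) Vs + ∑ (f₂ a) Vs + ∑ (f₃ a) Vs) Vs
        ≡⟨ trans (∑-+ (λ a → ∑ (f₁ a) Vs + ∑ (f₂ a) Vs) (λ a → ∑ (f₃ a) Vs) Vs) (cong (_+ ∑ (λ a → ∑ (f₃ a) Vs) Vs) (∑-+ (λ a → ∑ (f₁ a) Vs) (λ a → ∑ (f₂ a) Vs) Vs)) ⟩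
      _ ∎
      where
      open ≤-Reasoning
      f₁ f₂ f₃ : V → V → ℕ
      f₁ a b = if (Z ∖ Z') true a ∧ (D a b ∧ Z false b) then 1 else 0
      f₂ a b = if Z' true a ∧ (D a b ∧ (Z ∖ Z') false b) then 1 else 0
      f₃ a b = if Z' true a ∧ (D a b ∧ Z' false b) then 1 else 0
      lem : ∀ z z' d y y' → (if z ∧ (d ∧ y) then 1 else 0) ≤
        (if (z ∧ not z') ∧ (d ∧ y) then 1 else 0) + (if z' ∧ (d ∧ (y ∧ not y')) then 1 else 0) + (if z' ∧ (d ∧ y') then 1 else 0)
      lem false _ _ _ _ = z≤n
      lem true _ false _ _ = z≤n
      lem true _ true false _ = z≤n
      lem true false true true _ = s≤s z≤n
      lem true true true true true = ≤-refl
      lem true true true true false = ≤-refl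

    edges-cong : ∀ {Z₁ Z₂ : Pair} → (∀ b v → Z₂ b v ≡ Z₁ b v) → edges Z₂ ≡ edges Z₁
    edges-cong eq = ∑-cong Vs λ a → ∑-cong Vs λ b → cong (λ x → if x then 1 else 0)
      (cong₂ (λ x y → x ∧ (D a b ∧ y)) (eq true a) (eq false b))

    ∣∣-cong : ∀ {p q : V → Bool} → (∀ v → p v ≡ q v) → ∣ p ∣ ≡ ∣ q ∣
    ∣∣-cong h = ∑-cong Vs λ v → cong (λ x → if x then 1 else 0) (h v)

    ∖-size : ∀ Z Z' → Z' ⊑ Z → ∀ b → ∣ (Z ∖ Z') b ∣ + ∣ Z' b ∣ ≡ ∣ Z b ∣
    ∖-size Z Z' s b = sym (trans (cnt-split (Z b) (Z' b) Vs) (trans (+-comm (cnt (λ x → Z b x ∧ Z' b x) Vs) _) (cong (∣ (Z ∖ Z') b ∣ +_) (∣∣-cong lem))))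
      where
      lem : ∀ v → Z b v ∧ Z' b v ≡ Z' b v
      lem v with Z' b v in eq
      ... | true rewrite s b v eq = refl
      ... | false with Z b v
      ...   | true = refl
      ...   | false = refl

    -- K and j measure densities in units of 1/K.
    record Sparse (r K j : ℕ) (Z Z' : Pair) : Set where
      constructor sparse
      field
        sub : Z' ⊑ Z
        wide : ∀ b → ∣ Z b ∣ ≤ r * ∣ Z' b ∣
        thin : 2 * K * edges Z' ≤ j * (∣ Z' true ∣ * ∣ Z' false ∣)

    sparse? : ∀ r K j Z Z' → Dec (Sparse r K j Z Z')
    sparse? r K j Z Z' = map′ (λ { (a , b , c) → sparse a b c }) (λ { (sparse a b c) → a , b , c })
      (bool-all? (λ b → Finₚ.all? λ v → (Z' b v Boolₚ.≟ true) →-dec (Z b v Boolₚ.≟ true))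
      ×-dec bool-all? (λ b → ∣ Z b ∣ ≤? r * ∣ Z' b ∣)
      ×-dec (2 * K * edges Z' ≤? j * (∣ Z' true ∣ * ∣ Z' false ∣)))

    sparse-resp : ∀ {r K j Z Z₁ Z₂} → (∀ b v → Z₂ b v ≡ Z₁ b v) → Sparse r K j Z Z₁ → Sparse r K j Z Z₂
    sparse-resp {r} {K} {j} eq (sparse s w t) = sparse
      (λ b v e → s b v (trans (sym (eq b v)) e))
      (λ b → ≤-trans (w b) (≤-reflexive (cong (r *_) (sym (∣∣-cong (eq b))))))
      (≤-trans (≤-reflexive (cong (2 * K *_) (edges-cong eq)))
        (≤-trans t (≤-reflexive (sym (cong₂ (λ x y → j * (x * y)) (∣∣-cong (eq true)) (∣∣-cong (eq false)))))))

    Regular : ℕ → ℕ → ℕ → Pair → Set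
    Regular r K j Z = ∀ Z' → ¬ Sparse r K j Z Z'

    private
      -- The rectangle of sides `a` and `b` is cut into `a₁` by `b`, `a'` by `b₁`, and the sparse
      -- `a'` by `b'`. If neither of the first two were denser than `(j + 1) / K`, up to an error of
      -- `a * b / (2 * K)` each, counting edges would give `(j + 2) * a' * b' ≤ 4 * a * b`. But
      -- `a * b ≤ r * r * a' * b'` and `4 * r * r ≤ j`, a contradiction.
      increment : ∀ r K j a a₁ a' b b₁ b' e e₁ e₂ e' → 4 * (r * r) ≤ j → 0 < a * b →
        a₁ + a' ≡ a → b₁ + b' ≡ b → j * (a * b) ≤ K * e → e ≤ e₁ + e₂ + e' → 2 * K * e' ≤ j * (a' * b') →
        a ≤ r * a' → b ≤ r * b' →
        2 * K * e₁ ≤ 2 * (suc j * (a₁ * b)) + a * b → 2 * K * e₂ ≤ 2 * (suc j * (a' * b₁)) + a * b → ⊥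
      increment r K j a a₁ a' b b₁ b' e e₁ e₂ e' hj pos refl refl h he ht wa wb h₁ h₂ = <⇒≱ final final'
        where
        open ≤-Reasoning
        w' = a' * b'
        ab = (a₁ + a') * (b₁ + b')
        ineq : 2 * (j * ab) ≤ 2 * (suc j * (a₁ * (b₁ + b'))) + ab + (2 * (suc j * (a' * b₁)) + ab) + j * w'
        ineq = begin
          2 * (j * ab) ≤⟨ *-monoʳ-≤ 2 h ⟩
          2 * (K * e) ≤⟨ *-monoʳ-≤ 2 (*-monoʳ-≤ K he) ⟩
          2 * (K * (e₁ + e₂ + e')) ≡⟨ eq K e₁ e₂ e' ⟩
          2 * K * e₁ + 2 * K * e₂ + 2 * K * e' ≤⟨ +-mono-≤ (+-mono-≤ h₁ h₂) ht ⟩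
          _ ∎
          where
          eq : ∀ K x y z → 2 * (K * (x + y + z)) ≡ 2 * K * x + 2 * K * y + 2 * K * z
          eq = solve-∀
        small : (j + 2) * w' ≤ 4 * ab
        small = ≤-by 0 ineq (eq j a₁ a' b₁ b')
          where
          eq : ∀ j a₁ a' b₁ b' → (j + 2) * (a' * b') + (2 * (suc j * (a₁ * (b₁ + b'))) + (a₁ + a') * (b₁ + b')
            + (2 * (suc j * (a' * b₁)) + (a₁ + a') * (b₁ + b')) + j * (a' * b')) + 0 ≡ 4 * ((a₁ + a') * (b₁ + b')) + 2 * (j * ((a₁ + a') * (b₁ + b')))
          eq = solve-∀
        bound : ab ≤ (r * r) * w'
        bound = ≤-trans (*-mono-≤ wa wb) (≤-reflexive (eq r a' b'))
          where
          eq : ∀ r a' b' → r * a' * (r * b') ≡ r * r * (a' * b')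
          eq = solve-∀
        final' : (j + 2) * w' ≤ j * w'
        final' = begin
          (j + 2) * w' ≤⟨ small ⟩
          4 * ab ≤⟨ *-monoʳ-≤ 4 bound ⟩
          4 * ((r * r) * w') ≡⟨ sym (*-assoc 4 (r * r) w') ⟩
          4 * (r * r) * w' ≤⟨ *-monoˡ-≤ w' hj ⟩
          j * w' ∎
        w'>0 : ∀ x → x ≡ w' → 0 < w'
        w'>0 zero eq = ⊥-elim (<⇒≱ pos (≤-trans bound (≤-reflexive (trans (cong (r * r *_) (sym eq)) (*-zeroʳ (r * r))))))
        w'>0 (suc x) eq = subst (0 <_) eq (s≤s z≤n)
        final : j * w' < (j + 2) * w'
        final = <-≤-trans (m<m+n (j * w') (w'>0 w' refl)) (≤-trans (+-monoʳ-≤ (j * w') (m≤m+n w' w')) (≤-reflexive (double j w')))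
          where
          double : ∀ j w → j * w + (w + w) ≡ (j + 2) * w
          double = solve-∀

      -- A piece is unusable if its density has not risen or if it is too narrow. In the second case
      -- it has few edges simply by its area; this is the error term `a * b`.
      fail : ∀ K j a a₁ b e → e ≤ a₁ * b → (¬ (suc j * (a₁ * b) ≤ K * e)) ⊎ (¬ (a ≤ 2 * K * a₁)) →
        2 * K * e ≤ 2 * (suc j * (a₁ * b)) + a * b
      fail K j a a₁ b e h (inj₁ ¬d) = ≤-trans (≤-reflexive (*-assoc 2 K e)) (≤-trans (*-monoʳ-≤ 2 (<⇒≤ (≰⇒> ¬d))) (m≤m+n _ _))
      fail K j a a₁ b e h (inj₂ ¬s) = ≤-trans (*-monoʳ-≤ (2 * K) h) (≤-trans (≤-reflexive (sym (*-assoc (2 * K) a₁ b)))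
        (≤-trans (*-monoˡ-≤ b (<⇒≤ (≰⇒> ¬s))) (m≤n+m _ _)))

      and? : ∀ {P Q : Set} → Dec P → Dec Q → (P × Q) ⊎ (¬ P ⊎ ¬ Q)
      and? (yes p) (yes q) = inj₁ (p , q)
      and? (no ¬p) _ = inj₂ (inj₁ ¬p)
      and? (yes _) (no ¬q) = inj₂ (inj₂ ¬q)

      scale : ∀ {y} c m x x' → y ≤ c * x → x ≤ m * x' → y ≤ c * m * x'
      scale c m x x' h h' = ≤-trans h (≤-trans (*-monoʳ-≤ c h') (≤-reflexive (sym (*-assoc c m x'))))

      pow : ∀ c m f → c * m * m ^ f ≡ c * m ^ suc f
      pow c m f = *-assoc c m (m ^ f)

    -- As long as a sparse subpair exists, one of the two complementary rectangles has density
    -- larger by `1 / K`, at the price of a factor `2 * K` in the sides. Densities cannot exceed 1,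
    -- so `K < j + f` bounds the rounds by `f`. The factor `c` accumulates the loss against the
    -- fixed initial size `y`.
    regular-subpair : ∀ r K .{{_ : NonZero K}} → r ≤ 2 * K → ∀ f j Z y c → K < j + f → 4 * (r * r) ≤ j → 0 < y →
      (∀ b → y ≤ c * ∣ Z b ∣) → j * (∣ Z true ∣ * ∣ Z false ∣) ≤ K * edges Z →
      ∃ λ Z' → ∃ λ j' → Z' ⊑ Z × j ≤ j' × (∀ b → y ≤ c * (2 * K) ^ f * ∣ Z' b ∣) × Regular r K j' Z'
    regular-subpair r K r≤ f j Z y c fuel hj y>0 sz dens with any-pair? (sparse? r K j Z) sparse-resp
    ... | no ¬p = Z , j , (λ _ _ e → e) , ≤-refl , (λ b → ≤-trans (sz b) (*-monoˡ-≤ (∣ Z b ∣) (m≤m*n c ((2 * K) ^ f) {{m^n≢0 (2 * K) f {{m*n≢0 2 K}}}}))) , λ Z' p → ¬p (Z' , p)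
    ... | yes (Z' , sparse sub wide thin) = go f fuel
      where
      a = ∣ Z true ∣
      b = ∣ Z false ∣
      Z₁ Z₂ : Pair
      Z₁ = pair ((Z ∖ Z') true) (Z false)
      Z₂ = pair (Z' true) ((Z ∖ Z') false)
      nonzero : ∀ x → y ≤ c * x → 0 < x
      nonzero zero h = ⊥-elim (<⇒≱ y>0 (≤-trans h (≤-reflexive (*-zeroʳ c))))
      nonzero (suc x) _ = s≤s z≤n
      pos : 0 < a * b
      pos = *-mono-≤ (nonzero a (sz true)) (nonzero b (sz false))
      Z₁⊑ : Z₁ ⊑ Z
      Z₁⊑ true v e = proj₁ (∧-true (Z true v) e)
      Z₁⊑ false v e = e
      Z₂⊑ : Z₂ ⊑ Z
      Z₂⊑ true v e = sub true v e
      Z₂⊑ false v e = proj₁ (∧-true (Z false v) e)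
      again : ∀ f → K < j + suc f → ∀ Z₀ → Z₀ ⊑ Z → (∀ b → ∣ Z b ∣ ≤ 2 * K * ∣ Z₀ b ∣) →
        suc j * (∣ Z₀ true ∣ * ∣ Z₀ false ∣) ≤ K * edges Z₀ →
        ∃ λ Z' → ∃ λ j' → Z' ⊑ Z × j ≤ j' × (∀ b → y ≤ c * (2 * K) ^ suc f * ∣ Z' b ∣) × Regular r K j' Z'
      again f h Z₀ s w dn with regular-subpair r K r≤ f (suc j) Z₀ y (c * (2 * K)) (≤-trans h (≤-reflexive (+-suc j f))) (m≤n⇒m≤1+n hj) y>0
        (λ b → scale c (2 * K) _ _ (sz b) (w b)) dn
      ... | Z″ , j″ , s″ , le , z″ , reg = Z″ , j″ , (λ b v e → s b v (s″ b v e)) , ≤-trans (n≤1+n j) le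
        , (λ b → subst (λ x → y ≤ x * ∣ Z″ b ∣) (pow c (2 * K) f) (z″ b)) , reg
      go : ∀ f → K < j + f → ∃ λ Z' → ∃ λ j' → Z' ⊑ Z × j ≤ j' × (∀ b → y ≤ c * (2 * K) ^ f * ∣ Z' b ∣) × Regular r K j' Z'
      go zero h = ⊥-elim (<⇒≱ (*-monoˡ-< (a * b) {{>-nonZero pos}} (<-≤-trans h (≤-reflexive (+-identityʳ j))))
        (≤-trans dens (*-monoʳ-≤ K (edges≤ Z))))
      go (suc f) h with and? (suc j * (∣ Z₁ true ∣ * b) ≤? K * edges Z₁) (a ≤? 2 * K * ∣ Z₁ true ∣)
      ... | inj₁ (dn , w) = again f h Z₁ Z₁⊑ (λ { true → w ; false → m≤n*m b (2 * K) {{m*n≢0 2 K}} }) dn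
      ... | inj₂ f₁ with and? (suc j * (∣ Z₂ true ∣ * ∣ Z₂ false ∣) ≤? K * edges Z₂) (b ≤? 2 * K * ∣ Z₂ false ∣)
      ...   | inj₁ (dn , w) = again f h Z₂ Z₂⊑ (λ { true → ≤-trans (wide true) (*-monoˡ-≤ (∣ Z' true ∣) r≤) ; false → w }) dn
      ...   | inj₂ f₂ = ⊥-elim (increment r K j a (∣ Z₁ true ∣) (∣ Z' true ∣) b (∣ Z₂ false ∣) (∣ Z' false ∣) (edges Z) (edges Z₁) (edges Z₂) (edges Z')
          hj pos (∖-size Z Z' sub true) (∖-size Z Z' sub false) dens (edges-split Z Z') thin (wide true) (wide false)
          (fail K j a (∣ Z₁ true ∣) b (edges Z₁) (edges≤ Z₁) f₁)
          (≤-trans (fail K j b (∣ Z₂ false ∣) (∣ Z₂ true ∣) (edges Z₂) (≤-trans (edges≤ Z₂) (≤-reflexive (*-comm (∣ Z₂ true ∣) _))) (comm f₂)) swap-bound))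
        where
        comm : (¬ (suc j * (∣ Z₂ true ∣ * ∣ Z₂ false ∣) ≤ K * edges Z₂)) ⊎ (¬ (b ≤ 2 * K * ∣ Z₂ false ∣)) →
          (¬ (suc j * (∣ Z₂ false ∣ * ∣ Z₂ true ∣) ≤ K * edges Z₂)) ⊎ (¬ (b ≤ 2 * K * ∣ Z₂ false ∣))
        comm (inj₁ x) = inj₁ λ y → x (subst (λ t → suc j * t ≤ K * edges Z₂) (*-comm (∣ Z₂ false ∣) (∣ Z₂ true ∣)) y)
        comm (inj₂ x) = inj₂ x
        swap-bound : 2 * (suc j * (∣ Z₂ false ∣ * ∣ Z₂ true ∣)) + b * ∣ Z₂ true ∣ ≤ 2 * (suc j * (∣ Z' true ∣ * ∣ Z₂ false ∣)) + a * b
        swap-bound = +-mono-≤ (≤-reflexive (cong (λ t → 2 * (suc j * t)) (*-comm (∣ Z₂ false ∣) (∣ Z' true ∣))))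
          (≤-trans (≤-reflexive (*-comm b _)) (*-monoˡ-≤ b (∣∣-mono (sub true))))

    -- A substitute for a regular pair: steps and paths of length 3 give paths of every exact length ≥ 3.
    record Hub (Z : Pair) (f : ℕ) : Set where
      field
        W : Pair
        W⊑Z : W ⊑ Z
        inhabited : ∀ b → ∃ λ v → W b v ≡ true
        step : ∀ b v → W b v ≡ true → ∀ F → length F ≤ f → ∃ λ y → W (not b) y ≡ true × E b v y ≡ true × y ∉ F
        three : ∀ b v w → W b v ≡ true → W (not b) w ≡ true → ∀ F → length F ≤ f →
          ∃ λ y → ∃ λ x → E b v y ≡ true × E b x y ≡ true × E b x w ≡ true × x ∉ F × y ∉ F

    -- `W` keeps the vertices whose degree exceeds half the density `j / K`. On either side the
    -- others form less than a fraction `1 / r`, since otherwise they would be sparse together with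
    -- the whole opposite side. Neighbourhoods inside `W` remain wide after deleting `f` vertices,
    -- so regularity gives an edge between any two of them on opposite sides, which is the middle
    -- edge of a path of length 3.
    regular⇒hub : ∀ r K j Z f .{{_ : NonZero K}} → Regular r K j Z → 6 * K ≤ r * j → 0 < r → r * f ≤ ∣ Z true ∣ → r * f ≤ ∣ Z false ∣ →
      0 < ∣ Z true ∣ → 0 < ∣ Z false ∣ → Hub Z f
    regular⇒hub r K j Z f reg h6 r>0 ft ff pt pf = record
      { W = W
      ; W⊑Z = W⊑Z
      ; inhabited = inhabited
      ; step = step
      ; three = three
      }
      where
      sz : ∀ b → r * f ≤ ∣ Z b ∣
      sz true = ft
      sz false = ff
      pos : ∀ b → 0 < ∣ Z b ∣
      pos true = pt
      pos false = pf
      High : Bool → V → Bool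
      High b v = does (j * ∣ Z (not b) ∣ <? 2 * K * deg b v (Z (not b)))
      W Low : Pair
      W b v = Z b v ∧ High b v
      Low b v = Z b v ∧ not (High b v)
      W⊑Z : W ⊑ Z
      W⊑Z b v e = proj₁ (∧-true (Z b v) e)
      low-deg : ∀ b v → Low b v ≡ true → 2 * K * deg b v (Z (not b)) ≤ j * ∣ Z (not b) ∣
      low-deg b v e = ≮⇒≥ (dec-false (_ <? _) (not-true (proj₂ (∧-true (Z b v) e))))
      high-deg : ∀ b v → W b v ≡ true → j * ∣ Z (not b) ∣ < 2 * K * deg b v (Z (not b))
      high-deg b v e = dec-true (_ <? _) (proj₂ (∧-true (Z b v) e))
      low-small : ∀ b → r * ∣ Low b ∣ < ∣ Z b ∣
      low-small b with r * ∣ Low b ∣ <? ∣ Z b ∣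
      ... | yes p = p
      ... | no ¬p = ⊥-elim (reg (Z' b) (sparse (sub b) (wide b (≮⇒≥ ¬p)) (thin b (low-deg b))))
        where
        Z' : Bool → Pair
        Z' true = pair (Low true) (Z false)
        Z' false = pair (Z true) (Low false)
        sub : ∀ b → Z' b ⊑ Z
        sub true true v e = proj₁ (∧-true (Z true v) e)
        sub true false v e = e
        sub false true v e = e
        sub false false v e = proj₁ (∧-true (Z false v) e)
        wide : ∀ b → ∣ Z b ∣ ≤ r * ∣ Low b ∣ → ∀ c → ∣ Z c ∣ ≤ r * ∣ Z' b c ∣
        wide true p true = p
        wide true p false = m≤n*m _ r {{>-nonZero r>0}}
        wide false p true = m≤n*m _ r {{>-nonZero r>0}}
        wide false p false = p
        thin : ∀ b → (∀ v → Low b v ≡ true → 2 * K * deg b v (Z (not b)) ≤ j * ∣ Z (not b) ∣) →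
          2 * K * edges (Z' b) ≤ j * (∣ Z' b true ∣ * ∣ Z' b false ∣)
        thin true h = ≤-trans (edges-upper true (Z' true) (2 * K) (j * ∣ Z false ∣) h) (≤-reflexive (eq (∣ Low true ∣) j (∣ Z false ∣)))
          where
          eq : ∀ x y z → x * (y * z) ≡ y * (x * z)
          eq = solve-∀
        thin false h = ≤-trans (edges-upper false (Z' false) (2 * K) (j * ∣ Z true ∣) h) (≤-reflexive (eq (∣ Low false ∣) j (∣ Z true ∣)))
          where
          eq : ∀ x y z → x * (y * z) ≡ y * (z * x)
          eq = solve-∀
      -- A high vertex has more than `3 / r` of the opposite side as neighbours, by `6 * K ≤ r * j`;
      -- at most `1 / r` of that side is low, and `2 / r` is left. Deleting `F` will cost another
      -- `1 / r`.
      W-deg : ∀ b v → W b v ≡ true → 2 * ∣ Z (not b) ∣ ≤ r * deg b v (W (not b))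
      W-deg b v e = arith (∣ Z (not b) ∣) (deg b v (Z (not b))) (deg b v (W (not b))) (∣ Low (not b) ∣)
        (<⇒≤ (high-deg b v e)) (≤-trans (deg-split b v (Z (not b)) (W (not b)) (Low (not b)) outside) (+-monoʳ-≤ _ (deg≤∣∣ b v _))) (<⇒≤ (low-small (not b)))
        where
        outside : ∀ w → Z (not b) w ≡ true → W (not b) w ≡ false → Low (not b) w ≡ true
        outside w z h with Z (not b) w | High (not b) w
        ... | true | false = refl
        arith : ∀ z d d' l → j * z ≤ 2 * K * d → d ≤ d' + l → r * l ≤ z → 2 * z ≤ r * d'
        arith z d d' l h₁ h₂ h₃ = *-cancelˡ-≤ (2 * K) {{m*n≢0 2 K}} (≤-by 0 (+-mono-≤ (*-monoˡ-≤ z h6)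
            (+-mono-≤ (*-monoʳ-≤ r h₁) (+-mono-≤ (*-monoʳ-≤ (2 * K * r) h₂) (*-monoʳ-≤ (2 * K) h₃))))
          (eq K r j z d d' l))
          where
          eq : ∀ K r j z d d' l → 2 * K * (2 * z) + (r * j * z + (r * (2 * K * d) + (2 * K * r * (d' + l) + 2 * K * z))) + 0
            ≡ 2 * K * (r * d') + (6 * K * z + (r * (j * z) + (2 * K * r * d + 2 * K * (r * l))))
          eq = solve-∀
      inhabited : ∀ b → ∃ λ v → W b v ≡ true
      inhabited b = ∣∣-∈ (W b) (+-cancelʳ-< (∣ Low b ∣) 0 _ (<-≤-trans
        (≤-<-trans (m≤n*m _ r {{>-nonZero r>0}}) (low-small b))
        (≤-reflexive (cnt-split (Z b) (High b) Vs))))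
      nbhd : Bool → V → List V → V → Bool
      nbhd b v F w = (E b v w ∧ W (not b) w) ∧ not (w ∈ᵇ F)
      deg-avoid : ∀ b v → W b v ≡ true → ∀ F → length F ≤ f →
        ∣ Z (not b) ∣ ≤ r * ∣ nbhd b v F ∣
      deg-avoid b v e F lF = arith (∣ Z (not b) ∣) (deg b v (W (not b))) (∣ nbhd b v F ∣) (length F) (W-deg b v e) (∣∣-avoid (λ w → E b v w ∧ W (not b) w) F) (≤-trans (*-monoʳ-≤ r lF) (sz (not b)))
        where
        arith : ∀ z d x l → 2 * z ≤ r * d → d ≤ x + l → r * l ≤ z → z ≤ r * x
        arith z d x l h₁ h₂ h₃ = ≤-by 0 (+-mono-≤ h₁ (+-mono-≤ (*-monoʳ-≤ r h₂) h₃)) (eq r z d x l)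
          where
          eq : ∀ r z d x l → z + (r * d + (r * (x + l) + z)) + 0 ≡ r * x + (2 * z + (r * d + r * l))
          eq = solve-∀
      nbhd-W : ∀ b v F x → nbhd b v F x ≡ true → W (not b) x ≡ true
      nbhd-W b v F x e = proj₂ (∧-true (E b v x) (proj₁ (∧-true (E b v x ∧ W (not b) x) e)))
      nbhd⊑ : ∀ b v F x → nbhd b v F x ≡ true → Z (not b) x ≡ true
      nbhd⊑ b v F x e = W⊑Z (not b) x (nbhd-W b v F x e)
      nbhd⁻ : ∀ b v F x → nbhd b v F x ≡ true → E b v x ≡ true × x ∉ F
      nbhd⁻ b v F x e = let p , q = ∧-true (E b v x ∧ W (not b) x) e in proj₁ (∧-true (E b v x) p) , ∉ᵇ⁻ q
      dense : ∀ Z' → Z' ⊑ Z → (∀ b → ∣ Z b ∣ ≤ r * ∣ Z' b ∣) → 0 < edges Z'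
      dense Z' sub wide with edges Z' in eq
      ... | zero = ⊥-elim (reg Z' (sparse sub wide (≤-trans (≤-reflexive (trans (cong (2 * K *_) eq) (*-zeroʳ (2 * K)))) z≤n)))
      ... | suc _ = s≤s z≤n
      positive : ∀ x → 0 < r * x → 0 < x
      positive zero h = ⊥-elim (<⇒≱ h (≤-reflexive (*-zeroʳ r)))
      positive (suc x) _ = s≤s z≤n
      step : ∀ b v → W b v ≡ true → ∀ F → length F ≤ f → ∃ λ y → W (not b) y ≡ true × E b v y ≡ true × y ∉ F
      step b v e F lF = found (∣∣-∈ (nbhd b v F) (positive (∣ nbhd b v F ∣) (≤-trans (pos (not b)) (deg-avoid b v e F lF))))
        where
        found : (∃ λ y → nbhd b v F y ≡ true) → ∃ λ y → W (not b) y ≡ true × E b v y ≡ true × y ∉ F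
        found (y , h) = y , nbhd-W b v F y h , nbhd⁻ b v F y h
      three : ∀ b v w → W b v ≡ true → W (not b) w ≡ true → ∀ F → length F ≤ f →
          ∃ λ y → ∃ λ x → E b v y ≡ true × E b x y ≡ true × E b x w ≡ true × x ∉ F × y ∉ F
      dense-nbhds : ∀ v w → W true v ≡ true → W false w ≡ true → ∀ F → length F ≤ f → 0 < edges (pair (nbhd false w F) (nbhd true v F))
      dense-nbhds v w ev ew F lF = dense (pair (nbhd false w F) (nbhd true v F))
        (λ { true x e → nbhd⊑ false w F x e ; false x e → nbhd⊑ true v F x e })
        (λ { true → deg-avoid false w ew F lF ; false → deg-avoid true v ev F lF })
      three true v w ev ew F lF =
        let x , y , hx , hxy , hy = edges-∈ true (pair (nbhd false w F) (nbhd true v F)) (dense-nbhds v w ev ew F lF)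
            p , q = nbhd⁻ false w F x hx
            p' , q' = nbhd⁻ true v F y hy
        in y , x , p' , hxy , p , q , q'
      three false v w ev ew F lF =
        let x , y , hx , hxy , hy = edges-∈ false (pair (nbhd false v F) (nbhd true w F)) (dense-nbhds w v ew ev F lF)
            p , q = nbhd⁻ true w F x hx
            p' , q' = nbhd⁻ false v F y hy
        in y , x , p' , hxy , p , q , q'

    -- Degrees of at least `d ≥ n / (2 * N)` give density at least `1 / (2 * N)`, which is `j / K`.
    -- The choice `j = 4 * r * r` is what the density increment asks for, and `r = 12 * N` makes
    -- `6 * K` equal to `r * j`. With `suc K` rounds at most, the sides shrink by a constant factor.
    robust⇒hub : ∀ N d Z f .{{_ : NonZero N}} → NonEmpty Z → MinDeg d Z → n ≤ 2 * N * d → 0 < n →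
      (let r = 12 * N ; j = 4 * (r * r) ; K = 2 * N * j) →
      r * f * (2 * N * (2 * K) ^ suc K) ≤ n → Hub Z f
    robust⇒hub N d Z f ne md nd n>0 bound =
      finish (regular-subpair r K r≤2K (suc K) j Z n (2 * N) (m≤n+m (suc K) j) ≤-refl n>0 sizes dens)
      where
      r j K C : ℕ
      r = 12 * N
      j = 4 * (r * r)
      K = 2 * N * j
      C = 2 * N * (2 * K) ^ suc K
      instance
        r≢0 : NonZero r
        r≢0 = m*n≢0 12 N
        rr≢0 : NonZero (r * r)
        rr≢0 = m*n≢0 r r
        j≢0 : NonZero j
        j≢0 = m*n≢0 4 (r * r)
        2N≢0 : NonZero (2 * N)
        2N≢0 = m*n≢0 2 N
        K≢0 : NonZero K
        K≢0 = m*n≢0 (2 * N) j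
      r≤2K : r ≤ 2 * K
      r≤2K = ≤-trans (≤-trans (m≤m*n r r) (m≤n*m (r * r) 4)) (≤-trans (m≤n*m j (2 * N)) (m≤n*m K 2))
      positive : ∀ x y → 0 < x * y → 0 < y
      positive x zero h = ⊥-elim (<⇒≱ h (≤-reflexive (*-zeroʳ x)))
      positive x (suc y) _ = s≤s z≤n
      sizes : ∀ b → n ≤ 2 * N * ∣ Z b ∣
      sizes b = ≤-trans nd (*-monoʳ-≤ (2 * N) (side-large ne md (positive (2 * N) d (≤-trans n>0 nd)) b))
      dens : j * (∣ Z true ∣ * ∣ Z false ∣) ≤ K * edges Z
      dens = begin
        j * (∣ Z true ∣ * ∣ Z false ∣) ≤⟨ *-monoʳ-≤ j (*-monoʳ-≤ (∣ Z true ∣) (≤-trans (∣∣≤n (Z false)) nd)) ⟩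
        j * (∣ Z true ∣ * (2 * N * d)) ≡⟨ eq j (∣ Z true ∣) (2 * N) d ⟩
        K * (∣ Z true ∣ * d) ≤⟨ *-monoʳ-≤ K (edges-lower true Z d (md true)) ⟩
        K * edges Z ∎
        where
        open ≤-Reasoning
        eq : ∀ j a m d → j * (a * (m * d)) ≡ m * j * (a * d)
        eq = solve-∀
      finish : (∃ λ Z' → ∃ λ j' → Z' ⊑ Z × j ≤ j' × (∀ b → n ≤ C * ∣ Z' b ∣) × Regular r K j' Z') → Hub Z f
      finish (Z' , j' , sub , le , sz , reg) = record
        { W = Hub.W hub
        ; W⊑Z = λ b v e → sub b v (Hub.W⊑Z hub b v e)
        ; inhabited = Hub.inhabited hub
        ; step = Hub.step hub
        ; three = Hub.three hub
        }
        where
        fits : ∀ b → r * f ≤ ∣ Z' b ∣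
        fits b = *-cancelˡ-≤ C {{m*n≢0 (2 * N) ((2 * K) ^ suc K) {{2N≢0}} {{m^n≢0 (2 * K) (suc K) {{m*n≢0 2 K}}}}}}
          (≤-trans (≤-reflexive (*-comm C (r * f))) (≤-trans bound (sz b)))
        pos : ∀ b → 0 < ∣ Z' b ∣
        pos b = positive C _ (≤-trans n>0 (sz b))
        hub : Hub Z' f
        hub = regular⇒hub r K j' Z' f reg (≤-trans (≤-reflexive (eq N j)) (*-monoʳ-≤ r le)) (>-nonZero⁻¹ r) (fits true) (fits false) (pos true) (pos false)
          where
          eq : ∀ N j → 6 * (2 * N * j) ≡ 12 * N * j
          eq = solve-∀

  -- Permutations of lists, and pigeonhole on neighbourhoods.

  Unique-resp-↭ : ∀ {xs ys : List A} → xs ↭ ys → Unique xs → Unique ys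
  Unique-resp-↭ ↭.refl u = u
  Unique-resp-↭ (prep x p) (a ∷ u) = ↭ₚ.All-resp-↭ p a ∷ Unique-resp-↭ p u
  Unique-resp-↭ (swap x y p) ((x≢y ∷ a) ∷ (b ∷ u)) = ((λ e → x≢y (sym e)) ∷ ↭ₚ.All-resp-↭ p b) ∷ (↭ₚ.All-resp-↭ p a ∷ Unique-resp-↭ p u)
  Unique-resp-↭ (↭.trans p q) u = Unique-resp-↭ q (Unique-resp-↭ p u)

  Unique-++ˡ : ∀ (xs : List A) {ys} → Unique (xs ++ ys) → Unique xs
  Unique-++ˡ [] u = []
  Unique-++ˡ (x ∷ xs) (a ∷ u) = Allₚ.++⁻ˡ xs a ∷ Unique-++ˡ xs u

  Unique-++ʳ : ∀ (xs : List A) {ys} → Unique (xs ++ ys) → Unique ys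
  Unique-++ʳ [] u = u
  Unique-++ʳ (x ∷ xs) (a ∷ u) = Unique-++ʳ xs u

  Unique-disjoint : ∀ (xs : List A) {ys v} → Unique (xs ++ ys) → v ∈ xs → v ∈ ys → ⊥
  Unique-disjoint (x ∷ xs) (a ∷ u) (here refl) m = All.lookup a (∈-++⁺ʳ xs m) refl
  Unique-disjoint (x ∷ xs) (a ∷ u) (there l) m = Unique-disjoint xs u l m

  cnt-++ : ∀ (p : A → Bool) xs ys → cnt p (xs ++ ys) ≡ cnt p xs + cnt p ys
  cnt-++ p = ∑-++ (λ v → if p v then 1 else 0)

  ∑-concatMap : ∀ {B : Set} (f : B → ℕ) (g : A → List B) xs → ∑ f (concatMap g xs) ≡ ∑ (λ x → ∑ f (g x)) xs
  ∑-concatMap f g [] = refl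
  ∑-concatMap f g (x ∷ xs) = trans (∑-++ f (g x) (concatMap g xs)) (cong (∑ f (g x) +_) (∑-concatMap f g xs))

  split-off : ∀ (p : A → Bool) xs c → c ≤ cnt p xs →
    ∃ λ ys → ∃ λ zs → xs ↭ ys ++ zs × length ys ≡ c × (∀ v → v ∈ ys → p v ≡ true)
  split-off p xs zero h = [] , xs , ↭-refl , refl , λ v ()
  split-off p (x ∷ xs) (suc c) h with p x in eq
  ... | true with split-off p xs c (≤-pred h)
  ...   | ys , zs , perm , l , a = x ∷ ys , zs , prep x perm , cong suc l , λ { v (here refl) → eq ; v (there m) → a v m }
  split-off p (x ∷ xs) (suc c) h | false with split-off p xs (suc c) h
  ...   | ys , zs , perm , l , a = ys , x ∷ zs , ↭-trans (prep x perm) (↭-sym (↭ₚ.shift x ys zs)) , l , a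

  -- For each `t` the larger of the two classes, adjacent to `t` or not, is kept. After `length ts`
  -- halvings the survivors have the same neighbourhood in `ts`.
  agree : ∀ {W T : Set} (R : W → T → Bool) ts ws c → c * 2 ^ length ts ≤ length ws →
    ∃ λ ws' → c ≤ length ws' × (∀ w → w ∈ ws' → w ∈ ws) × (Unique ws → Unique ws') ×
      (∀ w w' → w ∈ ws' → w' ∈ ws' → ∀ t → t ∈ ts → R w t ≡ R w' t)
  agree R [] ws c h = ws , ≤-trans (≤-reflexive (sym (*-identityʳ c))) h , (λ w m → m) , id , λ w w' _ _ t ()
  agree {W} R (t ∷ ts) ws c h = [ go (λ w → R w t) true (λ w e → e) , go (λ w → not (R w t)) false (λ w → not-true) ]′ larger
    where
    x = c * 2 ^ length ts
    total : x + x ≤ cnt (λ w → R w t) ws + cnt (λ w → not (R w t)) ws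
    total = ≤-trans (≤-trans (≤-reflexive (eq c (2 ^ length ts))) h) (≤-reflexive (lem ws))
      where
      eq : ∀ c y → c * y + c * y ≡ c * (2 * y)
      eq = solve-∀
      lem : ∀ ws → length ws ≡ cnt (λ w → R w t) ws + cnt (λ w → not (R w t)) ws
      lem [] = refl
      lem (w ∷ ws) with R w t
      ... | true = cong suc (lem ws)
      ... | false = trans (cong suc (lem ws)) (sym (+-suc (cnt (λ w → R w t) ws) _))
    larger : x ≤ cnt (λ w → R w t) ws ⊎ x ≤ cnt (λ w → not (R w t)) ws
    larger with x ≤? cnt (λ w → R w t) ws
    ... | yes p = inj₁ p
    ... | no ¬p = inj₂ (+-cancelˡ-≤ x _ _ (≤-trans total (+-monoˡ-≤ _ (<⇒≤ (≰⇒> ¬p)))))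
    go : (q : W → Bool) (val : Bool) → (∀ w → q w ≡ true → R w t ≡ val) → x ≤ cnt q ws →
      ∃ λ ws' → c ≤ length ws' × (∀ w → w ∈ ws' → w ∈ ws) × (Unique ws → Unique ws') ×
        (∀ w w' → w ∈ ws' → w' ∈ ws' → ∀ t' → t' ∈ t ∷ ts → R w t' ≡ R w' t')
    go q val qv l with agree R ts (filterᵇ q ws) c (≤-trans l (≤-reflexive (sym (length-filterᵇ q ws))))
    ... | ws' , l' , sub , un , ag = ws' , l' , (λ w m → proj₁ (∈-filterᵇ⁻ q ws (sub w m))) , (λ u → un (unique-filterᵇ q u)) ,
      λ { w w' m m' _ (here refl) → trans (qv w (proj₂ (∈-filterᵇ⁻ q ws (sub w m)))) (sym (qv w' (proj₂ (∈-filterᵇ⁻ q ws (sub w' m'))))) ; w w' m m' t' (there mt) → ag w w' m m' t' mt }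

  record Common {W T : Set} (R : W → T → Bool) (ts : List T) (ws : List W) (c x : ℕ) : Set where
    field
      chosen : List W
      profile : T → Bool
      chosen-length : length chosen ≡ c
      chosen-⊆ : ∀ w → w ∈ chosen → w ∈ ws
      chosen-unique : Unique chosen
      profile-large : x ≤ cnt profile ts
      profile-adjacent : ∀ w → w ∈ chosen → ∀ t → t ∈ ts → profile t ≡ true → R w t ≡ true

  -- The common neighbourhood of the survivors is the neighbourhood of any one of them, so it
  -- inherits the lower bound `x` without any averaging.
  common : ∀ {W T : Set} (R : W → T → Bool) ts ws c x → 0 < c → c * 2 ^ length ts ≤ length ws →
    Unique ws → (∀ w → w ∈ ws → x ≤ cnt (R w) ts) → Common R ts ws c x
  common {W} {T} R ts ws c x c>0 h un hx with agree R ts ws c h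
  ... | [] , l , _ = ⊥-elim (<⇒≱ c>0 l)
  ... | w₀ ∷ ws' , l , sub , un' , ag = record
    { chosen = take c (w₀ ∷ ws')
    ; profile = R w₀
    ; chosen-length = length-take-≤ c (w₀ ∷ ws') l
    ; chosen-⊆ = λ w m → sub w (∈-take⁻ c (w₀ ∷ ws') m)
    ; chosen-unique = Uniqueₚ.take⁺ c (un' un)
    ; profile-large = hx w₀ (sub w₀ (here refl))
    ; profile-adjacent = λ w m t mt e → trans (ag w w₀ (∈-take⁻ c (w₀ ∷ ws') m) (here refl) t mt) e
    }

  -- Tiles: vertex-disjoint balanced complete bipartite subdigraphs

  module Tiles {n : ℕ} (D : Digraph n) (Z : Bool → Fin n → Bool) where
    open Graph D

    record Tile (s : ℕ) : Set where
      field
        part : Bool → List V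
        len : ∀ b → length (part b) ≡ s
        inside : ∀ b v → v ∈ part b → Z b v ≡ true
        complete : ∀ p q → p ∈ part true → q ∈ part false → D p q ≡ true

    open Tile public

    verts : ∀ {s} → Tile s → List V
    verts T = part T true ++ part T false

    verts* : ∀ {s} → List (Tile s) → List V
    verts* = concatMap verts

    length-verts : ∀ {s} (T : Tile s) → length (verts T) ≡ 2 * s
    length-verts {s} T = trans (length-++ (part T true)) (trans (cong₂ _+_ (len T true) (len T false)) (cong (s +_) (sym (+-identityʳ s))))

    length-verts* : ∀ {s} (Ts : List (Tile s)) → length (verts* Ts) ≡ length Ts * (2 * s)
    length-verts* [] = refl
    length-verts* (T ∷ Ts) = trans (length-++ (verts T)) (cong₂ _+_ (length-verts T) (length-verts* Ts))

    verts*-++ : ∀ {s} (Ts Us : List (Tile s)) → verts* (Ts ++ Us) ≡ verts* Ts ++ verts* Us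
    verts*-++ [] Us = refl
    verts*-++ (T ∷ Ts) Us = trans (cong (verts T ++_) (verts*-++ Ts Us)) (sym (++-assoc (verts T) (verts* Ts) (verts* Us)))

    module PermSolver = CMSolver (↭ₚ.++-commutativeMonoid {A = V})
    open PermSolver using (_⊕_; _⊜_) renaming (solve to ↭-solve)

    make-tile : ∀ {s} b Ps Qs → length Ps ≡ s → length Qs ≡ s → (∀ v → v ∈ Ps → Z b v ≡ true) → (∀ v → v ∈ Qs → Z (not b) v ≡ true) →
      (∀ p q → p ∈ Ps → q ∈ Qs → E b p q ≡ true) → ∃ λ (T : Tile s) → verts T ↭ Ps ++ Qs
    make-tile true Ps Qs lp lq zp zq c = record
      { part = λ { true → Ps ; false → Qs } ; len = λ { true → lp ; false → lq }
      ; inside = λ { true → zp ; false → zq } ; complete = c } , ↭-refl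
    make-tile false Ps Qs lp lq zp zq c = record
      { part = λ { true → Qs ; false → Ps } ; len = λ { true → lq ; false → lp }
      ; inside = λ { true → zq ; false → zp } ; complete = λ p q mp mq → c q p mq mp } , ↭ₚ.++-comm Qs Ps

    drop-∈ : ∀ c (xs : List V) {v} → v ∈ drop c xs → v ∈ xs
    drop-∈ zero xs m = m
    drop-∈ (suc c) (x ∷ xs) m = there (drop-∈ c xs m)

    length-drop-+ : ∀ s c (xs : List V) → length xs ≡ s + c → length (drop s xs) ≡ c
    length-drop-+ s c xs h = trans (length-drop s xs) (trans (cong (_∸ s) h) (m+n∸m≡n s c))

    interchange : ∀ (a b c d : List V) → (a ++ b) ++ (c ++ d) ↭ (a ++ c) ++ (b ++ d)
    interchange = ↭-solve 4 (λ a b c d → (a ⊕ b) ⊕ (c ⊕ d) ⊜ (a ⊕ c) ⊕ (b ⊕ d)) ↭-refl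

    subdivide : ∀ s m Ps Qs → length Ps ≡ m * s → length Qs ≡ m * s → (∀ v → v ∈ Ps → Z true v ≡ true) → (∀ v → v ∈ Qs → Z false v ≡ true) →
      (∀ p q → p ∈ Ps → q ∈ Qs → D p q ≡ true) → ∃ λ (Ts : List (Tile s)) → length Ts ≡ m × verts* Ts ↭ Ps ++ Qs
    subdivide s zero [] [] lp lq zp zq c = [] , refl , ↭-refl
    subdivide s (suc m) Ps Qs lp lq zp zq c
      with make-tile {s} true (take s Ps) (take s Qs)
             (length-take-≤ s Ps (≤-trans (m≤m+n s _) (≤-reflexive (sym lp)))) (length-take-≤ s Qs (≤-trans (m≤m+n s _) (≤-reflexive (sym lq))))
             (λ v m → zp v (∈-take⁻ s Ps m)) (λ v m → zq v (∈-take⁻ s Qs m)) (λ p q mp mq → c p q (∈-take⁻ s Ps mp) (∈-take⁻ s Qs mq))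
         | subdivide s m (drop s Ps) (drop s Qs) (length-drop-+ s _ Ps lp) (length-drop-+ s _ Qs lq)
             (λ v m → zp v (drop-∈ s Ps m)) (λ v m → zq v (drop-∈ s Qs m)) (λ p q mp mq → c p q (drop-∈ s Ps mp) (drop-∈ s Qs mq))
    ... | T , permT | Ts , l , perm = T ∷ Ts , cong suc l ,
      ↭-trans (↭ₚ.++⁺ permT perm) (↭-trans (interchange (take s Ps) (take s Qs) (drop s Ps) (drop s Qs))
        (↭-reflexive (cong₂ _++_ (take++drop≡id s Ps) (take++drop≡id s Qs))))

    refine : ∀ s m (Ts : List (Tile (m * s))) → ∃ λ (Us : List (Tile s)) → length Us ≡ length Ts * m × verts* Us ↭ verts* Ts
    refine s m [] = [] , refl , ↭-refl
    refine s m (T ∷ Ts) with subdivide s m (part T true) (part T false) (len T true) (len T false) (inside T true) (inside T false) (complete T) | refine s m Ts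
    ... | Us , l , p | Us' , l' , p' = Us ++ Us' , trans (length-++ Us) (cong₂ _+_ l l') , ↭-trans (↭-reflexive (verts*-++ Us Us')) (↭ₚ.++⁺ p p')

    remove : ∀ {s} (T : Tile s) (Ts : List (Tile s)) → T ∈ Ts → ∃ λ (Us : List (Tile s)) → length Ts ≡ suc (length Us) × verts* Ts ↭ verts T ++ verts* Us
    remove T (_ ∷ Ts) (here refl) = Ts , refl , ↭-refl
    remove T (T' ∷ Ts) (there m) with remove T Ts m
    ... | Us , l , p = T' ∷ Us , cong suc l , ↭-trans (↭ₚ.++⁺ˡ (verts T') p) (↭ₚ.shifts (verts T') (verts T))

    -- A tile meeting the common neighbourhood of 2s new vertices in s more than half of its vertices
    -- is rebuilt, together with the new vertices, into one more tile of size s.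
    module Rebuild (s m : ℕ) (s>0 : 0 < s) (c : Bool) (T : Tile (suc m * s)) (W : List V) (lW : length W ≡ 2 * s)
      (zW : ∀ v → v ∈ W → Z c v ≡ true) (p : V → Bool) (hp : suc m * s + s ≤ cnt p (verts T))
      (com : ∀ w → w ∈ W → ∀ t → t ∈ verts T → p t ≡ true → E c w t ∧ Z (not c) t ≡ true) where

      half : ∀ xs {y} → length xs ≡ suc m * s → suc m * s + s ≤ cnt p xs + y → s ≤ y
      half xs {y} l h = +-cancelˡ-≤ (suc m * s) s y (≤-trans h (+-monoˡ-≤ y (≤-trans (cnt≤length p xs) (≤-reflexive l))))

      enough : ∀ b → s ≤ cnt p (part T b)
      enough true = half (part T false) (len T false) (≤-trans hp (≤-reflexive (trans (cnt-++ p (part T true) (part T false)) (+-comm (cnt p (part T true)) _))))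
      enough false = half (part T true) (len T true) (≤-trans hp (≤-reflexive (cnt-++ p (part T true) (part T false))))

      split : ∀ b → ∃ λ ys → ∃ λ zs → part T b ↭ ys ++ zs × length ys ≡ s × (∀ v → v ∈ ys → p v ≡ true)
      split b = split-off p (part T b) s (enough b)

      X Y : Bool → List V
      X b = proj₁ (split b)
      Y b = proj₁ (proj₂ (split b))
      perm : ∀ b → part T b ↭ X b ++ Y b
      perm b = proj₁ (proj₂ (proj₂ (split b)))
      lX : ∀ b → length (X b) ≡ s
      lX b = proj₁ (proj₂ (proj₂ (proj₂ (split b))))

      lY : ∀ b → length (Y b) ≡ m * s
      lY b = +-cancelˡ-≡ s _ _ (trans (cong (_+ length (Y b)) (sym (lX b))) (trans (sym (length-++ (X b))) (trans (sym (↭ₚ.↭-length (perm b))) (len T b))))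

      part⊆verts : ∀ b {v} → v ∈ part T b → v ∈ verts T
      part⊆verts true = ∈-++⁺ˡ
      part⊆verts false = ∈-++⁺ʳ (part T true)

      X-adj : ∀ b w t → w ∈ W → t ∈ X b → E c w t ≡ true × Z (not c) t ≡ true
      X-adj b w t mw mt = ∧-true (E c w t) (com w mw t (part⊆verts b (↭ₚ.∈-resp-↭ (↭-sym (perm b)) (∈-++⁺ˡ mt))) (proj₂ (proj₂ (proj₂ (proj₂ (split b)))) t mt))

      w₀ : ∃ (_∈ W)
      w₀ = lem W (subst (0 <_) (sym lW) (≤-trans s>0 (m≤m+n s _)))
        where
        lem : ∀ xs → 0 < length xs → ∃ (_∈ xs)
        lem (x ∷ xs) _ = x , here refl

      X-in : ∀ b v → v ∈ X b → Z (not c) v ≡ true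
      X-in b v m = proj₂ (X-adj b (proj₁ w₀) v (proj₂ w₀) m)

      Y-in : ∀ b v → v ∈ Y b → v ∈ part T b
      Y-in b v m = ↭ₚ.∈-resp-↭ (↭-sym (perm b)) (∈-++⁺ʳ (X b) m)

      -- One half of `W` goes with `X true`, the other with `X false`; both of these are used on
      -- side `not c`, so one of them changes its role. The rest of `T` is still complete and
      -- balanced and yields `m` tiles. This makes `2 + m` tiles of size `s`, while `T` alone is
      -- worth `1 + m`.
      rebuild : ∃ λ (Us : List (Tile s)) → length Us ≡ 2 + m × verts* Us ↭ W ++ verts T
      rebuild
        with make-tile {s} c (take s W) (X true) (length-take-≤ s W (≤-trans (m≤m+n s _) (≤-reflexive (sym lW)))) (lX true)
               (λ v mv → zW v (∈-take⁻ s W mv)) (X-in true) (λ w t mw mt → proj₁ (X-adj true w t (∈-take⁻ s W mw) mt))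
           | make-tile {s} c (drop s W) (X false) (trans (length-drop-+ s (s + 0) W lW) (+-identityʳ s)) (lX false)
               (λ v mv → zW v (drop-∈ s W mv)) (X-in false) (λ w t mw mt → proj₁ (X-adj false w t (drop-∈ s W mw) mt))
           | subdivide s m (Y true) (Y false) (lY true) (lY false)
               (λ v mv → inside T true v (Y-in true v mv)) (λ v mv → inside T false v (Y-in false v mv))
               (λ x y mx my → complete T x y (Y-in true x mx) (Y-in false y my))
      ... | T₁ , perm₁ | T₂ , perm₂ | Ts , l , perm₃ = T₁ ∷ T₂ ∷ Ts , cong (λ x → suc (suc x)) l ,
        ↭-trans (↭ₚ.++⁺ perm₁ (↭ₚ.++⁺ perm₂ perm₃))
        (↭-trans (↭-solve 6 (λ w₁ x₁ w₂ x₂ y₁ y₂ → (w₁ ⊕ x₁) ⊕ ((w₂ ⊕ x₂) ⊕ (y₁ ⊕ y₂)) ⊜ (w₁ ⊕ w₂) ⊕ ((x₁ ⊕ y₁) ⊕ (x₂ ⊕ y₂))) ↭-refl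
            (take s W) (X true) (drop s W) (X false) (Y true) (Y false))
          (↭ₚ.++⁺ (↭-reflexive (take++drop≡id s W)) (↭ₚ.++⁺ (↭-sym (perm true)) (↭-sym (perm false)))))

  -- Covering almost `2 * d` vertices by tiles.

  module Tiling {n : ℕ} (D : Digraph n) (oriented : Oriented D) (Z : Bool → Fin n → Bool) (d : ℕ)
    (md : Graph.MinDeg D d Z) (large : ∀ b → d ≤ ∣ Z b ∣) where
    open Graph D
    open Tiles D Z
    open PermSolver using (_⊕_; _⊜_) renaming (solve to ↭-solve)

    no-loop : ∀ b v → E b v v ≡ true → ⊥
    no-loop true v e = true≢false e (proj₁ oriented v)
    no-loop false v e = true≢false e (proj₁ oriented v)

    -- If some vertex plays both roles then its in- and out-neighbourhoods are disjoint; otherwise the two sides are.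
    union-large : d + d ≤ ∣ (λ v → Z true v ∨ Z false v) ∣
    union-large with Finₚ.any? (λ v → (Z true v ∧ Z false v) Boolₚ.≟ true)
    ... | yes (v , e) = ≤-trans (+-mono-≤ (md true v (proj₁ (∧-true (Z true v) e))) (md false v (proj₂ (∧-true (Z true v) e))))
      (cnt-disjoint-+ (λ w → D v w ∧ Z false w) (λ w → D w v ∧ Z true w) _ Vs
        (λ w h → ∨-right (Z true w) (proj₂ (∧-true (D v w) h))) (λ w h → cong (_∨ Z false w) (proj₂ (∧-true (D w v) h)))
        (λ w h h' → true≢false (proj₁ (∧-true (D w v) h')) (proj₂ oriented v w (proj₁ (∧-true (D v w) h)))))
    ... | no ¬p = ≤-trans (+-mono-≤ (large true) (large false))
      (cnt-disjoint-+ (Z true) (Z false) _ Vs (λ w h → cong (_∨ Z false w) h) (λ w h → ∨-right (Z true w) h)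
        (λ w h h' → ¬p (w , ∧-intro h h')))

    d≤n : d ≤ n
    d≤n = ≤-trans (large true) (∣∣≤n (Z true))

    -- As long as the tiles fall short of `d` by more than `3 * t`, counted per side, one more small
    -- tile can be gained. Take `M` uncovered vertices on one side. If they send many edges to
    -- uncovered vertices, a new tile is found there. Otherwise their edges concentrate on the old
    -- tiles, and some old tile contains clearly more than half of its vertices as neighbours of
    -- many of the `M` vertices; it is rebuilt.
    module Augment (s m t M : ℕ) (s>0 : 0 < s) (O : List (Tile (suc m * s))) (N : List (Tile s))
      (hm : 2 * n ≤ suc m * t) (hs : 2 * (s * 2 ^ M) ≤ t) (hMt : M ≤ t) (hM : 4 * (suc m * s) * 2 ^ (2 * (suc m * s)) ≤ M)
      (hN : s * length N ≤ t) (unique : Unique (verts* N ++ verts* O))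
      (uncovered : suc m * s * length O + s * length N + 3 * t < d) where

      S a b : ℕ
      S = suc m * s
      a = length O
      b = length N

      C : List V
      C = verts* N ++ verts* O

      length-C : length C ≡ b * (2 * s) + a * (2 * S)
      length-C = trans (length-++ (verts* N)) (cong₂ _+_ (length-verts* N) (length-verts* O))

      unc : Pair
      unc c v = Z c v ∧ not (v ∈ᵇ C)

      Result : Set
      Result = ∃ λ (O' : List (Tile S)) → ∃ λ (N' : List (Tile s)) → Unique (verts* N' ++ verts* O') ×
        suc m * length O' + length N' ≡ suc (suc m * a + b) × length N' ≤ b + (2 + m)

      large-side : ∃ λ c → t ≤ ∣ unc c ∣
      large-side with t ≤? ∣ unc true ∣ | t ≤? ∣ unc false ∣
      ... | yes p | _ = true , p
      ... | no _ | yes p = false , p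
      ... | no ¬p | no ¬q = ⊥-elim (<⇒≱ uncovered (arith (∣ unc true ∣) (∣ unc false ∣) d t S s a b total (<⇒≤ (≰⇒> ¬p)) (<⇒≤ (≰⇒> ¬q))))
        where
        total : d + d ≤ ∣ unc true ∣ + ∣ unc false ∣ + (b * (2 * s) + a * (2 * S))
        total = ≤-trans union-large (≤-trans (∣∣-avoid _ C) (+-mono-≤ (≤-trans (∣∣-mono lem) (cnt-∨-≤ (unc true) (unc false) (Vs {n}))) (≤-reflexive length-C)))
          where
          lem : ∀ v → (Z true v ∨ Z false v) ∧ not (v ∈ᵇ C) ≡ true → unc true v ∨ unc false v ≡ true
          lem v e with Z true v | Z false v | v ∈ᵇ C
          ... | true | _ | false = refl
          ... | false | true | false = refl
        arith : ∀ x y d t S s a b → d + d ≤ x + y + (b * (2 * s) + a * (2 * S)) → x ≤ t → y ≤ t → d ≤ S * a + s * b + 3 * t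
        arith x y d t S s a b h hx hy = *-cancelˡ-≤ 2 (≤-by (4 * t) (+-mono-≤ h (+-mono-≤ hx hy)) (eq x y d t S s a b))
          where
          eq : ∀ x y d t S s a b → 2 * d + (x + y + (b * (2 * s) + a * (2 * S)) + (t + t)) + 4 * t ≡ 2 * (S * a + s * b + 3 * t) + (d + d + (x + y))
          eq = solve-∀

      module Side (c : Bool) (hc : t ≤ ∣ unc c ∣) where

        Ws : List V
        Ws = take M (filterᵇ (unc c) Vs)

        length-Ws : length Ws ≡ M
        length-Ws = length-take-≤ M _ (≤-trans hMt (≤-trans hc (≤-reflexive (sym (length-filterᵇ (unc c) Vs)))))

        unique-Ws : Unique Ws
        unique-Ws = Uniqueₚ.take⁺ M (unique-filterᵇ (unc c) (Uniqueₚ.allFin⁺ n))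

        Ws-unc : ∀ w → w ∈ Ws → unc c w ≡ true
        Ws-unc w mw = proj₂ (∈-filterᵇ⁻ (unc c) Vs (∈-take⁻ M _ mw))

        Ws-Z : ∀ w → w ∈ Ws → Z c w ≡ true
        Ws-Z w mw = proj₁ (∧-true (Z c w) (Ws-unc w mw))

        unc-∉ : ∀ c v → unc c v ≡ true → v ∉ C
        unc-∉ c v e = ∉ᵇ⁻ (proj₂ (∧-true (Z c v) e))

        R : V → V → Bool
        R w v = E c w v ∧ Z (not c) v

        new old : ℕ
        new = ∑ (λ w → deg c w (unc (not c))) Ws
        old = ∑ (λ w → cnt (R w) (verts* O)) Ws

        count-neighbours : M * d ≤ new + (M * (b * (2 * s)) + old)
        count-neighbours = begin
          M * d ≡⟨ cong (_* d) (sym length-Ws) ⟩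
          length Ws * d ≤⟨ ∑-≥-const Ws d each ⟩
          ∑ (λ w → deg c w (unc (not c)) + (b * (2 * s) + cnt (R w) (verts* O))) Ws ≡⟨ ∑-+ (λ w → deg c w (unc (not c))) _ Ws ⟩
          new + ∑ (λ w → b * (2 * s) + cnt (R w) (verts* O)) Ws ≡⟨ cong (new +_) (∑-+ (λ _ → b * (2 * s)) _ Ws) ⟩
          new + (∑ (λ _ → b * (2 * s)) Ws + old) ≡⟨ cong (λ x → new + (x + old)) (trans (∑-const (b * (2 * s)) Ws) (cong (_* (b * (2 * s))) length-Ws)) ⟩
          new + (M * (b * (2 * s)) + old) ∎
          where
          open ≤-Reasoning
          each : ∀ w → w ∈ Ws → d ≤ deg c w (unc (not c)) + (b * (2 * s) + cnt (R w) (verts* O))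
          each w mw = begin
            d ≤⟨ md c w (Ws-Z w mw) ⟩
            ∣ R w ∣ ≤⟨ ∣∣-remove (R w) C ⟩
            ∣ (λ v → R w v ∧ not (v ∈ᵇ C)) ∣ + cnt (R w) C ≤⟨ +-mono-≤ (∣∣-mono reassoc) (≤-reflexive (cnt-++ (R w) (verts* N) (verts* O))) ⟩
            deg c w (unc (not c)) + (cnt (R w) (verts* N) + cnt (R w) (verts* O))
              ≤⟨ +-monoʳ-≤ (deg c w (unc (not c))) (+-monoˡ-≤ (cnt (R w) (verts* O)) (≤-trans (cnt≤length (R w) (verts* N)) (≤-reflexive (length-verts* N)))) ⟩
            deg c w (unc (not c)) + (b * (2 * s) + cnt (R w) (verts* O)) ∎
            where
            reassoc : ∀ v → R w v ∧ not (v ∈ᵇ C) ≡ true → E c w v ∧ unc (not c) v ≡ true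
            reassoc v e = let x , y = ∧-true (R w v) e ; p , q = ∧-true (E c w v) x in ∧-intro p (∧-intro q y)

        -- Kővári–Sós–Turán, by pigeonhole on the neighbourhoods in Ws.
        module Fresh (hnew : M * t ≤ new) where

          good : V → Bool
          good u = unc (not c) u ∧ does (s ≤? cnt (E (not c) u) Ws)

          new≤ : new ≤ n * s + M * ∣ good ∣
          new≤ = begin
            new ≡⟨ ∑-swap (λ w u → if E c w u ∧ unc (not c) u then 1 else 0) Ws Vs ⟩
            ∑ (λ u → cnt (λ w → E c w u ∧ unc (not c) u) Ws) Vs
              ≤⟨ ∑-≤-exceptional (λ u → cnt (λ w → E c w u ∧ unc (not c) u) Ws) good (Vs {n}) s M
                   (λ u e → bad u e (bool-dec (unc (not c) u))) (λ u → ≤-trans (cnt≤length _ Ws) (≤-reflexive length-Ws)) ⟩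
            length (Vs {n}) * s + M * ∣ good ∣ ≡⟨ cong (λ x → x * s + M * ∣ good ∣) (length-Vs {n}) ⟩
            n * s + M * ∣ good ∣ ∎
            where
            open ≤-Reasoning
            bad : ∀ u → good u ≡ false → unc (not c) u ≡ true ⊎ unc (not c) u ≡ false → cnt (λ w → E c w u ∧ unc (not c) u) Ws ≤ s
            bad u eq (inj₁ h) = ≤-trans (cnt-mono Ws (λ w _ e → E-sym c w u (proj₁ (∧-true (E c w u) e))))
              (<⇒≤ (≰⇒> (dec-false (s ≤? cnt (E (not c) u) Ws) (∧-false h eq))))
            bad u eq (inj₂ h) = ≤-trans (cnt-mono {q = λ _ → false} Ws (λ w _ e → true≢false (proj₂ (∧-true (E c w u) e)) h))
              (≤-trans (≤-reflexive (trans (∑-const 0 Ws) (*-zeroʳ (length Ws)))) z≤n)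

          -- Vertices with fewer than `s` neighbours in `Ws` account for at most `n * s` edges, an
          -- eighth of `M * t` by `2 * n ≤ suc m * t` and `4 * S ≤ M`. The remaining edges need at
          -- least seven eighths of `t` good vertices.
          many : s * 2 ^ M ≤ ∣ good ∣
          many = arith n s (suc m) t M (∣ good ∣) (s * 2 ^ M) M>0 hm 4S≤M hs (≤-trans hnew new≤)
            where
            4S≤M : 4 * (suc m * s) ≤ M
            4S≤M = ≤-trans (m≤m*n (4 * S) (2 ^ (2 * S)) {{m^n≢0 2 (2 * S)}}) hM
            M>0 : 0 < M
            M>0 = ≤-trans (≤-trans s>0 (≤-trans (m≤n*m s (suc m)) (m≤n*m S 4))) 4S≤M
            arith : ∀ n s k t M G x → 0 < M → 2 * n ≤ k * t → 4 * (k * s) ≤ M → 2 * x ≤ t → M * t ≤ n * s + M * G → x ≤ G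
            arith n s k t M G x M>0 h₁ h₂ h₃ h₄ = *-cancelˡ-≤ 8 (≤-trans (≤-by (6 * x) z≤n (eq₀ x)) (*-cancelˡ-≤ M {{>-nonZero M>0}}
              (≤-by 0 (+-mono-≤ (*-monoˡ-≤ (4 * s) h₁) (+-mono-≤ (*-monoˡ-≤ t h₂) (+-mono-≤ (*-monoʳ-≤ (7 * M) h₃) (*-monoʳ-≤ 8 h₄)))) (eq n s k t M G x))))
              where
              eq₀ : ∀ x → 8 * x + 0 + 6 * x ≡ 14 * x + 0
              eq₀ = solve-∀
              eq : ∀ n s k t M G x → M * (14 * x) + (k * t * (4 * s) + (M * t + (7 * M * t + 8 * (n * s + M * G)))) + 0
                ≡ M * (8 * G) + (2 * n * (4 * s) + (4 * (k * s) * t + (7 * M * (2 * x) + 8 * (M * t))))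
              eq = solve-∀

          same : Common (E (not c)) Ws (filterᵇ good Vs) s s
          same = common (E (not c)) Ws (filterᵇ good Vs) s s s>0
            (≤-trans (≤-reflexive (cong (λ x → s * 2 ^ x) length-Ws)) (≤-trans many (≤-reflexive (sym (length-filterᵇ good Vs)))))
            (unique-filterᵇ good (Uniqueₚ.allFin⁺ n))
            (λ u mu → dec-true (s ≤? _) (proj₂ (∧-true (unc (not c) u) (proj₂ (∈-filterᵇ⁻ good Vs mu)))))

          open Common same renaming (chosen to Us; profile to p)

          Ps : List V
          Ps = take s (filterᵇ p Ws)

          Us-unc : ∀ u → u ∈ Us → unc (not c) u ≡ true
          Us-unc u mu = proj₁ (∧-true (unc (not c) u) (proj₂ (∈-filterᵇ⁻ good Vs (chosen-⊆ u mu))))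

          Ps∈ : ∀ w → w ∈ Ps → w ∈ Ws × p w ≡ true
          Ps∈ w mw = ∈-filterᵇ⁻ p Ws (∈-take⁻ s (filterᵇ p Ws) mw)

          made : ∃ λ (T : Tile s) → verts T ↭ Ps ++ Us
          made = make-tile c Ps Us (length-take-≤ s (filterᵇ p Ws) (≤-trans profile-large (≤-reflexive (sym (length-filterᵇ p Ws))))) chosen-length
            (λ v mv → Ws-Z v (proj₁ (Ps∈ v mv)))
            (λ u mu → proj₁ (∧-true (Z (not c) u) (Us-unc u mu)))
            (λ w u mw mu → E-sym′ c u w (profile-adjacent u mu w (proj₁ (Ps∈ w mw)) (proj₂ (Ps∈ w mw))))

          tile-unique : Unique (Ps ++ Us)
          tile-unique = Uniqueₚ.++⁺ (Uniqueₚ.take⁺ s (unique-filterᵇ p unique-Ws)) chosen-unique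
            -- A vertex used on both sides of the new tile would be adjacent to itself.
            λ { {v} (m₁ , m₂) → no-loop (not c) v (profile-adjacent v m₂ v (proj₁ (Ps∈ v m₁)) (proj₂ (Ps∈ v m₁))) }

          out : ∀ v → v ∈ Ps ++ Us → v ∉ C
          out v mv = [ (λ x → unc-∉ c v (Ws-unc v (proj₁ (Ps∈ v x)))) , (λ x → unc-∉ (not c) v (Us-unc v x)) ]′ (∈-++⁻ Ps mv)

          perm : (Ps ++ Us) ++ C ↭ verts* (proj₁ made ∷ N) ++ verts* O
          perm = ↭-trans {j = verts (proj₁ made) ++ C} (↭ₚ.++⁺ʳ C (↭-sym (proj₂ made))) (↭-sym (↭ₚ.++-assoc (verts (proj₁ made)) (verts* N) (verts* O)))

          unique' : Unique (verts* (proj₁ made ∷ N) ++ verts* O)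
          unique' = Unique-resp-↭ {xs = (Ps ++ Us) ++ C} {ys = verts* (proj₁ made ∷ N) ++ verts* O} perm
            (Uniqueₚ.++⁺ tile-unique unique λ { {v} (m₁ , m₂) → out v m₁ m₂ })

          result : Result
          result = O , proj₁ made ∷ N , unique' , +-suc (suc m * a) b , ≤-trans (≤-reflexive (+-comm 1 b)) (+-monoʳ-≤ b (s≤s z≤n))

        module Convert (hnew : new < M * t) where

          f : Tile S → ℕ
          f T = ∑ (λ w → cnt (R w) (verts T)) Ws

          old≡ : old ≡ ∑ f O
          old≡ = trans (∑-cong Ws (λ w → ∑-concatMap (λ v → if R w v then 1 else 0) verts O)) (∑-swap (λ w T → cnt (R w) (verts T)) Ws O)

          -- Of the at least `M * d` edges at `Ws`, fewer than `M * t` go to uncovered vertices and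
          -- at most `M * 2 * s * b` to small tiles. By `s * b ≤ t` more than `M * (S * a + t)`
          -- remain for the `a` old tiles, and `2 * s * a ≤ t`. Average over the old tiles.
          heavy : ∃ λ T → T ∈ O × M * (S + 2 * s) < f T
          heavy = ∑-pigeonhole f O (M * (S + 2 * s)) (<-≤-trans (arith new old M d t S s a b few count-neighbours hnew (<⇒≤ uncovered) hN) (≤-reflexive old≡))
            where
            few : 2 * (s * a) ≤ t
            few = *-cancelˡ-≤ (suc m) (≤-trans (≤-reflexive (eq m s a)) (≤-trans (*-monoʳ-≤ 2 (≤-trans (≤-trans (m≤m+n (S * a) (s * b)) (≤-trans (m≤m+n (S * a + s * b) (3 * t)) (<⇒≤ uncovered))) d≤n)) hm))
              where
              eq : ∀ m s a → suc m * (2 * (s * a)) ≡ 2 * (suc m * s * a)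
              eq = solve-∀
            arith : ∀ x y M d t S s a b → 2 * (s * a) ≤ t → M * d ≤ x + (M * (b * (2 * s)) + y) → x < M * t →
              S * a + s * b + 3 * t ≤ d → s * b ≤ t → a * (M * (S + 2 * s)) < y
            arith x y M d t S s a b h₁ h₂ h₃ h₄ h₅ = ≤-by 0 (+-mono-≤ (*-monoʳ-≤ M h₁) (+-mono-≤ h₂ (+-mono-≤ h₃ (+-mono-≤ (*-monoʳ-≤ M h₄) (*-monoʳ-≤ M h₅))))) (eq x y M d t S s a b)
              where
              eq : ∀ x y M d t S s a b → suc (a * (M * (S + 2 * s))) + (M * t + (x + (M * (b * (2 * s)) + y) + (M * t + (M * d + M * t)))) + 0
                ≡ y + (M * (2 * (s * a)) + (M * d + (suc x + (M * (S * a + s * b + 3 * t) + M * (s * b)))))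
              eq = solve-∀

          T : Tile S
          T = proj₁ heavy

          good : V → Bool
          good w = does (S + s ≤? cnt (R w) (verts T))

          upper : f T ≤ M * (S + s) + 2 * S * cnt good Ws
          upper = subst (λ x → f T ≤ x * (S + s) + 2 * S * cnt good Ws) length-Ws
            (∑-≤-exceptional (λ w → cnt (R w) (verts T)) good Ws (S + s) (2 * S)
              (λ w e → <⇒≤ (≰⇒> (dec-false (S + s ≤? cnt (R w) (verts T)) e)))
              (λ w → ≤-trans (cnt≤length (R w) (verts T)) (≤-reflexive (length-verts T))))

          arith : ∀ M S s F G p → 0 < S → M * (S + 2 * s) ≤ F → F ≤ M * (S + s) + 2 * S * G → 4 * S * p ≤ M → 2 * s * p ≤ G
          arith M S s F G p S>0 h₁ h₂ h₃ = *-cancelˡ-≤ (2 * S) {{m*n≢0 2 S {{_}} {{>-nonZero S>0}}}}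
            (≤-by 0 (+-mono-≤ h₁ (+-mono-≤ h₂ (*-monoʳ-≤ s h₃))) (eq M S s F G p))
            where
            eq : ∀ M S s F G p → 2 * S * (2 * s * p) + (F + (M * (S + s) + 2 * S * G + s * M)) + 0 ≡ 2 * S * G + (M * (S + 2 * s) + (F + s * (4 * S * p)))
            eq = solve-∀

          -- No vertex has more than `2 * S` neighbours in `T`, so the excess `M * s` over the
          -- threshold `S + s` comes from at least `M * s / (2 * S)` vertices. The lower bound on
          -- `M` leaves enough of them for pigeonhole on the `2 * S` vertices of `T`.
          many : 2 * s * 2 ^ (2 * S) ≤ cnt good Ws
          many = arith M S s (f T) (cnt good Ws) (2 ^ (2 * S)) (≤-trans s>0 (m≤n*m s (suc m))) (<⇒≤ (proj₂ (proj₂ heavy))) upper hM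

          many' : 2 * s * 2 ^ length (verts T) ≤ length (filterᵇ good Ws)
          many' = ≤-trans (≤-reflexive (cong (λ x → 2 * s * 2 ^ x) (length-verts T))) (≤-trans many (≤-reflexive (sym (length-filterᵇ good Ws))))

          same : Common R (verts T) (filterᵇ good Ws) (2 * s) (S + s)
          same = common R (verts T) (filterᵇ good Ws) (2 * s) (S + s) (≤-trans s>0 (m≤m+n s _)) many' (unique-filterᵇ good unique-Ws)
            (λ w mw → dec-true (S + s ≤? cnt (R w) (verts T)) (proj₂ (∈-filterᵇ⁻ good Ws mw)))

          open Common same renaming (chosen to W; profile to p)

          W-Ws : ∀ w → w ∈ W → w ∈ Ws
          W-Ws w mw = proj₁ (∈-filterᵇ⁻ good Ws (chosen-⊆ w mw))

          rebuilt : ∃ λ (Us : List (Tile s)) → length Us ≡ 2 + m × verts* Us ↭ W ++ verts T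
          rebuilt = Rebuild.rebuild s m s>0 c T W chosen-length (λ v mv → Ws-Z v (W-Ws v mv)) p profile-large profile-adjacent

          removed : ∃ λ (O' : List (Tile S)) → length O ≡ suc (length O') × verts* O ↭ verts T ++ verts* O'
          removed = remove T O (proj₁ (proj₂ heavy))

          Us : List (Tile s)
          Us = proj₁ rebuilt

          O' : List (Tile S)
          O' = proj₁ removed

          perm : verts* (Us ++ N) ++ verts* O' ↭ W ++ C
          perm = ↭-trans {j = ((W ++ verts T) ++ verts* N) ++ verts* O'}
            (↭ₚ.++⁺ʳ (verts* O') (↭-trans {j = verts* Us ++ verts* N} (↭-reflexive (verts*-++ Us N)) (↭ₚ.++⁺ʳ (verts* N) (proj₂ (proj₂ rebuilt)))))
            (↭-trans {j = W ++ (verts* N ++ (verts T ++ verts* O'))}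
              (↭-solve 4 (λ w t x y → ((w ⊕ t) ⊕ x) ⊕ y ⊜ w ⊕ (x ⊕ (t ⊕ y))) ↭-refl W (verts T) (verts* N) (verts* O'))
              (↭ₚ.++⁺ˡ W (↭ₚ.++⁺ˡ (verts* N) (↭-sym (proj₂ (proj₂ removed))))))

          unique' : Unique (verts* (Us ++ N) ++ verts* O')
          unique' = Unique-resp-↭ {xs = W ++ C} {ys = verts* (Us ++ N) ++ verts* O'} (↭-sym perm)
            (Uniqueₚ.++⁺ chosen-unique unique λ { {v} (m₁ , m₂) → unc-∉ c v (Ws-unc v (W-Ws v m₁)) m₂ })

          total : suc m * length O' + length (Us ++ N) ≡ suc (suc m * a + b)
          total = trans (cong (suc m * length O' +_) (trans (length-++ Us) (cong (_+ b) (proj₁ (proj₂ rebuilt)))))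
            (trans (eq m (length O') b) (cong (λ x → suc (suc m * x + b)) (sym (proj₁ (proj₂ removed)))))
            where
            eq : ∀ m o b → suc m * o + (2 + m + b) ≡ suc (suc m * suc o + b)
            eq = solve-∀

          result : Result
          result = O' , Us ++ N , unique' , total , ≤-reflexive (trans (length-++ Us) (trans (cong (_+ b) (proj₁ (proj₂ rebuilt))) (+-comm (2 + m) b)))

        result : Result
        result with M * t ≤? new
        ... | yes h = Fresh.result h
        ... | no h = Convert.result (≰⇒> h)

      result : Result
      result = Side.result (proj₁ large-side) (proj₂ large-side)

    module Rounds (m t M Smax g s₀ : ℕ) (s₀>0 : 0 < s₀)
      (hm : 2 * n ≤ suc m * t) (hs : 2 * (Smax * 2 ^ M) ≤ t) (hMt : M ≤ t) (hM : 4 * Smax * 2 ^ (2 * Smax) ≤ M)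
      (hg : (g + Smax) * (2 + m) ≤ t) where

      -- Rebuilding needs tiles `m + 1` times as large as the ones gained, so tile sizes go down
      -- from round to round and `scale` is read backwards, ending with `s₀`.
      scale : ℕ → ℕ
      scale zero = s₀
      scale (suc i) = suc m * scale i

      scale>0 : ∀ i → 0 < scale i
      scale>0 zero = s₀>0
      scale>0 (suc i) = ≤-trans (scale>0 i) (m≤m+n (scale i) _)

      module Round (s : ℕ) (s>0 : 0 < s) (sS : suc m * s ≤ Smax) where

        -- Each augmentation adds at most `2 + m` small tiles. The budget hypothesis keeps their
        -- total size at most `t` throughout, as a single augmentation requires.
        augment : ∀ x (O : List (Tile (suc m * s))) (N : List (Tile s)) → Unique (verts* N ++ verts* O) →
          s * (length N + x * (2 + m)) ≤ t →
          ∃ λ (O' : List (Tile (suc m * s))) → ∃ λ (N' : List (Tile s)) → Unique (verts* N' ++ verts* O') ×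
            (d ≤ suc m * s * length O' + s * length N' + 3 * t ⊎ suc m * length O' + length N' ≡ x + (suc m * length O + length N))
        augment zero O N u h = O , N , u , inj₂ refl
        augment (suc x) O N u h with d ≤? suc m * s * length O + s * length N + 3 * t
        ... | yes p = O , N , u , inj₁ p
        ... | no ¬p with Augment.result s m t M s>0 O N hm hs' hMt hM' (≤-trans (*-monoʳ-≤ s (m≤m+n (length N) _)) h) u (≰⇒> ¬p)
          where
          s≤S : s ≤ Smax
          s≤S = ≤-trans (m≤m+n s _) sS
          hs' : 2 * (s * 2 ^ M) ≤ t
          hs' = ≤-trans (*-monoʳ-≤ 2 (*-monoˡ-≤ (2 ^ M) s≤S)) hs
          hM' : 4 * (suc m * s) * 2 ^ (2 * (suc m * s)) ≤ M
          hM' = ≤-trans (*-mono-≤ (*-monoʳ-≤ 4 sS) (^-monoʳ-≤ 2 (*-monoʳ-≤ 2 sS))) hM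
        ...   | O' , N' , u' , eq , lN with augment x O' N' u' (≤-trans (*-monoʳ-≤ s (≤-trans (+-monoˡ-≤ _ lN) (≤-reflexive (+-assoc (length N) (2 + m) _)))) h)
        ...     | O″ , N″ , u″ , inj₁ p = O″ , N″ , u″ , inj₁ p
        ...     | O″ , N″ , u″ , inj₂ e = O″ , N″ , u″ , inj₂ (trans e (trans (cong (x +_) eq) (+-suc x _)))

        round : (Ts : List (Tile (suc m * s))) → Unique (verts* Ts) →
          ∃ λ (Us : List (Tile s)) → Unique (verts* Us) × (d ≤ s * length Us + 3 * t ⊎ suc m * s * length Ts + g ≤ s * length Us)
        round Ts u with augment x Ts [] u fits
          where
          instance
            s≢0 : NonZero s
            s≢0 = >-nonZero s>0
          x : ℕ
          -- The number of gained tiles of size `s` that are together worth at least `g`.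
          x = suc (g / s)
          fits : s * (0 + x * (2 + m)) ≤ t
          fits = ≤-trans (≤-reflexive (sym (*-assoc s x (2 + m)))) (≤-trans (*-monoˡ-≤ (2 + m) (≤-trans (≤-reflexive (*-suc s (g / s)))
            (≤-trans (≤-reflexive (+-comm s _)) (+-mono-≤ (≤-trans (≤-reflexive (*-comm s (g / s))) (m/n*n≤m g s)) (≤-trans (m≤m+n s _) sS))))) hg)
        ... | O , N , u' , alt with refine s (suc m) O
        ...   | Us , lU , perm = N ++ Us , Unique-resp-↭ {xs = verts* N ++ verts* O} {ys = verts* (N ++ Us)}
          (↭-trans {j = verts* N ++ verts* Us} (↭ₚ.++⁺ˡ (verts* N) (↭-sym perm)) (↭-reflexive (sym (verts*-++ N Us)))) u' , done alt
          where
          instance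
            s≢0 : NonZero s
            s≢0 = >-nonZero s>0
          count : length (N ++ Us) ≡ length O * suc m + length N
          count = trans (length-++ N) (trans (+-comm (length N) _) (cong (_+ length N) lU))
          eq₁ : ∀ k s o x → k * s * o + s * x ≡ s * (o * k + x)
          eq₁ = solve-∀
          gain : g ≤ s * suc (g / s)
          gain = ≤-trans (≤-reflexive (m≡m%n+[m/n]*n g s)) (≤-trans (+-monoˡ-≤ _ (<⇒≤ (m%n<n g s))) (≤-reflexive (trans (cong (s +_) (*-comm (g / s) s)) (sym (*-suc s (g / s))))))
          done : (d ≤ suc m * s * length O + s * length N + 3 * t ⊎ suc m * length O + length N ≡ suc (g / s) + (suc m * length Ts + 0)) →
            d ≤ s * length (N ++ Us) + 3 * t ⊎ suc m * s * length Ts + g ≤ s * length (N ++ Us)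
          done (inj₁ p) = inj₁ (≤-trans p (≤-reflexive (cong (_+ 3 * t) (trans (eq₁ (suc m) s (length O) (length N)) (cong (s *_) (sym count))))))
          done (inj₂ e) = inj₂ (≤-trans (+-monoʳ-≤ (suc m * s * length Ts) gain) (≤-reflexive (trans (eq₂ (suc m) s (length Ts) (suc (g / s)))
              (cong (s *_) (trans (sym e) (trans (cong (_+ length N) (*-comm (suc m) (length O))) (sym count)))))))
            where
            eq₂ : ∀ k s o x → k * s * o + s * x ≡ s * (x + (k * o + 0))
            eq₂ = solve-∀

      -- The invariant is that the deficit is at most `r * g + 3 * t`. A round either reaches a
      -- deficit of `3 * t` or reduces it by `g`. Thus the empty tiling with `d ≤ r * g` is a valid
      -- start.
      rounds : ∀ r → scale r ≤ Smax → (Ts : List (Tile (scale r))) → Unique (verts* Ts) → d ≤ scale r * length Ts + r * g + 3 * t →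
        ∃ λ (Us : List (Tile s₀)) → Unique (verts* Us) × d ≤ s₀ * length Us + 3 * t
      rounds zero sr Ts u h = Ts , u , ≤-trans h (≤-reflexive (cong (_+ 3 * t) (+-identityʳ (s₀ * length Ts))))
      rounds (suc r) sr Ts u h with Round.round (scale r) (scale>0 r) sr Ts u
      ... | Us , u' , alt = rounds r (≤-trans (m≤m+n (scale r) _) sr) Us u' (bound alt)
        where
        x = scale r * length Us
        bound : d ≤ x + 3 * t ⊎ suc m * scale r * length Ts + g ≤ x → d ≤ x + r * g + 3 * t
        bound (inj₁ p) = ≤-trans p (+-monoˡ-≤ (3 * t) (m≤m+n x (r * g)))
        bound (inj₂ p) = ≤-trans h (≤-trans (≤-reflexive (cong (_+ 3 * t) (sym (+-assoc (suc m * scale r * length Ts) g (r * g))))) (+-monoˡ-≤ (3 * t) (+-monoˡ-≤ (r * g) p)))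

      tiling : ∀ r → scale r ≤ Smax → d ≤ r * g → ∃ λ (Us : List (Tile s₀)) → Unique (verts* Us) × d ≤ s₀ * length Us + 3 * t
      tiling r sr h = rounds r sr [] [] (≤-trans h (≤-trans (m≤n+m (r * g) (scale r * 0)) (m≤m+n (scale r * 0 + r * g) (3 * t))))

  -- Parities, and counting in lists of vertices.

  flips : ℕ → Bool → Bool
  flips zero b = b
  flips (suc k) b = flips k (not b)

  flips-+ : ∀ i j b → flips (i + j) b ≡ flips j (flips i b)
  flips-+ zero j b = refl
  flips-+ (suc i) j b = flips-+ i j (not b)

  flips-odd : ∀ κ b → flips (suc (2 * κ)) b ≡ not b
  flips-odd zero b = refl
  flips-odd (suc κ) b = trans (cong (λ x → flips x (not (not b))) (+-suc κ (κ + 0))) (trans (flips-odd κ (not (not b))) (cong not (Boolₚ.not-involutive b)))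

  cnt-↭ : ∀ (p : A → Bool) {xs ys} → xs ↭ ys → cnt p xs ≡ cnt p ys
  cnt-↭ p ↭.refl = refl
  cnt-↭ p (prep x h) = cong (_ +_) (cnt-↭ p h)
  cnt-↭ p (swap x y h) rewrite cnt-↭ p h = lem (if p x then 1 else 0) (if p y then 1 else 0) _
    where
    lem : ∀ a b c → a + (b + c) ≡ b + (a + c)
    lem = solve-∀
  cnt-↭ p (↭.trans h h') = trans (cnt-↭ p h) (cnt-↭ p h')

  cnt≤1 : ∀ (p : A → Bool) {xs} → Unique xs → (∀ i j → p i ≡ true → p j ≡ true → i ≡ j) → cnt p xs ≤ 1
  cnt≤1 p [] h = z≤n
  cnt≤1 p {x ∷ xs} (a ∷ u) h with p x in eq
  ... | false = cnt≤1 p u h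
  ... | true = s≤s (≤-trans (cnt-mono {q = λ _ → false} xs λ y my e → ⊥-elim (All.lookup a my (h x y eq e))) (≤-reflexive (trans (∑-const 0 xs) (*-zeroʳ (length xs)))))

  cnt-∈-swap : ∀ {n} {P U : List (Fin n)} → Unique P → cnt (_∈ᵇ U) P ≤ cnt (_∈ᵇ P) U
  cnt-∈-swap {n} {P} {U} uP = ≤-trans (cnt-remove (_∈ᵇ U) C uP) (≤-trans (+-mono-≤ none (≤-trans (cnt≤length _ C) (≤-reflexive (length-filterᵇ (_∈ᵇ P) U)))) ≤-refl)
    where
    C : List (Fin n)
    C = filterᵇ (_∈ᵇ P) U
    none : cnt (λ v → (v ∈ᵇ U) ∧ not (v ∈ᵇ C)) P ≤ 0
    none = ≤-trans (cnt-mono {q = λ _ → false} P λ v mv e →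
        let x , y = ∧-true (v ∈ᵇ U) e in ⊥-elim (∉ᵇ⁻ {C = C} y (∈-filterᵇ⁺ (_∈ᵇ P) U (∈ᵇ⁻ x) (∈ᵇ⁺ mv))))
      (≤-reflexive (trans (∑-const 0 P) (*-zeroʳ (length P))))

  unique-length : ∀ {n} (xs : List (Fin n)) → Unique xs → length xs ≤ n
  unique-length {n} xs u = ≤-trans (≤-reflexive (sym (cnt-all xs))) (≤-trans (cnt-remove (λ _ → true) Vs u)
    (≤-trans (+-mono-≤ none (≤-trans (cnt≤length _ (Vs {n})) (≤-reflexive (length-Vs {n})))) ≤-refl))
    where
    cnt-all : ∀ ys → cnt (λ _ → true) ys ≡ length ys
    cnt-all [] = refl
    cnt-all (y ∷ ys) = cong suc (cnt-all ys)
    none : cnt (λ v → true ∧ not (v ∈ᵇ Vs)) xs ≤ 0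
    none = ≤-trans (cnt-mono {q = λ _ → false} xs λ v _ e → ⊥-elim (∉ᵇ⁻ {C = Vs} e (∈-allFin v))) (≤-reflexive (trans (∑-const 0 xs) (*-zeroʳ (length xs))))

  lookup-injective : ∀ {A : Set} (xs : List A) → Unique xs → ∀ i j → lookup xs i ≡ lookup xs j → i ≡ j
  lookup-injective (x ∷ xs) (a ∷ u) fzero fzero e = refl
  lookup-injective (x ∷ xs) (a ∷ u) fzero (fsuc j) e = ⊥-elim (All.lookup a (∈-lookup j) e)
  lookup-injective (x ∷ xs) (a ∷ u) (fsuc i) fzero e = ⊥-elim (All.lookup a (∈-lookup i) (sym e))
  lookup-injective (x ∷ xs) (a ∷ u) (fsuc i) (fsuc j) e = cong fsuc (lookup-injective xs u i j e)

  -- An order of the branch vertices from the forest of short edges.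

  module Forest {h : ℕ} (g : EdgeFun h) (forest : ShortEdgesForest g) where

    short? : ∀ i j → Dec (Short g i j)
    short? i j = ((i Finₚ.<? j) ×-dec (g i j <? 3)) ⊎-dec ((j Finₚ.<? i) ×-dec (g j i <? 3))

    short-irrefl : ∀ {i} → ¬ Short g i i
    short-irrefl (inj₁ (p , _)) = Finₚ.<-irrefl refl p
    short-irrefl (inj₂ (p , _)) = Finₚ.<-irrefl refl p

    short-sym : ∀ {i j} → Short g i j → Short g j i
    short-sym = Sum.swap

    data Chain : Fin h → List (Fin h) → Set where
      [] : ∀ {x} → Chain x []
      _∷_ : ∀ {x y ys} → Short g x y → Chain y ys → Chain x (y ∷ ys)

    chain-lookup : ∀ {x ys} → Chain x ys → ∀ t → Short g (lookup (x ∷ ys) (inject₁ t)) (lookup (x ∷ ys) (fsuc t))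
    chain-lookup (s ∷ c) fzero = s
    chain-lookup (s ∷ c) (fsuc t) = chain-lookup c t

    truncate : ∀ {x w} ys → Chain x ys → w ∈ ys → ∃ λ zs → ∃ λ rest → zs ++ rest ≡ ys × Chain x zs × lookup (x ∷ zs) (fromℕ (length zs)) ≡ w × 1 ≤ length zs
    truncate (y ∷ ys) (s ∷ c) (here refl) = y ∷ [] , ys , refl , s ∷ [] , refl , s≤s z≤n
    truncate (y ∷ ys) (s ∷ c) (there m) = let zs , rest , e , c' , l , _ = truncate ys c m in y ∷ zs , rest , cong (y ∷_) e , s ∷ c' , l , s≤s z≤n

    Leaf : List (Fin h) → Fin h → Set
    Leaf xs x = ∀ y z → y ∈ xs → z ∈ xs → Short g x y → Short g x z → y ≡ z

    leaf-or-next : ∀ xs x u → Leaf xs x ⊎ ∃ λ w → w ∈ xs × Short g x w × w ≢ u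
    leaf-or-next xs x u with any? (λ w → (short? x w) ×-dec ¬? (w Finₚ.≟ u)) xs
    ... | yes p = let w , m , s , ne = find p in inj₂ (w , m , s , ne)
    ... | no ¬p = inj₁ λ y z my mz sy sz → trans (all-u y my sy) (sym (all-u z mz sz))
      where
      all-u : ∀ y → y ∈ xs → Short g x y → y ≡ u
      all-u y my sy with y Finₚ.≟ u
      ... | yes e = e
      ... | no ne = ⊥-elim (¬p (lose my (sy , ne)))

    -- A path of short edges is extended at its end `v` by a neighbour other than the previous
    -- vertex `u`. A neighbour further back on the path would close a cycle of length at least 3,
    -- cut out by `truncate`. So the path stays simple, cannot exceed `h` vertices, and gets stuck
    -- at a leaf.
    leaf-search : ∀ fuel xs v u rest → h < fuel + suc (suc (length rest)) → v ∈ xs → Chain v (u ∷ rest) → Unique (v ∷ u ∷ rest) → ∃ λ x → x ∈ xs × Leaf xs x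
    leaf-search zero xs v u rest hf mv c un = ⊥-elim (<⇒≱ hf (unique-length _ un))
    leaf-search (suc fuel) xs v u rest hf mv c un with leaf-or-next xs v u
    ... | inj₁ l = v , mv , l
    ... | inj₂ (w , mw , s , ne) with any? (w Finₚ.≟_) (v ∷ u ∷ rest)
    ...   | no ¬p = leaf-search fuel xs w v (u ∷ rest) (≤-trans hf (≤-reflexive (sym (+-suc fuel _)))) mw (short-sym s ∷ c) (Allₚ.¬Any⇒All¬ _ ¬p ∷ un)
    ...   | yes (here refl) = ⊥-elim (short-irrefl s)
    ...   | yes (there (here e)) = ⊥-elim (ne e)
    leaf-search (suc fuel) xs v u rest hf mv (s₀ ∷ c) un | inj₂ (w , mw , s , ne) | yes (there (there p)) with truncate rest c p
    ...     | zs , tl , e , c' , l , z≥1 = ⊥-elim (forest (suc (length zs)) (s≤s z≥1) (lookup (v ∷ u ∷ zs))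
        (lookup-injective (v ∷ u ∷ zs) (Unique-++ˡ (v ∷ u ∷ zs) (subst (λ t → Unique (v ∷ u ∷ t)) (sym e) un)))
        (chain-lookup (s₀ ∷ c')) (subst (λ t → Short g t v) (sym l) (short-sym s)))

    leaf : ∀ x xs → ∃ λ y → y ∈ x ∷ xs × Leaf (x ∷ xs) y
    leaf x xs with leaf-or-next (x ∷ xs) x x
    ... | inj₁ l = x , here refl , l
    ... | inj₂ (w , mw , s , ne) = leaf-search h (x ∷ xs) w x [] (≤-trans (≤-reflexive (+-comm 1 h)) (+-monoʳ-≤ h (n≤1+n 1))) mw (short-sym s ∷ []) ((ne ∷ []) ∷ [] ∷ [])

    -- The head is removed first and hence placed last: when it is placed, exactly the tail has been
    -- placed, with at most one short edge to it.
    data Peel : List (Fin h) → Set where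
      [] : Peel []
      peel : ∀ {x xs} → Leaf xs x → x ∉ xs → Peel xs → Peel (x ∷ xs)

    peeling : ∀ r xs → length xs ≡ r → Unique xs → ∃ λ ys → Peel ys × xs ↭ ys
    peeling zero [] e u = [] , [] , ↭-refl
    peeling (suc r) (x ∷ xs) e u with leaf x xs
    ... | y , my , l with ∈-∃++ my
    ...   | as , bs , eq with subst (λ t → t ↭ y ∷ as ++ bs) (sym eq) (↭ₚ.shift y as bs)
    ...     | p with Unique-resp-↭ p u
    ...       | a ∷ u' with peeling r (as ++ bs) (suc-injective (trans (sym (↭ₚ.↭-length p)) e)) u'
    ...         | ys , pl , q = y ∷ ys , peel (λ z w mz mw → l z w (back mz) (back mw)) (λ m → Uniqueₚ.Unique[x∷xs]⇒x∉xs (a ∷ u') (↭ₚ.∈-resp-↭ (↭-sym q) m)) pl , ↭-trans p (_↭_.prep y q)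
      where
      back : ∀ {z} → z ∈ ys → z ∈ x ∷ xs
      back m = ↭ₚ.∈-resp-↭ (↭-sym p) (there (↭ₚ.∈-resp-↭ (↭-sym q) m))

    order : ∃ λ ys → Peel ys × (∀ i → i ∈ ys) × length ys ≡ h
    order with peeling h (allFin h) (length-tabulate {n = h} (λ i → i)) (Uniqueₚ.allFin⁺ h)
    ... | ys , pl , p = ys , pl , (λ i → ↭ₚ.∈-resp-↭ p (∈-allFin i)) , trans (sym (↭ₚ.↭-length p)) (length-tabulate {n = h} (λ i → i))

  -- Path systems, and the data needed to build them.

  record PathSystem {n : ℕ} (D : Digraph n) {h : ℕ} (g : EdgeFun h) (side : Fin h → Bool) : Set where
    open Graph D using (Walk)
    field
      φ : Fin h → Fin n
      interior : ∀ i j → i <ᶠ j → List (Fin n)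
      walks : ∀ i j p → Walk (side i) (φ i) (interior i j p) (side j) (φ j)
      lengths : ∀ i j p → suc (length (interior i j p)) ≡ g i j
      φ-injective : ∀ i j → φ i ≡ φ j → i ≡ j
      interior-unique : ∀ i j p → Unique (interior i j p)
      interior-branch : ∀ i j p l → φ l ∉ interior i j p
      interior-disjoint : ∀ i j p i' j' p' v → v ∈ interior i j p → v ∈ interior i' j' p' → (i , j) ≡ (i' , j')

  -- At most `cap` vertices are used outside traversals. A tile hit `θ` times is frozen; since a
  -- single connection adds at most `L + 2 ≤ θ` vertices, no tile is ever hit more than `2 * θ`
  -- times, and `κs` leaves `κ` free vertices in each of its parts. A traversal uses these and has
  -- `J` edges. `fits` bounds the used vertices, the at most `cap / θ` frozen tiles and two end
  -- vertices by `f`. `tiles-suffice` says that `q - cap / θ` tiles of `J` edges are worth more than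
  -- `k`.
  record Setup {n : ℕ} (D : Digraph n) : Set where
    field
      oriented : Oriented D
      Z : Bool → Fin n → Bool
      L f : ℕ
      conn : ∀ b u c v → Z b u ≡ true → Z c v ≡ true → ∀ F → length F ≤ f →
        ∃ λ ps → Graph.Walk D c v ps b u × length ps ≤ L × Unique ps × All (_∉ F) ps
      hub : Hubs.Hub D Z f
      s θ κ J q : ℕ
      J≡ : J ≡ suc (2 * κ)
      tile : Fin q → Tiles.Tile D Z s
      tile-disjoint : ∀ i j v → v ∈ Tiles.verts D Z (tile i) → v ∈ Tiles.verts D Z (tile j) → i ≡ j
      tile-unique : ∀ i → Unique (Tiles.verts D Z (tile i))
      θ>0 : 0 < θ
      Lθ : L + 2 ≤ θ
      κs : κ + 2 * θ ≤ s
      k cap : ℕ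
      fits : θ * (cap + 2) + 2 * s * cap ≤ θ * f
      tiles-suffice : θ * k + J * cap < J * (θ * q)

  -- Routing a single path through tiles and hub.

  module Routing {n : ℕ} {D : Digraph n} (S : Setup D) where

    open Setup S

    open Graph D
    open Tiles D Z
    open Hubs D using (module Hub)
    open Hub hub

    hit : Fin q → List V → ℕ
    hit i U = cnt (_∈ᵇ verts (tile i)) U

    frozen : List V → Fin q → List V
    frozen U i = if does (θ ≤? hit i U) then verts (tile i) else []

    -- Avoiding the tiles that have been hit θ times keeps every tile almost intact.
    avoid : List V → List V
    avoid U = U ++ concatMap (frozen U) (allFin q)

    ∉avoid⇒∉ : ∀ {U v} → v ∉ avoid U → v ∉ U
    ∉avoid⇒∉ h m = h (∈-++⁺ˡ m)

    ∈-concatMap : ∀ {B C : Set} (g : B → List C) {xs x v} → x ∈ xs → v ∈ g x → v ∈ concatMap g xs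
    ∈-concatMap g {x ∷ xs} (here refl) m = ∈-++⁺ˡ m
    ∈-concatMap g {x ∷ xs} (there mx) m = ∈-++⁺ʳ (g x) (∈-concatMap g mx m)

    ∈-concatMap⁻ : ∀ {B C : Set} (g : B → List C) xs {v} → v ∈ concatMap g xs → ∃ λ x → x ∈ xs × v ∈ g x
    ∈-concatMap⁻ g (x ∷ xs) m with ∈-++⁻ (g x) m
    ... | inj₁ m' = x , here refl , m'
    ... | inj₂ m' = let y , my , h = ∈-concatMap⁻ g xs m' in y , there my , h

    frozen-avoided : ∀ {U v} i → θ ≤ hit i U → v ∈ verts (tile i) → v ∈ avoid U
    frozen-avoided {U} {v} i h m = ∈-++⁺ʳ U (∈-concatMap (frozen U) (∈-allFin i)
      (subst (λ x → v ∈ (if x then verts (tile i) else [])) (sym (true-dec (θ ≤? hit i U) h)) m))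

    live-∉avoid : ∀ {U v} i → hit i U < θ → v ∈ verts (tile i) → v ∉ U → v ∉ avoid U
    live-∉avoid {U} {v} i h m v∉U m' with ∈-++⁻ U m'
    ... | inj₁ x = v∉U x
    ... | inj₂ x with ∈-concatMap⁻ (frozen U) (allFin q) x
    ...   | j , _ , mj with does (θ ≤? hit j U) in eq
    ...     | true with tile-disjoint i j v m mj
    ...       | refl = <⇒≱ h (dec-true (θ ≤? hit i U) eq)
    live-∉avoid {U} {v} i h m v∉U m' | inj₂ x | j , _ , () | false

    hits : ∀ U → ∑ (λ i → hit i U) (allFin q) ≤ length U
    hits U = ≤-trans (≤-reflexive (∑-swap (λ i v → if v ∈ᵇ verts (tile i) then 1 else 0) (allFin q) U))
      (≤-trans (∑-≤-const U 1 λ v _ → cnt≤1 (λ i → v ∈ᵇ verts (tile i)) (Uniqueₚ.allFin⁺ q) λ i j hi hj → tile-disjoint i j v (∈ᵇ⁻ hi) (∈ᵇ⁻ hj))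
        (≤-reflexive (*-identityʳ (length U))))

    length-concatMap : ∀ {B C : Set} (g : B → List C) xs → length (concatMap g xs) ≡ ∑ (λ x → length (g x)) xs
    length-concatMap g [] = refl
    length-concatMap g (x ∷ xs) = trans (length-++ (g x)) (cong (length (g x) +_) (length-concatMap g xs))

    -- A frozen tile has `2 * s` vertices and accounts for at least `θ` hits, while disjointness of
    -- the tiles bounds all hits by `length U`. Multiplying by `θ` avoids a division.
    length-avoid : ∀ U → θ * length (avoid U) ≤ θ * length U + 2 * s * length U
    length-avoid U = begin
      θ * length (avoid U) ≡⟨ cong (θ *_) (trans (length-++ U) (cong (length U +_) (length-concatMap (frozen U) (allFin q)))) ⟩
      θ * (length U + ∑ (λ i → length (frozen U i)) (allFin q)) ≡⟨ *-distribˡ-+ θ (length U) _ ⟩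
      θ * length U + θ * ∑ (λ i → length (frozen U i)) (allFin q) ≡⟨ cong (θ * length U +_) (sym (∑-* θ _ (allFin q))) ⟩
      θ * length U + ∑ (λ i → θ * length (frozen U i)) (allFin q) ≤⟨ +-monoʳ-≤ (θ * length U) (∑-mono (allFin q) λ i _ → each i) ⟩
      θ * length U + ∑ (λ i → 2 * s * hit i U) (allFin q) ≡⟨ cong (θ * length U +_) (∑-* (2 * s) (λ i → hit i U) (allFin q)) ⟩
      θ * length U + 2 * s * ∑ (λ i → hit i U) (allFin q) ≤⟨ +-monoʳ-≤ (θ * length U) (*-monoʳ-≤ (2 * s) (hits U)) ⟩
      θ * length U + 2 * s * length U ∎
      where
      open ≤-Reasoning
      each : ∀ i → θ * length (frozen U i) ≤ 2 * s * hit i U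
      each i with does (θ ≤? hit i U) in eq
      ... | true = ≤-trans (*-mono-≤ (dec-true (θ ≤? hit i U) eq) (≤-reflexive (length-verts (tile i)))) (≤-reflexive (*-comm (hit i U) (2 * s)))
      ... | false = ≤-trans (≤-reflexive (*-zeroʳ θ)) z≤n

    Good : List V → Set
    Good U = ∀ i → hit i U ≤ 2 * θ

    good-resp : ∀ {U U'} → U ↭ U' → Good U → Good U'
    good-resp p g i = ≤-trans (≤-reflexive (sym (cnt-↭ _ p))) (g i)

    -- A tile with `θ` hits is avoided and receives no new ones; any other tile has fewer than `θ`
    -- and receives at most `length ps ≤ θ`.
    good-extend : ∀ {U ps} → Good U → All (_∉ avoid U) ps → length ps ≤ θ → Good (ps ++ U)
    good-extend {U} {ps} g a l i = ≤-trans (≤-reflexive (cnt-++ (_∈ᵇ verts (tile i)) ps U)) (lem (≤-<-connex θ (hit i U)))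
      where
      lem : θ ≤ hit i U ⊎ hit i U < θ → hit i ps + hit i U ≤ 2 * θ
      lem (inj₁ h) = ≤-trans (+-monoˡ-≤ (hit i U) (≤-trans (cnt-mono {q = λ _ → false} ps λ v mv e →
          ⊥-elim (All.lookup a mv (frozen-avoided i h (∈ᵇ⁻ e)))) (≤-reflexive (trans (∑-const 0 ps) (*-zeroʳ (length ps)))))) (g i)
      lem (inj₂ h) = +-mono-≤ (≤-trans (cnt≤length _ ps) l) (≤-trans (<⇒≤ h) (m≤m+n θ 0))

    unique-extend : ∀ {U ps} → Unique U → Unique ps → All (_∉ avoid U) ps → Unique (ps ++ U)
    unique-extend {U} {ps} u up a = Uniqueₚ.++⁺ up u λ { (m₁ , m₂) → ∉avoid⇒∉ (All.lookup a m₁) m₂ }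

    free : ∀ b i U → s ≤ cnt (λ v → not (v ∈ᵇ U)) (part (tile i) b) + hit i U
    free b i U = ≤-trans (≤-reflexive (sym (len (tile i) b))) (≤-trans (≤-reflexive (total (part (tile i) b)))
      (≤-trans (≤-reflexive (+-comm (cnt (_∈ᵇ U) (part (tile i) b)) _)) (+-monoʳ-≤ _ (≤-trans (cnt-∈-swap {U = U} (uniq b)) (cnt-mono U λ v _ e → ∈ᵇ⁺ (sub b (∈ᵇ⁻ e)))))))
      where
      total : ∀ xs → length xs ≡ cnt (_∈ᵇ U) xs + cnt (λ v → not (v ∈ᵇ U)) xs
      total [] = refl
      total (x ∷ xs) with x ∈ᵇ U
      ... | true = cong suc (total xs)
      ... | false = trans (cong suc (total xs)) (sym (+-suc (cnt (_∈ᵇ U) xs) _))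
      uniq : ∀ b → Unique (part (tile i) b)
      uniq true = Unique-++ˡ (part (tile i) true) (tile-unique i)
      uniq false = Unique-++ʳ (part (tile i) true) (tile-unique i)
      sub : ∀ b {v} → v ∈ part (tile i) b → v ∈ verts (tile i)
      sub true = ∈-++⁺ˡ
      sub false = ∈-++⁺ʳ (part (tile i) true)

    -- A walk in which each tile of the list is still to be traversed by a path with 2κ interior vertices.
    data Skeleton : Bool → V → List V → List (Fin q) → ℕ → Bool → V → Set where
      walk : ∀ {b u ps c v} → Walk b u ps c v → Skeleton b u ps [] (suc (length ps)) c v
      _then_ : ∀ {b u ps c v qs is l c' v'} → Walk b u ps c v → Skeleton c v qs is l c' v' → Skeleton b u (ps ++ v ∷ qs) is (suc (length ps) + l) c' v'
      jump : ∀ {i x y ps is l c v} → x ∈ part (tile i) true → y ∈ part (tile i) false →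
        Skeleton false y ps is l c v → Skeleton true x (y ∷ ps) (i ∷ is) (J + l) c v

    join : ∀ {b u ps c v qs c' v'} → Walk b u ps c v → Walk c v qs c' v' → Walk b u (ps ++ v ∷ qs) c' v'
    join (arc e) w = e ⟶ w
    join (e ⟶ w') w = e ⟶ join w' w

    walk-parity : ∀ {b u ps c v} → Walk b u ps c v → c ≡ flips (suc (length ps)) b
    walk-parity (arc e) = refl
    walk-parity (e ⟶ w) = walk-parity w

    -- To be applied to the complete list of vertices used by connections, hub paths and branch
    -- vertices. Traversals chosen only then avoid all of these, and they avoid each other because
    -- visited tiles are distinct and disjoint.
    module Fill (U : List V) (good : Good U) where

      alternate : List V → List V → List V
      alternate (y ∷ ys) (x ∷ xs) = y ∷ x ∷ alternate ys xs
      alternate _ _ = []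

      alternate-↭ : ∀ ys xs → length ys ≡ length xs → alternate ys xs ↭ ys ++ xs
      alternate-↭ [] [] _ = ↭-refl
      alternate-↭ (y ∷ ys) (x ∷ xs) e = prep y (↭-trans (prep x (alternate-↭ ys xs (suc-injective e))) (↭-sym (↭ₚ.shift x ys xs)))

      free-part : Bool → Fin q → List V
      free-part b i = take κ (filterᵇ (λ v → not (v ∈ᵇ U)) (part (tile i) b))

      free-length : ∀ b i → length (free-part b i) ≡ κ
      free-length b i = length-take-≤ κ _ (≤-trans (+-cancelʳ-≤ (2 * θ) _ _ (≤-trans κs (≤-trans (free b i U) (+-monoʳ-≤ _ (good i)))))
        (≤-reflexive (sym (length-filterᵇ (λ v → not (v ∈ᵇ U)) (part (tile i) b)))))

      free-∈ : ∀ b i {v} → v ∈ free-part b i → v ∈ part (tile i) b × v ∉ U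
      free-∈ b i m = let x , y = ∈-filterᵇ⁻ _ (part (tile i) b) (∈-take⁻ κ _ m) in x , ∉ᵇ⁻ y

      fill : Fin q → List V
      fill i = alternate (free-part false i) (free-part true i)

      fill-↭ : ∀ i → fill i ↭ free-part false i ++ free-part true i
      fill-↭ i = alternate-↭ _ _ (trans (free-length false i) (sym (free-length true i)))

      fill-length : ∀ i → length (fill i) ≡ 2 * κ
      fill-length i = trans (↭ₚ.↭-length (fill-↭ i)) (trans (length-++ (free-part false i)) (trans (cong₂ _+_ (free-length false i) (free-length true i)) (cong (κ +_) (sym (+-identityʳ κ)))))

      fill-∈ : ∀ i {v} → v ∈ fill i → v ∈ verts (tile i) × v ∉ U
      fill-∈ i m with ∈-++⁻ (free-part false i) (↭ₚ.∈-resp-↭ (fill-↭ i) m)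
      ... | inj₁ h = let x , y = free-∈ false i h in ∈-++⁺ʳ (part (tile i) true) x , y
      ... | inj₂ h = let x , y = free-∈ true i h in ∈-++⁺ˡ x , y

      fill-unique : ∀ i → Unique (fill i)
      fill-unique i = Unique-resp-↭ (↭-sym (fill-↭ i)) (Uniqueₚ.++⁺
        (Uniqueₚ.take⁺ κ (unique-filterᵇ _ (Unique-++ʳ (part (tile i) true) (tile-unique i))))
        (Uniqueₚ.take⁺ κ (unique-filterᵇ _ (Unique-++ˡ (part (tile i) true) (tile-unique i))))
        λ { (m₁ , m₂) → Unique-disjoint (part (tile i) true) (tile-unique i) (proj₁ (free-∈ true i m₂)) (proj₁ (free-∈ false i m₁)) })

      fills-unique : ∀ is → Unique is → Unique (concatMap fill is)
      fills-unique [] _ = []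
      fills-unique (i ∷ is) (a ∷ u) = Uniqueₚ.++⁺ (fill-unique i) (fills-unique is u) λ { (m₁ , m₂) →
        let j , mj , h = ∈-concatMap⁻ fill is m₂ in All.lookup a mj (tile-disjoint i j _ (proj₁ (fill-∈ i m₁)) (proj₁ (fill-∈ j h))) }

      fills-∉ : ∀ is {v} → v ∈ concatMap fill is → v ∉ U
      fills-∉ is m = let j , _ , h = ∈-concatMap⁻ fill is m in proj₂ (fill-∈ j h)

      traverse : ∀ i {x y} → x ∈ part (tile i) true → y ∈ part (tile i) false → Walk true x (fill i) false y
      traverse i {x} {y} mx my = go (free-part false i) (free-part true i) (λ m → proj₁ (free-∈ false i m)) (λ m → proj₁ (free-∈ true i m)) mx
        where
        go : ∀ ys xs → (∀ {v} → v ∈ ys → v ∈ part (tile i) false) → (∀ {v} → v ∈ xs → v ∈ part (tile i) true) →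
          ∀ {x} → x ∈ part (tile i) true → Walk true x (alternate ys xs) false y
        go [] xs hy hx mx = arc (complete (tile i) _ _ mx my)
        go (y' ∷ ys) [] hy hx mx = arc (complete (tile i) _ _ mx my)
        go (y' ∷ ys) (x' ∷ xs) hy hx mx = complete (tile i) _ _ mx (hy (here refl)) ⟶
          (complete (tile i) _ _ (hx (here refl)) (hy (here refl)) ⟶ go ys xs (λ m → hy (there m)) (λ m → hx (there m)) (hx (here refl)))

      expand : ∀ {b u ps is l c v} → Skeleton b u ps is l c v → ∃ λ qs → Walk b u qs c v × suc (length qs) ≡ l × qs ↭ ps ++ concatMap fill is
      expand {ps = ps} (walk w) = ps , w , refl , ↭-sym (↭ₚ.++-identityʳ ps)
      expand (_then_ {ps = ps} {v = v} {qs = rs} {is = is} w sk) with expand sk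
      ... | qs , w' , e , p = ps ++ v ∷ qs , join w w' , cong suc (trans (length-++ ps) (cong (length ps +_) e)) ,
        ↭-trans (↭ₚ.++⁺ˡ ps (prep v p)) (↭-reflexive (sym (++-assoc ps (v ∷ rs) (concatMap fill is))))
      expand (jump {i} {x} {y} {ps} {is} mx my sk) with expand sk
      ... | qs , w , e , p = fill i ++ y ∷ qs , join (traverse i mx my) w ,
        trans (cong suc (length-++ (fill i))) (trans (cong₂ (λ a b → suc (a + b)) (fill-length i) e) (cong (_+ _) (sym J≡))) ,
        ↭-trans (↭ₚ.shift y (fill i) qs) (prep y (↭-trans (↭ₚ.++⁺ˡ (fill i) p) (↭ₚ.shifts (fill i) ps)))

    no-loop : ∀ b v → E b v v ≡ true → ⊥
    no-loop true v e = true≢false e (proj₁ oriented v)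
    no-loop false v e = true≢false e (proj₁ oriented v)

    J≢0 : NonZero J
    J≢0 = subst NonZero (sym J≡) _

    -- A visit to a tile takes at most `L + 1` edges to reach it and `J` to cross it, and `L + 4`
    -- must remain: `L + 1` for a connection to the hub and 3 inside it. All this fits precisely
    -- when the remaining length exceeds `c₁`.
    c₁ : ℕ
    c₁ = 2 * L + J + 4

    -- R bounds the total length of the paths still to be embedded, e the number of remaining steps outside the tiles.
    record St (U : List V) (Vis : List (Fin q)) (R e : ℕ) : Set where
      field
        unique-used : Unique U
        good : Good U
        unique-vis : Unique Vis
        tiles : J * length Vis + R ≤ k
        room : J * length U + (L + 2) * R + J * (c₁ * e) ≤ J * cap

    open St

    St-resp : ∀ {U U' Vis Vis' R e} → U ↭ U' → Vis ↭ Vis' → St U Vis R e → St U' Vis' R e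
    St-resp {R = R} {e} p p' st = record
      { unique-used = Unique-resp-↭ p (unique-used st)
      ; good = good-resp p (good st)
      ; unique-vis = Unique-resp-↭ p' (unique-vis st)
      ; tiles = subst (λ x → J * x + R ≤ k) (↭ₚ.↭-length p') (tiles st)
      ; room = subst (λ x → J * x + (L + 2) * R + J * (c₁ * e) ≤ J * cap) (↭ₚ.↭-length p) (room st)
      }

    used≤ : ∀ {U Vis R e} → St U Vis R e → length U + c₁ * e ≤ cap
    used≤ {U} {Vis} {R} {e} st = *-cancelˡ-≤ J {{J≢0}} (≤-by ((L + 2) * R) (room st) (eq J (length U) ((L + 2) * R) (c₁ * e) cap))
      where
      eq : ∀ J u x y c → J * (u + y) + J * c + x ≡ J * c + (J * u + x + J * y)
      eq = solve-∀

    avoid≤ : ∀ U → length U ≤ cap → length (avoid U) + 2 ≤ f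
    avoid≤ U h = *-cancelˡ-≤ θ {{>-nonZero θ>0}} (≤-trans (≤-reflexive (*-distribˡ-+ θ _ 2)) (≤-trans (+-monoˡ-≤ (θ * 2) (length-avoid U))
      (≤-trans (+-monoˡ-≤ (θ * 2) (+-mono-≤ (*-monoʳ-≤ θ h) (*-monoʳ-≤ (2 * s) h))) (≤-trans (≤-reflexive (eq θ cap (2 * s))) fits))))
      where
      eq : ∀ t c s → t * c + s * c + t * 2 ≡ t * (c + 2) + s * c
      eq = solve-∀

    avoid≤f : ∀ U → length U ≤ cap → length (avoid U) ≤ f
    avoid≤f U h = ≤-trans (m≤m+n _ 2) (avoid≤ U h)

    -- The inequality `room` is a potential: it reserves `L + 2` vertices for every `J` edges still
    -- to be embedded and `c₁` vertices for each of the `e` remaining steps outside the tiles. Such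
    -- a step is paid for by one unit of `e`.
    St-finish : ∀ {U Vis R e} g ps → St U Vis (g + R) (suc e) → Unique (ps ++ U) → Good (ps ++ U) → length ps ≤ c₁ → St (ps ++ U) Vis R e
    St-finish {U} {Vis} {R} {e} g ps st un gd l = record
      { unique-used = un
      ; good = gd
      ; unique-vis = unique-vis st
      ; tiles = ≤-trans (+-monoʳ-≤ (J * length Vis) (m≤n+m R g)) (tiles st)
      ; room = ≤-trans (≤-reflexive (cong (λ x → J * x + (L + 2) * R + J * (c₁ * e)) (length-++ ps)))
          (≤-by ((L + 2) * g) (+-mono-≤ (room st) (*-monoʳ-≤ J l)) (eq J (length ps) (length U) (L + 2) R c₁ e g cap))
      }
      where
      eq : ∀ J p u l R c e g cap → J * (p + u) + l * R + J * (c * e) + (J * cap + J * c) + l * g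
        ≡ J * cap + (J * u + l * (g + R) + J * (c * suc e) + J * p)
      eq = solve-∀

    -- The first `k` edges are free steps within `W`; parity then puts their last vertex and `a'` on
    -- opposite sides, and a path of length 3 closes the gap. This fixes the length exactly.
    hub-walk : ∀ k b a b' a' U → W b a ≡ true → W b' a' ≡ true → b' ≡ flips (3 + k) b → Unique U → Good U → length U + k ≤ cap →
      ∃ λ ps → Walk b a ps b' a' × length ps ≡ k + 2 × Unique (ps ++ U) × Good (ps ++ U)
    hub-walk zero b a b' a' U wa wa' par un gd room
      with three b a a' wa (subst (λ x → W x a' ≡ true) (trans par (Boolₚ.not-involutive (not b))) wa') (avoid U) (avoid≤f U (≤-trans (m≤m+n _ 0) room))
    ... | y , x , e₁ , e₂ , e₃ , x∉ , y∉ = y ∷ x ∷ [] , three-walk b b' par e₁ e₂ e₃ , refl ,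
      unique-extend un (((λ h → no-loop b x (subst (λ t → E b x t ≡ true) h e₂)) ∷ []) ∷ [] ∷ []) (y∉ ∷ x∉ ∷ []) ,
      good-extend gd (y∉ ∷ x∉ ∷ []) (≤-trans (m≤n+m 2 L) Lθ)
      where
      three-walk : ∀ b b' → b' ≡ not (not (not b)) → E b a y ≡ true → E b x y ≡ true → E b x a' ≡ true → Walk b a (y ∷ x ∷ []) b' a'
      three-walk true b' refl e₁ e₂ e₃ = e₁ ⟶ (e₂ ⟶ arc e₃)
      three-walk false b' refl e₁ e₂ e₃ = e₁ ⟶ (e₂ ⟶ arc e₃)
    hub-walk (suc k) b a b' a' U wa wa' par un gd room
      with step b a wa (avoid U) (avoid≤f U (≤-trans (m≤m+n _ _) room))
    ... | y , wy , e , y∉ with hub-walk k (not b) y b' a' (y ∷ U) wy wa' par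
            (unique-extend un ([] ∷ []) (y∉ ∷ [])) (good-extend gd (y∉ ∷ []) (≤-trans (≤-trans (n≤1+n 1) (m≤n+m 2 L)) Lθ)) (≤-trans (≤-reflexive (sym (+-suc _ k))) room)
    ...   | ps , w , l , un' , gd' = y ∷ ps , e ⟶ w , cong suc l , Unique-resp-↭ {xs = ps ++ y ∷ U} {ys = y ∷ ps ++ U} (↭ₚ.shift y ps U) un' , good-resp {U = ps ++ y ∷ U} {U' = y ∷ ps ++ U} (↭ₚ.shift y ps U) gd'

    module FreshTile {U : List V} {Vis : List (Fin q)} {R e : ℕ} (st : St U Vis R e) where

      live : Fin q → Bool
      live i = does (suc (hit i U) ≤? θ)

      lower : q * θ ≤ θ * ∣ live ∣ + length U
      lower = begin
        q * θ ≡⟨ cong (_* θ) (sym (length-Vs {q})) ⟩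
        length (Vs {q}) * θ ≤⟨ ∑-≥-const (Vs {q}) θ (λ i _ → each i) ⟩
        ∑ (λ i → θ * (if live i then 1 else 0) + hit i U) (Vs {q}) ≡⟨ ∑-+ (λ i → θ * (if live i then 1 else 0)) (λ i → hit i U) (Vs {q}) ⟩
        ∑ (λ i → θ * (if live i then 1 else 0)) (Vs {q}) + ∑ (λ i → hit i U) (Vs {q}) ≤⟨ +-mono-≤ (≤-reflexive (∑-* θ (λ i → if live i then 1 else 0) (Vs {q}))) (hits U) ⟩
        θ * ∣ live ∣ + length U ∎
        where
        open ≤-Reasoning
        each : ∀ i → θ ≤ θ * (if live i then 1 else 0) + hit i U
        each i with live i in eq
        ... | true = ≤-trans (≤-reflexive (sym (*-identityʳ θ))) (m≤m+n _ _)
        ... | false = ≤-trans (≮⇒≥ (dec-false (suc (hit i U) ≤? θ) eq)) (m≤n+m _ _)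

      arith : ∀ x v u → x ≤ v → q * θ ≤ θ * x + u → J * v ≤ k → u ≤ cap → J * (θ * q) ≤ θ * k + J * cap
      arith x v u h₁ h₂ h₃ h₄ = begin
        J * (θ * q) ≤⟨ *-monoʳ-≤ J (≤-trans (≤-reflexive (*-comm θ q)) h₂) ⟩
        J * (θ * x + u) ≤⟨ *-monoʳ-≤ J (+-mono-≤ (*-monoʳ-≤ θ h₁) h₄) ⟩
        J * (θ * v + cap) ≡⟨ eq J θ v cap ⟩
        θ * (J * v) + J * cap ≤⟨ +-monoˡ-≤ (J * cap) (*-monoʳ-≤ θ h₃) ⟩
        θ * k + J * cap ∎
        where
        open ≤-Reasoning
        eq : ∀ J t v c → J * (t * v + c) ≡ t * (J * v) + J * c
        eq = solve-∀

      -- At most `k / J` tiles have been visited, as each contributed `J` edges, and at most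
      -- `cap / θ` are frozen; `tiles-suffice` says that `q` is larger than the sum.
      enough : length Vis < ∣ live ∣
      enough = ≰⇒> λ h → <⇒≱ tiles-suffice (arith (∣ live ∣) (length Vis) (length U) h lower (≤-trans (m≤m+n _ R) (tiles st)) (≤-trans (m≤m+n _ _) (used≤ st)))

      result : ∃ λ i → i ∉ Vis × hit i U < θ
      result = let i , e' , i∉ = pick live Vis enough in i , i∉ , dec-true (suc (hit i U) ≤? θ) e'

    free-vertex : ∀ b i U → hit i U < θ → ∃ λ x → x ∈ part (tile i) b × x ∉ U
    free-vertex b i U h with cnt-∈ (λ v → not (v ∈ᵇ U)) (part (tile i) b) (+-cancelʳ-< θ 0 _ (<-≤-trans (<-≤-trans (m<m+n θ θ>0) (≤-trans (+-monoʳ-≤ θ (m≤m+n θ 0)) (≤-trans (m≤n+m (2 * θ) κ) κs))) (≤-trans (free b i U) (+-monoʳ-≤ _ (<⇒≤ h)))))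
    ... | x , m , e = x , m , ∉ᵇ⁻ e

    record Step (U : List V) (Vis : List (Fin q)) (R e : ℕ) (b : Bool) (z : V) (g : ℕ) : Set where
      field
        i : Fin q
        x y : V
        ps : List V
        g' : ℕ
        to-tile : Walk b z ps true x
        x∈ : x ∈ part (tile i) true
        y∈ : y ∈ part (tile i) false
        g≡ : g ≡ suc (length ps) + (J + g')
        g'-large : L + 4 ≤ g'
        state : St (ps ++ x ∷ y ∷ U) (i ∷ Vis) (g' + R) (suc e)

    module TileStep {U : List V} {Vis : List (Fin q)} {R e : ℕ} (b : Bool) (z : V) (g : ℕ) (st : St U Vis (g + R) (suc e))
      (zz : Z b z ≡ true) (big : c₁ < g) (i : Fin q) (i∉ : i ∉ Vis) (live : hit i U < θ)
      (x : V) (mx : x ∈ part (tile i) true) (x∉ : x ∉ U) (y : V) (my : y ∈ part (tile i) false) (y∉ : y ∉ U)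
      (ps : List V) (w : Walk b z ps true x) (l : length ps ≤ L) (un : Unique ps) (av : All (_∉ x ∷ y ∷ avoid U) ps) where

      a g' : ℕ
      a = suc (length ps) + J
      g' = g ∸ a

      a≤ : a + (L + 4) ≤ g
      a≤ = ≤-trans (≤-trans (+-monoˡ-≤ (L + 4) (+-monoˡ-≤ J (s≤s l))) (≤-reflexive (eq L J))) big
        where
        eq : ∀ L J → suc L + J + (L + 4) ≡ suc (2 * L + J + 4)
        eq = solve-∀

      g≡ : g ≡ suc (length ps) + (J + g')
      g≡ = trans (sym (m+[n∸m]≡n (≤-trans (m≤m+n a _) a≤))) (+-assoc (suc (length ps)) J g')

      g'-large : L + 4 ≤ g'
      g'-large = ≤-trans (≤-reflexive (sym (m+n∸m≡n a (L + 4)))) (∸-monoˡ-≤ a a≤)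

      new : List V
      new = ps ++ x ∷ y ∷ []

      x≢y : x ≢ y
      x≢y refl = Unique-disjoint (part (tile i) true) (tile-unique i) mx my

      new-unique : Unique new
      new-unique = Uniqueₚ.++⁺ un ((x≢y ∷ []) ∷ [] ∷ []) λ { (m₁ , here refl) → All.lookup av m₁ (here refl) ; (m₁ , there (here refl)) → All.lookup av m₁ (there (here refl)) }

      new-avoid : All (_∉ avoid U) new
      new-avoid = Allₚ.++⁺ (All.map (λ h m → h (there (there m))) av)
        (live-∉avoid i live (∈-++⁺ˡ mx) x∉ ∷ live-∉avoid i live (∈-++⁺ʳ (part (tile i) true) my) y∉ ∷ [])

      new-length : length new ≤ L + 2
      new-length = ≤-trans (≤-reflexive (length-++ ps)) (+-monoˡ-≤ 2 l)

      perm : new ++ U ↭ ps ++ x ∷ y ∷ U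
      perm = ↭-reflexive (++-assoc ps (x ∷ y ∷ []) U)

      tiles-left : J * suc (length Vis) + (g' + R) ≤ k
      tiles-left = begin
        J * suc (length Vis) + (g' + R) ≡⟨ eq J (length Vis) g' R ⟩
        J * length Vis + (J + g' + R) ≤⟨ +-monoʳ-≤ (J * length Vis) (+-monoˡ-≤ R (m≤n+m (J + g') (suc (length ps)))) ⟩
        J * length Vis + (suc (length ps) + (J + g') + R) ≡⟨ cong (λ t → J * length Vis + (t + R)) (sym g≡) ⟩
        J * length Vis + (g + R) ≤⟨ tiles st ⟩
        k ∎
        where
        open ≤-Reasoning
        eq : ∀ J v g' R → J * suc v + (g' + R) ≡ J * v + (J + g' + R)
        eq = solve-∀

      -- The at most `L + 2` new vertices are paid for by the `J` edges of the traversal, which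
      -- leave the total of remaining lengths.
      room-left : J * length (ps ++ x ∷ y ∷ U) + (L + 2) * (g' + R) + J * (c₁ * suc e) ≤ J * cap
      room-left = begin
        J * length (ps ++ x ∷ y ∷ U) + (L + 2) * (g' + R) + J * (c₁ * suc e) ≤⟨ +-monoˡ-≤ (J * (c₁ * suc e)) (+-monoˡ-≤ ((L + 2) * (g' + R)) (*-monoʳ-≤ J shorter)) ⟩
        J * (L + 2 + length U) + (L + 2) * (g' + R) + J * (c₁ * suc e) ≡⟨ cong (_+ J * (c₁ * suc e)) (eq J (L + 2) (length U) g' R) ⟩
        J * length U + (L + 2) * (J + g' + R) + J * (c₁ * suc e)
          ≤⟨ +-monoˡ-≤ (J * (c₁ * suc e)) (+-monoʳ-≤ (J * length U) (*-monoʳ-≤ (L + 2) (+-monoˡ-≤ R (≤-trans (m≤n+m (J + g') (suc (length ps))) (≤-reflexive (sym g≡)))))) ⟩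
        J * length U + (L + 2) * (g + R) + J * (c₁ * suc e) ≤⟨ room st ⟩
        J * cap ∎
        where
        open ≤-Reasoning
        shorter : length (ps ++ x ∷ y ∷ U) ≤ L + 2 + length U
        shorter = ≤-trans (≤-reflexive (trans (sym (↭ₚ.↭-length perm)) (length-++ new))) (+-monoˡ-≤ (length U) new-length)
        eq : ∀ J l u g' R → J * (l + u) + l * (g' + R) ≡ J * u + l * (J + g' + R)
        eq = solve-∀

      result : Step U Vis R e b z g
      result = record
        { i = i ; x = x ; y = y ; ps = ps ; g' = g' ; to-tile = w ; x∈ = mx ; y∈ = my ; g≡ = g≡ ; g'-large = g'-large
        ; state = record
          { unique-used = Unique-resp-↭ {xs = new ++ U} {ys = ps ++ x ∷ y ∷ U} perm (unique-extend (unique-used st) new-unique new-avoid)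
          ; good = good-resp {U = new ++ U} {U' = ps ++ x ∷ y ∷ U} perm (good-extend (good st) new-avoid (≤-trans new-length Lθ))
          ; unique-vis = Allₚ.¬Any⇒All¬ Vis i∉ ∷ unique-vis st
          ; tiles = tiles-left
          ; room = room-left
          } }

    tile-step : ∀ {U Vis R e} b z g → St U Vis (g + R) (suc e) → Z b z ≡ true → c₁ < g → Step U Vis R e b z g
    tile-step {U} b z g st zz big =
      let i , i∉ , live = FreshTile.result st
          x , mx , x∉ = free-vertex true i U live
          y , my , y∉ = free-vertex false i U live
          ps , w , l , un , av = conn true x b z (inside (tile i) true x mx) zz (x ∷ y ∷ avoid U) (≤-trans (≤-reflexive (+-comm 2 _)) (avoid≤ U (≤-trans (m≤m+n _ _) (used≤ st))))
      in TileStep.result b z g st zz big i i∉ live x mx x∉ y my y∉ ps w l un av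

    module HubFinish {U : List V} {Vis : List (Fin q)} {R e : ℕ} (g : ℕ) (b : Bool) (z : V) (b' : Bool) (a' : V) (gl : L + 4 ≤ g) (gs : g ≤ c₁)
      (wa : W b' a' ≡ true) (par : b' ≡ flips g b) (st : St U Vis (g + R) (suc e)) (w : V) (ww : W true w ≡ true) (w∉ : w ∉ avoid U)
      (ps : List V) (wk : Walk b z ps true w) (l : length ps ≤ L) (un : Unique ps) (av : All (_∉ w ∷ avoid U) ps) where

      a k' : ℕ
      a = suc (length ps) + 3
      k' = g ∸ a

      g≡ : g ≡ suc (length ps) + (3 + k')
      g≡ = trans (sym (m+[n∸m]≡n (≤-trans (≤-trans (s≤s (+-monoˡ-≤ 3 l)) (≤-reflexive (sym (+-suc L 3)))) gl))) (+-assoc (suc (length ps)) 3 k')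

      par' : b' ≡ flips (3 + k') true
      par' = trans par (trans (cong (λ t → flips t b) g≡) (trans (flips-+ (suc (length ps)) (3 + k') b) (cong (flips (3 + k')) (sym (walk-parity wk)))))

      new U₁ : List V
      new = ps ++ w ∷ []
      U₁ = ps ++ w ∷ U

      new-avoid : All (_∉ avoid U) new
      new-avoid = Allₚ.++⁺ (All.map (λ h m → h (there m)) av) (w∉ ∷ [])

      perm₁ : new ++ U ↭ U₁
      perm₁ = ↭-reflexive (++-assoc ps (w ∷ []) U)

      unique₁ : Unique U₁
      unique₁ = Unique-resp-↭ {xs = new ++ U} {ys = U₁} perm₁ (unique-extend (unique-used st) (Uniqueₚ.++⁺ un ([] ∷ []) λ { (m₁ , here refl) → All.lookup av m₁ (here refl) }) new-avoid)

      good₁ : Good U₁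
      good₁ = good-resp {U = new ++ U} {U' = U₁} perm₁ (good-extend (good st) new-avoid (≤-trans (≤-reflexive (length-++ ps)) (≤-trans (+-mono-≤ l (n≤1+n 1)) Lθ)))

      room₁ : length U₁ + k' ≤ cap
      room₁ = begin
        length U₁ + k' ≡⟨ cong (_+ k') (length-++ ps) ⟩
        length ps + suc (length U) + k' ≡⟨ eq (length ps) (length U) k' ⟩
        length U + (suc (length ps) + k') ≤⟨ +-monoʳ-≤ (length U) (≤-trans (+-monoʳ-≤ (suc (length ps)) (m≤n+m k' 3)) (≤-trans (≤-reflexive (sym g≡)) (≤-trans gs (m≤m*n c₁ (suc e))))) ⟩
        length U + c₁ * suc e ≤⟨ used≤ st ⟩
        cap ∎
        where
        open ≤-Reasoning
        eq : ∀ p u k → p + suc u + k ≡ u + (suc p + k)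
        eq = solve-∀

      walked : ∃ λ qs → Walk true w qs b' a' × length qs ≡ k' + 2 × Unique (qs ++ U₁) × Good (qs ++ U₁)
      walked = hub-walk k' true w b' a' U₁ ww wa par' unique₁ good₁ room₁

      qs : List V
      qs = proj₁ walked

      length≡ : suc (length ps) + suc (length qs) ≡ g
      length≡ = trans (cong (suc (length ps) +_) (cong suc (trans (proj₁ (proj₂ (proj₂ walked))) (+-comm k' 2)))) (sym g≡)

      perm : qs ++ U₁ ↭ (ps ++ w ∷ qs) ++ U
      perm = ↭-trans {j = ps ++ (qs ++ w ∷ U)} (↭ₚ.shifts qs ps) (↭-trans {j = ps ++ (w ∷ qs ++ U)} (↭ₚ.++⁺ˡ ps (↭ₚ.shift w qs U)) (↭-reflexive (sym (++-assoc ps (w ∷ qs) U))))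

      short : length (ps ++ w ∷ qs) ≤ c₁
      short = ≤-trans (n≤1+n _) (≤-trans (≤-reflexive (trans (cong suc (length-++ ps)) length≡)) gs)

      result : ∃ λ ps → ∃ λ is → Skeleton b z ps is g b' a' × St (ps ++ U) (is ++ Vis) R e
      result = ps ++ w ∷ qs , [] , subst (λ t → Skeleton b z (ps ++ w ∷ qs) [] t b' a') length≡ (wk then walk (proj₁ (proj₂ walked))) ,
        St-finish g (ps ++ w ∷ qs) st (Unique-resp-↭ {xs = qs ++ U₁} {ys = (ps ++ w ∷ qs) ++ U} perm (proj₁ (proj₂ (proj₂ (proj₂ walked)))))
          (good-resp {U = qs ++ U₁} {U' = (ps ++ w ∷ qs) ++ U} perm (proj₂ (proj₂ (proj₂ (proj₂ walked))))) short

    hub-finish : ∀ {U Vis R e} g b z b' a' → L + 4 ≤ g → g ≤ c₁ → Z b z ≡ true → W b' a' ≡ true → b' ≡ flips g b →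
      St U Vis (g + R) (suc e) → ∃ λ ps → ∃ λ is → Skeleton b z ps is g b' a' × St (ps ++ U) (is ++ Vis) R e
    hub-finish {U} g b z b' a' gl gs zz wa par st =
      let u≤ = ≤-trans (m≤m+n _ _) (used≤ st)
          w , ww , _ , w∉ = step false (proj₁ (inhabited false)) (proj₂ (inhabited false)) (avoid U) (avoid≤f U u≤)
          ps , wk , l , un , av = conn true w b z (W⊑Z true w ww) zz (w ∷ avoid U) (≤-trans (≤-trans (n≤1+n _) (≤-reflexive (+-comm 2 _))) (avoid≤ U u≤))
      in HubFinish.result g b z b' a' gl gs wa par st w ww w∉ ps wk l un av

    -- Tiles are visited while more than `c₁` edges remain; the rest has length between `L + 4` and
    -- `c₁` and is adjusted in the hub. A traversal has odd length and leads from side true to side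
    -- false, so the parity condition survives each visit.
    route : ∀ fuel {U Vis R e} g b z b' a' → g ≤ fuel → L + 4 ≤ g → Z b z ≡ true → W b' a' ≡ true → b' ≡ flips g b →
      St U Vis (g + R) (suc e) → ∃ λ ps → ∃ λ is → Skeleton b z ps is g b' a' × St (ps ++ U) (is ++ Vis) R e
    continue : ∀ fuel {U Vis R e} g b z b' a' → g ≤ suc fuel → W b' a' ≡ true → b' ≡ flips g b → Step U Vis R e b z g →
      ∃ λ ps → ∃ λ is → Skeleton b z ps is g b' a' × St (ps ++ U) (is ++ Vis) R e

    route zero g b z b' a' gf gl zz wa par st = ⊥-elim (<⇒≱ (≤-trans (m≤n+m 1 (L + 3)) (≤-trans (≤-reflexive (+-assoc L 3 1)) gl)) gf)
    route (suc fuel) g b z b' a' gf gl zz wa par st with g ≤? c₁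
    ... | yes p = hub-finish g b z b' a' gl p zz wa par st
    ... | no ¬p = continue fuel g b z b' a' gf wa par (tile-step b z g st zz (≰⇒> ¬p))

    continue fuel {U} {Vis} {R} {e} g b z b' a' gf wa par record { i = i ; x = x ; y = y ; ps = ps ; g' = g' ; to-tile = w ; x∈ = mx ; y∈ = my ; g≡ = refl ; g'-large = g'l ; state = st' } =
      finish (route fuel g' false y b' a' g'≤ g'l (inside (tile i) false y my) wa par' st')
      where
      g'≤ : g' ≤ fuel
      g'≤ = ≤-pred (≤-trans (s≤s (≤-trans (m≤n+m g' J) (m≤n+m _ (length ps)))) gf)
      par' : b' ≡ flips g' false
      par' = trans par (trans (flips-+ (suc (length ps)) (J + g') b) (trans (cong (flips (J + g')) (sym (walk-parity w)))
        (trans (flips-+ J g' true) (cong (flips g') (trans (cong (λ t → flips t true) J≡) (flips-odd κ true))))))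
      U₁ : List V
      U₁ = ps ++ x ∷ y ∷ U
      finish : (∃ λ qs → ∃ λ is → Skeleton false y qs is g' b' a' × St (qs ++ U₁) (is ++ i ∷ Vis) R e) →
        ∃ λ rs → ∃ λ is → Skeleton b z rs is (suc (length ps) + (J + g')) b' a' × St (rs ++ U) (is ++ Vis) R e
      finish (qs , is , sk , st″) = ps ++ x ∷ y ∷ qs , i ∷ is , w then jump mx my sk , St-resp {U = qs ++ U₁} {U' = (ps ++ x ∷ y ∷ qs) ++ U} perm (↭ₚ.shift i is Vis) st″
        where
        perm : qs ++ U₁ ↭ (ps ++ x ∷ y ∷ qs) ++ U
        perm = ↭-trans {j = ps ++ (qs ++ x ∷ y ∷ U)} (↭ₚ.shifts qs ps)
          (↭-trans {j = ps ++ (x ∷ y ∷ qs ++ U)} (↭ₚ.++⁺ˡ ps (↭-trans {j = x ∷ qs ++ y ∷ U} (↭ₚ.shift x qs (y ∷ U)) (prep x (↭ₚ.shift y qs U))))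
            (↭-reflexive (sym (++-assoc ps (x ∷ y ∷ qs) U))))

    -- Both ends lie in the hub, so lengths from 3 to `c₁` are realised there directly, and only
    -- larger ones need tiles.
    edge-route : ∀ {U Vis R e} g b a b' a' → 3 ≤ g → W b a ≡ true → W b' a' ≡ true → b' ≡ flips g b →
      St U Vis (g + R) (suc e) → ∃ λ ps → ∃ λ is → Skeleton b a ps is g b' a' × St (ps ++ U) (is ++ Vis) R e
    edge-route 1 b a b' a' (s≤s ()) wa wa' par st
    edge-route 2 b a b' a' (s≤s (s≤s ())) wa wa' par st
    edge-route {U} {Vis} {R} {e} (suc (suc (suc k'))) b a b' a' _ wa wa' par st with 3 + k' ≤? c₁
    ... | no ¬p = route (3 + k') (3 + k') b a b' a' ≤-refl (≤-trans (+-monoˡ-≤ 4 (≤-trans (m≤m+n L (L + 0)) (m≤m+n (2 * L) J))) (<⇒≤ (≰⇒> ¬p))) (W⊑Z b a wa) wa' par st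
    ... | yes p with hub-walk k' b a b' a' U wa wa' par (unique-used st) (good st) (≤-trans (+-monoʳ-≤ (length U) (≤-trans (≤-trans (m≤n+m k' 3) p) (m≤m*n c₁ (suc e)))) (used≤ st))
    ...   | ps , w , l , un , gd = ps , [] , subst (λ t → Skeleton b a ps [] (suc t) b' a') (trans l (+-comm k' 2)) (walk w) ,
      St-finish (3 + k') ps st un gd (≤-trans (≤-reflexive (trans l (+-comm k' 2))) (≤-trans (n≤1+n (2 + k')) p))

    -- Placing the branch vertices and routing all edges.

    record Target {h : ℕ} (g : EdgeFun h) (side : Fin h → Bool) : Set where
      field
        positive : Positive g
        forest : ShortEdgesForest g
        total : sumEdges g ≡ k
        parity : ∀ i j → i <ᶠ j → side j ≡ flips (g i j) (side i)
        rooms : (L + 2) * k + J * ((2 * L + J + 4) * (h + h * h)) ≤ J * cap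

    module Embed {h : ℕ} {g : EdgeFun h} {side : Fin h → Bool} (T : Target g side) where

      open Target T
      open St
      open Forest g forest

      Edge : Set
      Edge = Fin h × Fin h

      record Route (φ : Fin h → V) (e : Edge) : Set where
        constructor mkRoute
        field
          ps : List V
          is : List (Fin q)
          skel : Skeleton (side (proj₁ e)) (φ (proj₁ e)) ps is (g (proj₁ e) (proj₂ e)) (side (proj₂ e)) (φ (proj₂ e))
      open Route

      flatP : ∀ {φ es} → All (Route φ) es → List V
      flatP [] = []
      flatP (r ∷ rs) = ps r ++ flatP rs

      flatI : ∀ {φ es} → All (Route φ) es → List (Fin q)
      flatI [] = []
      flatI (r ∷ rs) = is r ++ flatI rs

      flatP-++ : ∀ {φ es es'} (rs : All (Route φ) es) (rs' : All (Route φ) es') → flatP (Allₚ.++⁺ rs rs') ≡ flatP rs ++ flatP rs'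
      flatP-++ [] rs' = refl
      flatP-++ (r ∷ rs) rs' = trans (cong (ps r ++_) (flatP-++ rs rs')) (sym (++-assoc (ps r) (flatP rs) (flatP rs')))

      flatI-++ : ∀ {φ es es'} (rs : All (Route φ) es) (rs' : All (Route φ) es') → flatI (Allₚ.++⁺ rs rs') ≡ flatI rs ++ flatI rs'
      flatI-++ [] rs' = refl
      flatI-++ (r ∷ rs) rs' = trans (cong (is r ++_) (flatI-++ rs rs')) (sym (++-assoc (is r) (flatI rs) (flatI rs')))

      Within : List (Fin h) → Edge → Set
      Within xs e = proj₁ e ∈ xs × proj₂ e ∈ xs

      -- Placing another branch vertex changes `φ` only there; routes between vertices placed
      -- earlier carry over.
      transport : ∀ {φ φ' : Fin h → V} {xs es} → (∀ i → i ∈ xs → φ i ≡ φ' i) → All (Within xs) es → All (Route φ) es → All (Route φ') es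
      transport eq [] [] = []
      transport eq ((m , m') ∷ ms) (r ∷ rs) = mkRoute (ps r) (is r) (subst₂ (λ x y → Skeleton _ x (ps r) (is r) _ _ y) (eq _ m) (eq _ m') (skel r)) ∷ transport eq ms rs

      transport-P : ∀ {φ φ' : Fin h → V} {xs es} (eq : ∀ i → i ∈ xs → φ i ≡ φ' i) (ms : All (Within xs) es) (rs : All (Route φ) es) → flatP (transport eq ms rs) ≡ flatP rs
      transport-P eq [] [] = refl
      transport-P eq (_ ∷ ms) (r ∷ rs) = cong (ps r ++_) (transport-P eq ms rs)

      transport-I : ∀ {φ φ' : Fin h → V} {xs es} (eq : ∀ i → i ∈ xs → φ i ≡ φ' i) (ms : All (Within xs) es) (rs : All (Route φ) es) → flatI (transport eq ms rs) ≡ flatI rs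
      transport-I eq [] [] = refl
      transport-I eq (_ ∷ ms) (r ∷ rs) = cong (is r ++_) (transport-I eq ms rs)

      record Placed (xs : List (Fin h)) (R e : ℕ) : Set where
        field
          φ : Fin h → V
          es : List Edge
          routes : All (Route φ) es
          inW : ∀ i → i ∈ xs → W (side i) (φ i) ≡ true
          within : All (Within xs) es
          covered : ∀ i j → i ∈ xs → j ∈ xs → i <ᶠ j → g i j < 3 → (i , j) ∈ es
          state : St (flatP routes ++ map φ xs) (flatI routes) R e

      St-add : ∀ {U Vis R e ps} → St U Vis R (suc e) → Unique ps → All (_∉ avoid U) ps → length ps ≤ 2 → St (ps ++ U) Vis R e
      St-add {U} {ps = ps} st un av l = St-finish 0 ps st (unique-extend (unique-used st) un av) (good-extend (good st) av (≤-trans l (≤-trans (m≤n+m 2 L) Lθ)))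
        (≤-trans l (≤-trans (≤-trans (n≤1+n 2) (n≤1+n 3)) (m≤n+m 4 (2 * L + J))))

      avoid-fits : ∀ {U Vis R e} → St U Vis R e → length (avoid U) ≤ f
      avoid-fits {U} st = avoid≤f U (≤-trans (m≤m+n _ _) (used≤ st))

      avoid-fits' : ∀ {U Vis R e} → St U Vis R e → suc (length (avoid U)) ≤ f
      avoid-fits' {U} st = ≤-trans (n≤1+n _) (≤-trans (≤-reflexive (+-comm 2 _)) (avoid≤ U (≤-trans (m≤m+n _ _) (used≤ st))))

      fresh-vertex : ∀ {U Vis R e} b → St U Vis R (suc e) → ∃ λ a → W b a ≡ true × St (a ∷ U) Vis R e
      fresh-vertex {U} b st with step (not b) (proj₁ (inhabited (not b))) (proj₂ (inhabited (not b))) (avoid U) (avoid-fits st)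
      ... | a , wa , _ , a∉ = a , subst (λ x → W x a ≡ true) (Boolₚ.not-involutive b) wa , St-add st ([] ∷ []) (a∉ ∷ []) (n≤1+n 1)

      -- The path is grown from the placed vertex `y` and its far end `a` becomes the new branch
      -- vertex. The walk is returned in both directions, because an edge is directed by the order
      -- of its indices and either end may be the placed one.
      short-path : ∀ {U Vis R e} ℓ b y → 1 ≤ ℓ → ℓ < 3 → W b y ≡ true → St U Vis R (suc e) →
        ∃ λ a → ∃ λ ps → W (flips ℓ b) a ≡ true × Walk b y ps (flips ℓ b) a × Walk (flips ℓ b) a ps b y × suc (length ps) ≡ ℓ × St (a ∷ ps ++ U) Vis R e
      short-path {U} 1 b y _ _ wy st with step b y wy (avoid U) (avoid-fits st)
      ... | a , wa , e , a∉ = a , [] , wa , arc e , subst (λ t → Walk (not b) a [] t y) (Boolₚ.not-involutive b) (arc (E-sym b y a e)) , refl , St-add st ([] ∷ []) (a∉ ∷ []) (n≤1+n 1)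
      short-path {U} 2 b y _ _ wy st with step b y wy (avoid U) (avoid-fits st)
      ... | m , wm , e , m∉ with step (not b) m wm (m ∷ avoid U) (avoid-fits' st)
      ...   | a , wa , e' , a∉ = a , m ∷ [] , wa , e ⟶ arc e' , back b e e' , refl ,
        St-add st (((λ h → a∉ (here h)) ∷ []) ∷ [] ∷ []) ((λ h → a∉ (there h)) ∷ m∉ ∷ []) ≤-refl
        where
        back : ∀ b → E b y m ≡ true → E (not b) m a ≡ true → Walk (not (not b)) a (m ∷ []) b y
        back true e e' = e' ⟶ arc e
        back false e e' = e' ⟶ arc e
      short-path (suc (suc (suc _))) b y _ (s≤s (s≤s (s≤s ()))) wy st

      flips-inv : ∀ ℓ b → flips ℓ (flips ℓ b) ≡ b
      flips-inv ℓ b = trans (sym (flips-+ ℓ ℓ b)) (lem ℓ b)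
        where
        lem : ∀ ℓ b → flips (ℓ + ℓ) b ≡ b
        lem zero b = refl
        lem (suc ℓ) b = trans (cong (λ t → flips t (not b)) (+-suc ℓ ℓ)) (trans (lem ℓ (not (not b))) (Boolₚ.not-involutive b))

      update : (Fin h → V) → Fin h → V → Fin h → V
      update φ x a i with i Finₚ.≟ x
      ... | yes _ = a
      ... | no _ = φ i

      update-new : ∀ φ x a → update φ x a x ≡ a
      update-new φ x a with x Finₚ.≟ x
      ... | yes _ = refl
      ... | no ne = ⊥-elim (ne refl)

      update-old : ∀ φ x a i → i ≢ x → φ i ≡ update φ x a i
      update-old φ x a i ne with i Finₚ.≟ x
      ... | yes e = ⊥-elim (ne e)
      ... | no _ = refl

      map-cong-∈ : ∀ {φ φ' : Fin h → V} xs → (∀ i → i ∈ xs → φ i ≡ φ' i) → map φ xs ≡ map φ' xs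
      map-cong-∈ [] eq = refl
      map-cong-∈ (x ∷ xs) eq = cong₂ _∷_ (eq x (here refl)) (map-cong-∈ xs λ i m → eq i (there m))

      module _ {x : Fin h} {xs : List (Fin h)} (x∉ : x ∉ xs) (lf : Leaf xs x) {R e : ℕ} (P : Placed xs R (suc e)) where
        private
          module P = Placed P
          U : List V
          U = flatP P.routes ++ map P.φ xs

          module New (a : V) (wa : W (side x) a ≡ true) where
            φ' : Fin h → V
            φ' = update P.φ x a
            old : ∀ i → i ∈ xs → P.φ i ≡ φ' i
            old i m = update-old P.φ x a i λ { refl → x∉ m }
            routes' : All (Route φ') P.es
            routes' = transport old P.within P.routes
            inW' : ∀ i → i ∈ x ∷ xs → W (side i) (φ' i) ≡ true
            inW' i (here refl) = subst (λ t → W (side x) t ≡ true) (sym (update-new P.φ x a)) wa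
            inW' i (there m) = subst (λ t → W (side i) t ≡ true) (old i m) (P.inW i m)
            within' : All (Within (x ∷ xs)) P.es
            within' = All.map (λ { (m , m') → there m , there m' }) P.within
            perm : ∀ ps → a ∷ ps ++ U ↭ (ps ++ flatP routes') ++ map φ' (x ∷ xs)
            perm ps = ↭-trans {j = a ∷ (ps ++ flatP routes') ++ map φ' xs} (prep a (↭-reflexive (trans (cong₂ (λ s t → ps ++ s ++ t) (sym (transport-P old P.within P.routes)) (map-cong-∈ xs old)) (sym (++-assoc ps (flatP routes') (map φ' xs))))))
              (↭-trans {j = (ps ++ flatP routes') ++ a ∷ map φ' xs} (↭-sym (↭ₚ.shift a (ps ++ flatP routes') (map φ' xs))) (↭-reflexive (cong (λ t → (ps ++ flatP routes') ++ t ∷ map φ' xs) (sym (update-new P.φ x a)))))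
            state' : ∀ ps → St (a ∷ ps ++ U) (flatI P.routes) R e → St ((ps ++ flatP routes') ++ map φ' (x ∷ xs)) (flatI routes') R e
            state' ps st = St-resp {U = a ∷ ps ++ U} {U' = (ps ++ flatP routes') ++ map φ' (x ∷ xs)} (perm ps) (↭-reflexive (sym (transport-I old P.within P.routes))) st

        place-isolated : (∀ y → y ∈ xs → ¬ Short g x y) → Placed (x ∷ xs) R e
        place-isolated iso = let a , wa , st = fresh-vertex (side x) P.state in put a wa st
          where
          put : ∀ a → W (side x) a ≡ true → St (a ∷ U) (flatI P.routes) R e → Placed (x ∷ xs) R e
          put a wa st = record
            { φ = φ' ; es = P.es ; routes = routes' ; inW = inW' ; within = within' ; covered = cov ; state = state' [] st }
            where
            open New a wa
            cov : ∀ i j → i ∈ x ∷ xs → j ∈ x ∷ xs → i <ᶠ j → g i j < 3 → (i , j) ∈ P.es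
            cov i j (here refl) (here refl) p _ = ⊥-elim (Finₚ.<-irrefl refl p)
            cov i j (here refl) (there m) p l = ⊥-elim (iso j m (inj₁ (p , l)))
            cov i j (there m) (here refl) p l = ⊥-elim (iso i m (inj₂ (p , l)))
            cov i j (there m) (there m') p l = P.covered i j m m' p l

        -- As `x` is a leaf over `xs`, the edge to `y` is the only short edge to be routed now. The
        -- parity of its length puts the new end on the side prescribed for `x`.
        place-pendant : ∀ y → y ∈ xs → Short g x y → Placed (x ∷ xs) R e
        place-pendant y my (inj₂ (p , l)) with short-path (g y x) (side y) (P.φ y) (positive y x p) l (P.inW y my) P.state
        ... | a , ps , wa , w , _ , len , st = record
          { φ = φ' ; es = (y , x) ∷ P.es
          ; routes = mkRoute ps [] (subst₂ (λ u v → Skeleton (side y) u ps [] (g y x) (side x) v) (old y my) (sym (update-new P.φ x a))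
              (subst₂ (λ ℓ b → Skeleton (side y) (P.φ y) ps [] ℓ b a) len (sym (parity y x p)) (walk w))) ∷ routes'
          ; inW = inW' ; within = (there my , here refl) ∷ within' ; covered = cov
          ; state = state' ps st }
          where
          open New a (subst (λ b → W b a ≡ true) (sym (parity y x p)) wa)
          cov : ∀ i j → i ∈ x ∷ xs → j ∈ x ∷ xs → i <ᶠ j → g i j < 3 → (i , j) ∈ (y , x) ∷ P.es
          cov i j (here refl) (here refl) q _ = ⊥-elim (Finₚ.<-irrefl refl q)
          cov i j (here refl) (there m) q l' with lf j y m my (inj₁ (q , l')) (inj₂ (p , l))
          ... | refl = ⊥-elim (Finₚ.<-asym p q)
          cov i j (there m) (here refl) q l' with lf i y m my (inj₂ (q , l')) (inj₂ (p , l))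
          ... | refl = here refl
          cov i j (there m) (there m') q l' = there (P.covered i j m m' q l')
        place-pendant y my (inj₁ (p , l)) with short-path (g x y) (side y) (P.φ y) (positive x y p) l (P.inW y my) P.state
        ... | a , ps , wa , _ , w , len , st = record
          { φ = φ' ; es = (x , y) ∷ P.es
          ; routes = mkRoute ps [] (subst₂ (λ u v → Skeleton (side x) u ps [] (g x y) (side y) v) (sym (update-new P.φ x a)) (old y my)
              (subst₂ (λ ℓ b → Skeleton b a ps [] ℓ (side y) (P.φ y)) len par (walk w))) ∷ routes'
          ; inW = inW' ; within = (here refl , there my) ∷ within' ; covered = cov
          ; state = state' ps st }
          where
          par : flips (g x y) (side y) ≡ side x
          par = trans (cong (flips (g x y)) (parity x y p)) (flips-inv (g x y) (side x))
          open New a (subst (λ b → W b a ≡ true) par wa)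
          cov : ∀ i j → i ∈ x ∷ xs → j ∈ x ∷ xs → i <ᶠ j → g i j < 3 → (i , j) ∈ (x , y) ∷ P.es
          cov i j (here refl) (here refl) q _ = ⊥-elim (Finₚ.<-irrefl refl q)
          cov i j (there m) (here refl) q l' with lf i y m my (inj₂ (q , l')) (inj₁ (p , l))
          ... | refl = ⊥-elim (Finₚ.<-asym p q)
          cov i j (here refl) (there m) q l' with lf j y m my (inj₁ (q , l')) (inj₁ (p , l))
          ... | refl = here refl
          cov i j (there m) (there m') q l' = there (P.covered i j m m' q l')

      place : ∀ {xs} → Peel xs → ∀ R e → St [] [] R (length xs + e) → Placed xs R e
      place [] R e st = record
        -- An arbitrary value, overwritten when a branch vertex is placed.
        { φ = λ _ → proj₁ (inhabited true) ; es = [] ; routes = [] ; inW = λ i () ; within = [] ; covered = λ i j () ; state = st }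
      place (peel {x} {xs} lf x∉ pl) R e st with place pl R (suc e) (subst (St [] [] R) (sym (+-suc (length xs) e)) st) | any? (short? x) xs
      ... | P | no ¬p = place-isolated x∉ lf P λ y m sh → ¬p (lose m sh)
      ... | P | yes p = let y , m , sh = find p in place-pendant x∉ lf P y m sh

      route-all : ∀ φ → (∀ i → W (side i) (φ i) ≡ true) → ∀ es → All (λ e → proj₁ e <ᶠ proj₂ e × 3 ≤ g (proj₁ e) (proj₂ e)) es → ∀ {U Vis} →
        St U Vis (∑ (λ e → g (proj₁ e) (proj₂ e)) es) (length es) → ∃ λ (rs : All (Route φ) es) → St (flatP rs ++ U) (flatI rs ++ Vis) 0 0
      route-all φ inW [] [] st = [] , st
      route-all φ inW ((i , j) ∷ es) ((p , l) ∷ as) {U} {Vis} st with edge-route (g i j) (side i) (φ i) (side j) (φ j) l (inW i) (inW j) (parity i j p) st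
      ... | ps , is , sk , st' with route-all φ inW es as st'
      ...   | rs , st″ = mkRoute ps is sk ∷ rs , St-resp {U = flatP rs ++ (ps ++ U)} {U' = (ps ++ flatP rs) ++ U} {Vis = flatI rs ++ (is ++ Vis)} {Vis' = (is ++ flatI rs) ++ Vis}
          (↭-trans {j = ps ++ (flatP rs ++ U)} (↭ₚ.shifts (flatP rs) ps) (↭-reflexive (sym (++-assoc ps (flatP rs) U))))
          (↭-trans {j = is ++ (flatI rs ++ Vis)} (↭ₚ.shifts (flatI rs) is) (↭-reflexive (sym (++-assoc is (flatI rs) Vis)))) st″

      long-edge : Fin h → Fin h → List Edge
      long-edge i j = if does (i Finₚ.<? j) ∧ does (3 ≤? g i j) then (i , j) ∷ [] else []

      long-edges : List Edge
      long-edges = concatMap (λ i → concatMap (long-edge i) (allFin h)) (allFin h)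

      ∑-long : ∀ (w : Edge → ℕ) → ∑ w long-edges ≡ ∑ (λ i → ∑ (λ j → ∑ w (long-edge i j)) (allFin h)) (allFin h)
      ∑-long w = trans (∑-concatMap w (λ i → concatMap (long-edge i) (allFin h)) (allFin h)) (∑-cong (allFin h) λ i → ∑-concatMap w (long-edge i) (allFin h))

      sum-long : ∑ (λ e → g (proj₁ e) (proj₂ e)) long-edges ≤ k
      sum-long = ≤-trans (≤-reflexive (∑-long _)) (≤-trans (∑-mono (allFin h) λ i _ → ∑-mono (allFin h) λ j _ → each i j)
        (≤-reflexive (trans (sym (trans (∑-sum _ (allFin h)) (∑-cong (allFin h) λ i → ∑-sum _ (allFin h)))) total)))
        where
        each : ∀ i j → ∑ (λ e → g (proj₁ e) (proj₂ e)) (long-edge i j) ≤ (if does (i Finₚ.<? j) then g i j else 0)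
        each i j with does (i Finₚ.<? j) | does (3 ≤? g i j)
        ... | true | true = ≤-reflexive (+-identityʳ _)
        ... | true | false = z≤n
        ... | false | _ = z≤n

      length≡∑ : ∀ {A : Set} (xs : List A) → length xs ≡ ∑ (λ _ → 1) xs
      length≡∑ xs = sym (trans (∑-const 1 xs) (*-identityʳ (length xs)))

      count-long : length long-edges ≤ h * h
      count-long = ≤-trans (≤-reflexive (trans (length≡∑ long-edges) (∑-long _))) (≤-trans (∑-≤-const (allFin h) (h * 1) (λ i _ →
          ≤-trans (∑-≤-const (allFin h) 1 λ j _ → each i j) (≤-reflexive (cong (_* 1) (length-Vs {h})))))
        (≤-reflexive (trans (cong (_* (h * 1)) (length-Vs {h})) (cong (h *_) (*-identityʳ h)))))
        where
        each : ∀ i j → ∑ (λ _ → 1) (long-edge i j) ≤ 1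
        each i j with does (i Finₚ.<? j) ∧ does (3 ≤? g i j)
        ... | true = ≤-refl
        ... | false = z≤n

      long-edges-ok : All (λ e → proj₁ e <ᶠ proj₂ e × 3 ≤ g (proj₁ e) (proj₂ e)) long-edges
      long-edges-ok = All.tabulate λ {e} m →
        let i , _ , m₁ = ∈-concatMap⁻ (λ i → concatMap (long-edge i) (allFin h)) (allFin h) m
            j , _ , m₂ = ∈-concatMap⁻ (long-edge i) (allFin h) m₁
        in ok i j e m₂
        where
        ok : ∀ i j e → e ∈ long-edge i j → proj₁ e <ᶠ proj₂ e × 3 ≤ g (proj₁ e) (proj₂ e)
        ok i j e m with does (i Finₚ.<? j) in eq₁ | does (3 ≤? g i j) in eq₂
        ok i j e (here refl) | true | true = dec-true (i Finₚ.<? j) eq₁ , dec-true (3 ≤? g i j) eq₂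

      ∈-long : ∀ i j → i <ᶠ j → 3 ≤ g i j → (i , j) ∈ long-edges
      ∈-long i j p l = ∈-concatMap (λ i → concatMap (long-edge i) (allFin h)) (∈-allFin i) (∈-concatMap (long-edge i) (∈-allFin j)
        (subst (λ t → (i , j) ∈ (if t then (i , j) ∷ [] else [])) (sym (∧-intro (true-dec (i Finₚ.<? j) p) (true-dec (3 ≤? g i j) l))) (here refl)))

      -- Short and long routes are expanded together against one final list `U`. All interiors and
      -- branch vertices then form a single list without repetitions, from which every disjointness
      -- property is read off.
      module Finish (φ : Fin h → V) (ord : List (Fin h)) (all : ∀ i → i ∈ ord) (es : List Edge) (rs : All (Route φ) es) (R e : ℕ)
        (st : St (flatP rs ++ map φ ord) (flatI rs) R e) (mem : ∀ i j → i <ᶠ j → (i , j) ∈ es) where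

        U : List V
        U = flatP rs ++ map φ ord
        open Fill U (good st)

        Q : ∀ {e} → Route φ e → List V
        Q r = proj₁ (expand (skel r))

        Q-↭ : ∀ {e} (r : Route φ e) → Q r ↭ ps r ++ concatMap fill (is r)
        Q-↭ r = proj₂ (proj₂ (proj₂ (expand (skel r))))

        flatQ : ∀ {es} → All (Route φ) es → List V
        flatQ [] = []
        flatQ (r ∷ rs) = Q r ++ flatQ rs

        flatQ-↭ : ∀ {es} (rs : All (Route φ) es) → flatQ rs ↭ flatP rs ++ concatMap fill (flatI rs)
        flatQ-↭ [] = ↭-refl
        flatQ-↭ (r ∷ rs) = ↭-trans {j = (ps r ++ concatMap fill (is r)) ++ (flatP rs ++ concatMap fill (flatI rs))} (↭ₚ.++⁺ (Q-↭ r) (flatQ-↭ rs))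
          (↭-trans {j = (ps r ++ flatP rs) ++ (concatMap fill (is r) ++ concatMap fill (flatI rs))} (interchange (ps r) (concatMap fill (is r)) (flatP rs) (concatMap fill (flatI rs)))
          (↭-reflexive (cong ((ps r ++ flatP rs) ++_) (sym (concatMap-++ fill (is r) (flatI rs))))))

        F : List V
        F = concatMap fill (flatI rs)

        all-perm : U ++ F ↭ flatQ rs ++ map φ ord
        all-perm = ↭-sym (↭-trans {j = (flatP rs ++ F) ++ map φ ord} (↭ₚ.++⁺ʳ (map φ ord) (flatQ-↭ rs))
          (↭-trans {j = flatP rs ++ (F ++ map φ ord)} (↭-reflexive (++-assoc (flatP rs) F (map φ ord)))
            (↭-trans {j = flatP rs ++ (map φ ord ++ F)} (↭ₚ.++⁺ˡ (flatP rs) (↭ₚ.++-comm F (map φ ord))) (↭-reflexive (sym (++-assoc (flatP rs) (map φ ord) F))))))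

        all-unique : Unique (flatQ rs ++ map φ ord)
        all-unique = Unique-resp-↭ {xs = U ++ F} {ys = flatQ rs ++ map φ ord} all-perm
          (Uniqueₚ.++⁺ (unique-used st) (fills-unique (flatI rs) (unique-vis st)) λ { (m₁ , m₂) → fills-∉ (flatI rs) m₂ m₁ })

        ∈-flatQ : ∀ {es e v} (rs : All (Route φ) es) (m : e ∈ es) → v ∈ Q (All.lookup rs m) → v ∈ flatQ rs
        ∈-flatQ (r ∷ rs) (here refl) h = ∈-++⁺ˡ h
        ∈-flatQ (r ∷ rs) (there m) h = ∈-++⁺ʳ (Q r) (∈-flatQ rs m h)

        Q-unique : ∀ {es e} (rs : All (Route φ) es) (m : e ∈ es) → Unique (flatQ rs) → Unique (Q (All.lookup rs m))
        Q-unique (r ∷ rs) (here refl) u = Unique-++ˡ (Q r) u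
        Q-unique (r ∷ rs) (there m) u = Q-unique rs m (Unique-++ʳ (Q r) u)

        Q-disjoint : ∀ {es e e' v} (rs : All (Route φ) es) (m : e ∈ es) (m' : e' ∈ es) → Unique (flatQ rs) →
          v ∈ Q (All.lookup rs m) → v ∈ Q (All.lookup rs m') → e ≡ e'
        Q-disjoint (r ∷ rs) (here refl) (here refl) u h h' = refl
        Q-disjoint (r ∷ rs) (here refl) (there m') u h h' = ⊥-elim (Unique-disjoint (Q r) u h (∈-flatQ rs m' h'))
        Q-disjoint (r ∷ rs) (there m) (here refl) u h h' = ⊥-elim (Unique-disjoint (Q r) u h' (∈-flatQ rs m h))
        Q-disjoint (r ∷ rs) (there m) (there m') u h h' = Q-disjoint rs m m' (Unique-++ʳ (Q r) u) h h'

        map-injective : ∀ xs → Unique (map φ xs) → ∀ {i j} → i ∈ xs → j ∈ xs → φ i ≡ φ j → i ≡ j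
        map-injective (x ∷ xs) u (here refl) (here refl) e = refl
        map-injective (x ∷ xs) (a ∷ u) (here refl) (there m) e = ⊥-elim (All.lookup a (∈-map⁺ φ m) e)
        map-injective (x ∷ xs) (a ∷ u) (there m) (here refl) e = ⊥-elim (All.lookup a (∈-map⁺ φ m) (sym e))
        map-injective (x ∷ xs) (a ∷ u) (there m) (there m') e = map-injective xs u m m' e

        uQ : Unique (flatQ rs)
        uQ = Unique-++ˡ (flatQ rs) all-unique

        result : PathSystem D g side
        result = record
          { φ = φ
          ; interior = λ i j p → Q (All.lookup rs (mem i j p))
          ; walks = λ i j p → proj₁ (proj₂ (expand (skel (All.lookup rs (mem i j p)))))
          ; lengths = λ i j p → proj₁ (proj₂ (proj₂ (expand (skel (All.lookup rs (mem i j p))))))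
          ; φ-injective = λ i j → map-injective ord (Unique-++ʳ (flatQ rs) all-unique) (all i) (all j)
          ; interior-unique = λ i j p → Q-unique rs (mem i j p) uQ
          ; interior-branch = λ i j p l m → Unique-disjoint (flatQ rs) all-unique (∈-flatQ rs (mem i j p) m) (∈-map⁺ φ (all l))
          ; interior-disjoint = λ i j p i' j' p' v m m' → Q-disjoint rs (mem i j p) (mem i' j' p') uQ m m'
          }

      -- The steps outside the tiles are the `h` placements and one final adjustment for each of at
      -- most `h * h` long edges; the bound `rooms` pays for them.
      start : ∀ (ord : List (Fin h)) → length ord ≡ h → St [] [] (∑ (λ e → g (proj₁ e) (proj₂ e)) long-edges) (length ord + length long-edges)
      start ord lord = record
        { unique-used = []
        ; good = λ i → z≤n
        ; unique-vis = []
        ; tiles = ≤-trans (≤-reflexive (cong (_+ ∑ (λ e → g (proj₁ e) (proj₂ e)) long-edges) (*-zeroʳ J))) sum-long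
        ; room = begin
            J * 0 + (L + 2) * ∑ (λ e → g (proj₁ e) (proj₂ e)) long-edges + J * (c₁ * (length ord + length long-edges))
              ≡⟨ cong (λ t → t + (L + 2) * ∑ (λ e → g (proj₁ e) (proj₂ e)) long-edges + J * (c₁ * (length ord + length long-edges))) (*-zeroʳ J) ⟩
            (L + 2) * ∑ (λ e → g (proj₁ e) (proj₂ e)) long-edges + J * (c₁ * (length ord + length long-edges))
              ≤⟨ +-mono-≤ (*-monoʳ-≤ (L + 2) sum-long) (*-monoʳ-≤ J (*-monoʳ-≤ c₁ (+-mono-≤ (≤-reflexive lord) count-long))) ⟩
            (L + 2) * k + J * (c₁ * (h + h * h)) ≤⟨ rooms ⟩
            J * cap ∎
        }
        where open ≤-Reasoning

      module Conclude (ord : List (Fin h)) (all : ∀ i → i ∈ ord) (P : Placed ord (∑ (λ e → g (proj₁ e) (proj₂ e)) long-edges) (length long-edges)) where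

        open Placed P

        routed : ∃ λ (rs : All (Route φ) long-edges) → St (flatP rs ++ (flatP routes ++ map φ ord)) (flatI rs ++ flatI routes) 0 0
        routed = route-all φ (λ i → inW i (all i)) long-edges long-edges-ok state

        rs : All (Route φ) long-edges
        rs = proj₁ routed

        mem : ∀ i j → i <ᶠ j → (i , j) ∈ long-edges ++ es
        mem i j p with 3 ≤? g i j
        ... | yes l = ∈-++⁺ˡ (∈-long i j p l)
        ... | no ¬l = ∈-++⁺ʳ long-edges (covered i j (all i) (all j) p (≰⇒> ¬l))

        perm : flatP rs ++ (flatP routes ++ map φ ord) ↭ flatP (Allₚ.++⁺ rs routes) ++ map φ ord
        perm = ↭-reflexive (trans (sym (++-assoc (flatP rs) (flatP routes) (map φ ord))) (cong (_++ map φ ord) (sym (flatP-++ rs routes))))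

        result : PathSystem D g side
        result = Finish.result φ ord all (long-edges ++ es) (Allₚ.++⁺ rs routes) 0 0
          (St-resp {U = flatP rs ++ (flatP routes ++ map φ ord)} {U' = flatP (Allₚ.++⁺ rs routes) ++ map φ ord} perm (↭-reflexive (sym (flatI-++ rs routes))) (proj₂ routed)) mem

      path-system : PathSystem D g side
      path-system = let ord , pl , all , lord = order in
        Conclude.result ord all (place pl (∑ (λ e → g (proj₁ e) (proj₂ e)) long-edges) (length long-edges) (start ord lord))

  -- From a path system to an embedding of `H`.

  flips-not : ∀ k b → flips k (not b) ≡ not (flips k b)
  flips-not zero b = refl
  flips-not (suc k) b = flips-not k (not b)

  nth : ∀ {A : Set} → A → List A → A → ℕ → A
  nth a ps z zero = a
  nth a [] z (suc k) = z
  nth a (x ∷ ps) z (suc k) = nth x ps z k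

  nth-last : ∀ {A : Set} (a : A) ps z → nth a ps z (suc (length ps)) ≡ z
  nth-last a [] z = refl
  nth-last a (x ∷ ps) z = nth-last x ps z

  nth-∈ : ∀ {A : Set} (a : A) ps z k → k < length ps → nth a ps z (suc k) ∈ ps
  nth-∈ a (x ∷ ps) z zero h = here refl
  nth-∈ a (x ∷ ps) z (suc k) (s≤s h) = there (nth-∈ x ps z k h)

  nth-injective : ∀ {A : Set} (a : A) ps z → Unique ps → ∀ k k' → k < length ps → k' < length ps → nth a ps z (suc k) ≡ nth a ps z (suc k') → k ≡ k'
  nth-injective a (x ∷ ps) z (d ∷ u) zero zero h h' e = refl
  nth-injective a (x ∷ ps) z (d ∷ u) zero (suc k') h (s≤s h') e = ⊥-elim (All.lookup d (nth-∈ x ps z k' h') e)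
  nth-injective a (x ∷ ps) z (d ∷ u) (suc k) zero (s≤s h) h' e = ⊥-elim (All.lookup d (nth-∈ x ps z k h) (sym e))
  nth-injective a (x ∷ ps) z (d ∷ u) (suc k) (suc k') (s≤s h) (s≤s h') e = cong suc (nth-injective x ps z u k k' h h' e)

  nth-walk : ∀ {n} (D : Digraph n) {b u ps c v} → Graph.Walk D b u ps c v → ∀ k → k ≤ length ps →
    Graph.E D (flips k b) (nth u ps v k) (nth u ps v (suc k)) ≡ true
  nth-walk D (Graph.arc e) zero h = e
  nth-walk D (e Graph.⟶ w) zero h = e
  nth-walk D (e Graph.⟶ w) (suc k) (s≤s h) = nth-walk D w k h

  module Assembly {h : ℕ} {g : EdgeFun h} {m : ℕ} {H : Digraph m} (anti : IsAntisubdivision h g H) where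
    open IsAntisubdivision anti

    -- The side of a vertex of `H`. In an antidirected graph a vertex with an outgoing arc has no
    -- incoming one, so this value alternates along every path and prescribes the sides of the
    -- branch vertices.
    source : Fin m → Bool
    source u = does (Finₚ.any? λ v → H u v Boolₚ.≟ true)

    source-tail : ∀ u v → H u v ≡ true → source u ≡ true
    source-tail u v e = true-dec (Finₚ.any? λ v → H u v Boolₚ.≟ true) (v , e)

    source-head : ∀ u v → H u v ≡ true → source v ≡ false
    source-head u v e with bool-dec (source v)
    ... | inj₂ f = f
    ... | inj₁ t = let w , e' = dec-true (Finₚ.any? λ w → H v w Boolₚ.≟ true) t in true≢false e' (antidirected u v w e)

    source-adjacent : ∀ u v → H u v ∨ H v u ≡ true → source v ≡ not (source u)
    source-adjacent u v e with bool-dec (H u v)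
    ... | inj₁ t = trans (source-head u v t) (cong not (sym (source-tail u v t)))
    ... | inj₂ f = let t = subst (λ x → x ∨ H v u ≡ true) f e in trans (source-tail v u t) (cong not (sym (source-head v u t)))

    side : Fin h → Bool
    side i = source (branch i)

    source-path : ∀ i j p t → source (path i j p t) ≡ flips (toℕ t) (side i)
    source-path i j p = <-weakInduction (λ t → source (path i j p t) ≡ flips (toℕ t) (side i)) (cong source (path-start i j p))
      λ t ih → trans (source-adjacent _ _ (path-adjacent i j p t))
        (trans (cong not (trans ih (cong (λ k → flips k (side i)) (Finₚ.toℕ-inject₁ t)))) (sym (flips-not (toℕ t) (side i))))

    side-parity : ∀ i j → i <ᶠ j → side j ≡ flips (g i j) (side i)
    side-parity i j p = trans (cong source (sym (path-end i j p))) (trans (source-path i j p (fromℕ (g i j))) (cong (λ k → flips k (side i)) (Finₚ.toℕ-fromℕ (g i j))))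

    module _ {n : ℕ} {D : Digraph n} (S : PathSystem D g side) where
      open PathSystem S

      at : ∀ i j → i <ᶠ j → ℕ → Fin n
      at i j p = nth (φ i) (interior i j p) (φ j)

      at-end : ∀ i j p → at i j p (g i j) ≡ φ j
      at-end i j p = trans (cong (at i j p) (sym (lengths i j p))) (nth-last (φ i) (interior i j p) (φ j))

      Internal : Fin m → Set
      Internal u = ∃ λ i → ∃ λ j → Σ (i <ᶠ j) λ p → ∃ λ t → path i j p t ≡ u × ¬ t ≡ fzero × ¬ t ≡ fromℕ (g i j)

      classify : ∀ u → (∃ λ l → branch l ≡ u) ⊎ Internal u
      classify u with covers u
      ... | inj₁ b = inj₁ b
      ... | inj₂ (i , j , p , t , e) with t Finₚ.≟ fzero | t Finₚ.≟ fromℕ (g i j)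
      ...   | yes refl | _ = inj₁ (i , trans (sym (path-start i j p)) e)
      ...   | no _ | yes refl = inj₁ (j , trans (sym (path-end i j p)) e)
      ...   | no t≢0 | no t≢g = inj₂ (i , j , p , t , e , t≢0 , t≢g)

      position : ∀ i j p (t : Fin (suc (g i j))) → ¬ t ≡ fzero → ¬ t ≡ fromℕ (g i j) → ∃ λ k → toℕ t ≡ suc k × k < length (interior i j p)
      position i j p fzero t≢0 _ = ⊥-elim (t≢0 refl)
      position i j p (fsuc t) _ t≢g = toℕ t , refl , ≤-pred (≤-trans
        (≤∧≢⇒< (Finₚ.toℕ<n t) λ e → t≢g (Finₚ.toℕ-injective (trans e (sym (Finₚ.toℕ-fromℕ (g i j)))))) (≤-reflexive (sym (lengths i j p))))

      value : ∀ u → (∃ λ l → branch l ≡ u) ⊎ Internal u → Fin n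
      value u (inj₁ (l , _)) = φ l
      value u (inj₂ (i , j , p , t , _)) = at i j p (toℕ t)

      embedding : Fin m → Fin n
      embedding u = value u (classify u)

      at-irrelevant : ∀ i j p p' k → at i j p k ≡ at i j p' k
      at-irrelevant i j p p' k = cong (λ q → at i j q k) (<-irrelevant p p')

      -- A branch vertex is the end of many paths, so the description picked by `classify` is
      -- arbitrary. The value agrees nevertheless with the position on any path through the vertex,
      -- which is what makes arcs of `H` arcs of `D`.
      value-path : ∀ i j p t c → value (path i j p t) c ≡ at i j p (toℕ t)
      value-path i j p t (inj₁ (l , e)) with t Finₚ.≟ fzero | t Finₚ.≟ fromℕ (g i j)
      ... | yes refl | _ = cong φ (branch-inj l i (trans e (path-start i j p)))
      ... | no _ | yes refl = trans (cong φ (branch-inj l j (trans e (path-end i j p)))) (trans (sym (at-end i j p)) (cong (at i j p) (sym (Finₚ.toℕ-fromℕ (g i j)))))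
      ... | no t≢0 | no t≢g = ⊥-elim (internal-not-branch i j p t t≢0 t≢g l (sym e))
      value-path i j p t (inj₂ (i' , j' , p' , t' , e , t'≢0 , t'≢g)) with internal-unique i' j' p' t' t'≢0 t'≢g i j p t e
      ... | refl , refl , k≡ = trans (at-irrelevant i j p' p (toℕ t')) (cong (at i j p) k≡)

      embedding-path : ∀ i j p t → embedding (path i j p t) ≡ at i j p (toℕ t)
      embedding-path i j p t = value-path i j p t (classify (path i j p t))

      internal-∈ : ∀ i j p t → ¬ t ≡ fzero → ¬ t ≡ fromℕ (g i j) → at i j p (toℕ t) ∈ interior i j p
      internal-∈ i j p t t≢0 t≢g with position i j p t t≢0 t≢g
      ... | k , e , l = subst (λ x → at i j p x ∈ interior i j p) (sym e) (nth-∈ (φ i) (interior i j p) (φ j) k l)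

      value-injective : ∀ u v c c' → value u c ≡ value v c' → u ≡ v
      value-injective u v (inj₁ (l , e)) (inj₁ (l' , e')) h = trans (sym e) (trans (cong branch (φ-injective l l' h)) e')
      value-injective u v (inj₁ (l , e)) (inj₂ (i , j , p , t , _ , t≢0 , t≢g)) h =
        ⊥-elim (interior-branch i j p l (subst (_∈ interior i j p) (sym h) (internal-∈ i j p t t≢0 t≢g)))
      value-injective u v (inj₂ (i , j , p , t , _ , t≢0 , t≢g)) (inj₁ (l , e)) h =
        ⊥-elim (interior-branch i j p l (subst (_∈ interior i j p) h (internal-∈ i j p t t≢0 t≢g)))
      value-injective u v (inj₂ (i , j , p , t , e , t≢0 , t≢g)) (inj₂ (i' , j' , p' , t' , e' , t'≢0 , t'≢g)) h
        with interior-disjoint i j p i' j' p' (at i j p (toℕ t)) (internal-∈ i j p t t≢0 t≢g) (subst (_∈ interior i' j' p') (sym h) (internal-∈ i' j' p' t' t'≢0 t'≢g))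
      ... | refl with <-irrelevant p p'
      ...   | refl with position i j p t t≢0 t≢g | position i j p t' t'≢0 t'≢g
      ...     | k , q , l | k' , q' , l' = trans (sym e) (trans (cong (path i j p) (Finₚ.toℕ-injective (trans q (trans (cong suc
                  (nth-injective (φ i) (interior i j p) (φ j) (interior-unique i j p) k k' l l' (trans (cong (at i j p) (sym q)) (trans h (cong (at i j p) q'))))) (sym q'))))) e')

      at-arc : ∀ i j p (t : Fin (g i j)) → Graph.E D (flips (toℕ t) (side i)) (at i j p (toℕ t)) (at i j p (suc (toℕ t))) ≡ true
      at-arc i j p t = nth-walk D (walks i j p) (toℕ t) (≤-pred (≤-trans (Finₚ.toℕ<n t) (≤-reflexive (sym (lengths i j p)))))

      side-at : ∀ i j p (t : Fin (g i j)) → flips (toℕ t) (side i) ≡ source (path i j p (inject₁ t))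
      side-at i j p t = trans (cong (λ k → flips k (side i)) (sym (Finₚ.toℕ-inject₁ t))) (sym (source-path i j p (inject₁ t)))

      embedding-inject : ∀ i j p (t : Fin (g i j)) → embedding (path i j p (inject₁ t)) ≡ at i j p (toℕ t)
      embedding-inject i j p t = trans (embedding-path i j p (inject₁ t)) (cong (at i j p) (Finₚ.toℕ-inject₁ t))

      embedding-arc : ∀ u v → H u v ≡ true → D (embedding u) (embedding v) ≡ true
      embedding-arc u v e with adjacent-on-path u v (cong (_∨ H v u) e)
      ... | i , j , p , t , inj₁ (refl , refl) = subst₂ (λ x y → D x y ≡ true) (sym (embedding-inject i j p t)) (sym (embedding-path i j p (fsuc t)))
        (subst (λ b → Graph.E D b (at i j p (toℕ t)) (at i j p (suc (toℕ t))) ≡ true) (trans (side-at i j p t) (source-tail u v e)) (at-arc i j p t))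
      ... | i , j , p , t , inj₂ (refl , refl) = subst₂ (λ x y → D x y ≡ true) (sym (embedding-path i j p (fsuc t))) (sym (embedding-inject i j p t))
        (subst (λ b → Graph.E D b (at i j p (toℕ t)) (at i j p (suc (toℕ t))) ≡ true) (trans (side-at i j p t) (source-head u v e)) (at-arc i j p t))

      contains : Contains D H
      contains = embedding , (λ u v → value-injective u v (classify u) (classify v)) , embedding-arc

  -- Numerical estimates and the combination of all ingredients.

  outdeg≤deg : ∀ {n} (D : Digraph n) v → outdeg D v ≤ Graph.deg D true v (λ _ → true)
  outdeg≤deg D v = ≤-trans (≤-reflexive (∑-sum (λ w → if D v w then 1 else 0) Vs)) (∣∣-mono {p = D v} λ w e → ∧-intro e refl)

  indeg≤deg : ∀ {n} (D : Digraph n) v → indeg D v ≤ Graph.deg D false v (λ _ → true)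
  indeg≤deg D v = ≤-trans (≤-reflexive (∑-sum (λ w → if D w v then 1 else 0) Vs)) (∣∣-mono {p = λ w → D w v} λ w e → ∧-intro e refl)

  module TileFamily {n : ℕ} (D : Digraph n) (Z : Bool → Fin n → Bool) {s : ℕ} where
    open Tiles D Z

    ∈-verts* : ∀ (Ts : List (Tile s)) i {v} → v ∈ verts (lookup Ts i) → v ∈ verts* Ts
    ∈-verts* (T ∷ Ts) fzero m = ∈-++⁺ˡ m
    ∈-verts* (T ∷ Ts) (fsuc i) m = ∈-++⁺ʳ (verts T) (∈-verts* Ts i m)

    lookup-disjoint : ∀ (Ts : List (Tile s)) → Unique (verts* Ts) → ∀ i j v → v ∈ verts (lookup Ts i) → v ∈ verts (lookup Ts j) → i ≡ j
    lookup-disjoint (T ∷ Ts) u fzero fzero v m m' = refl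
    lookup-disjoint (T ∷ Ts) u fzero (fsuc j) v m m' = ⊥-elim (Unique-disjoint (verts T) u m (∈-verts* Ts j m'))
    lookup-disjoint (T ∷ Ts) u (fsuc i) fzero v m m' = ⊥-elim (Unique-disjoint (verts T) u m' (∈-verts* Ts i m))
    lookup-disjoint (T ∷ Ts) u (fsuc i) (fsuc j) v m m' = cong fsuc (lookup-disjoint Ts (Unique-++ʳ (verts T) u) i j v m m')

    lookup-unique : ∀ (Ts : List (Tile s)) → Unique (verts* Ts) → ∀ i → Unique (verts (lookup Ts i))
    lookup-unique (T ∷ Ts) u fzero = Unique-++ˡ (verts T) u
    lookup-unique (T ∷ Ts) u (fsuc i) = lookup-unique Ts (Unique-++ʳ (verts T) u) i

  -- Half of the surplus is given up: from degree above `(1 + 1/N) * k / 2`, at most `8 * N`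
  -- separations with loss `2 * σ` each leave at least `(1 + 1/(2N)) * k / 2`.
  degree-loss : ∀ N k δ σ → suc N * k < 2 * N * δ → 64 * (N * (N * σ)) ≤ k → .{{NonZero N}} →
    (δ ∸ 8 * N * (σ + σ)) + 8 * N * (σ + σ) ≤ δ × (2 * N + 1) * k ≤ 4 * N * (δ ∸ 8 * N * (σ + σ))
  degree-loss N k δ σ h₁ h₂ = ≤-reflexive (m∸n+n≡m loss≤) , gain
    where
    open ≤-Reasoning
    x = 8 * N * (σ + σ)
    loss≤ : x ≤ δ
    loss≤ = *-cancelˡ-≤ (4 * N) {{m*n≢0 4 N}} (begin
      4 * N * (8 * N * (σ + σ)) ≡⟨ eq N σ ⟩
      64 * (N * (N * σ)) ≤⟨ h₂ ⟩
      k ≤⟨ m≤n*m k (suc N) ⟩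
      suc N * k ≤⟨ <⇒≤ h₁ ⟩
      2 * N * δ ≤⟨ *-monoˡ-≤ δ (*-monoˡ-≤ N (m≤m+n 2 2)) ⟩
      4 * N * δ ∎)
      where
      eq : ∀ N σ → 4 * N * (8 * N * (σ + σ)) ≡ 64 * (N * (N * σ))
      eq = solve-∀
    arith : ∀ N k y σ → suc N * k ≤ 2 * N * (y + 8 * N * (σ + σ)) → 64 * (N * (N * σ)) ≤ k → (2 * N + 1) * k ≤ 4 * N * y
    arith N k y σ h₁ h₂ = +-cancelʳ-≤ k _ _ (begin
      (2 * N + 1) * k + k ≡⟨ eq₁ N k ⟩
      2 * (suc N * k) ≤⟨ *-monoʳ-≤ 2 h₁ ⟩
      2 * (2 * N * (y + 8 * N * (σ + σ))) ≡⟨ eq₂ N y σ ⟩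
      4 * N * y + 64 * (N * (N * σ)) ≤⟨ +-monoʳ-≤ (4 * N * y) h₂ ⟩
      4 * N * y + k ∎)
      where
      eq₁ : ∀ N k → (2 * N + 1) * k + k ≡ 2 * (suc N * k)
      eq₁ = solve-∀
      eq₂ : ∀ N y σ → 2 * (2 * N * (y + 8 * N * (σ + σ))) ≡ 4 * N * y + 64 * (N * (N * σ))
      eq₂ = solve-∀
    gain : (2 * N + 1) * k ≤ 4 * N * (δ ∸ x)
    gain = arith N k (δ ∸ x) σ (≤-trans (<⇒≤ h₁) (≤-reflexive (cong (2 * N *_) (sym (m∸n+n≡m loss≤))))) h₂

  -- The relative surplus over `k` shrinks in stages. It is `1/(2N)` for `2 * d`, still `1/(4N)` for
  -- the vertices `2 * s * q` in tiles after the uncovered `3 * t`, and `7/(32N)` for the edges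
  -- `J * q` after the up to `4 * θ` vertices lost per tile. Frozen tiles cost less than `4/(32N)`
  -- of `k`, so more than `k` remains.
  tile-supply : ∀ N k d n t s θ κ J q cap → .{{NonZero N}} → 0 < θ → (2 * N + 1) * k ≤ 4 * N * d → d ≤ s * q + 3 * t → 24 * (N * t) ≤ k →
    q * (2 * s) ≤ n → n ≤ N * k → s ≡ 64 * (N * N * θ) → κ + 2 * θ ≡ s → J ≡ suc (2 * κ) → 1024 * (N * N * N * N * cap) < n →
    θ * k + J * cap < J * (θ * q)
  tile-supply N k d n t _ θ κ _ q cap θ>0 hd hcov ht hq hn refl hκ refl hcap = *-cancelˡ-< (32 * N) _ _ (begin-strict
      32 * N * (θ * k + J * cap) ≡⟨ eq₁ N θ k J cap ⟩
      32 * (N * (θ * k)) + 4 * (8 * (N * (J * cap))) <⟨ +-monoʳ-< (32 * (N * (θ * k))) (*-monoʳ-< 4 spare) ⟩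
      32 * (N * (θ * k)) + 4 * (θ * k) ≤⟨ +-monoʳ-≤ (32 * (N * (θ * k))) (*-monoˡ-≤ (θ * k) (m≤m+n 4 3)) ⟩
      32 * (N * (θ * k)) + 7 * (θ * k) ≡⟨ eq₂ N θ k ⟩
      θ * ((32 * N + 7) * k) ≤⟨ *-monoʳ-≤ θ supply ⟩
      θ * (32 * N * (J * q)) ≡⟨ eq₃ θ N J q ⟩
      32 * N * (J * (θ * q)) ∎)
    where
    open ≤-Reasoning
    s J : ℕ
    s = 64 * (N * N * θ)
    J = suc (2 * κ)
    eq₁ : ∀ N θ k J c → 32 * N * (θ * k + J * c) ≡ 32 * (N * (θ * k)) + 4 * (8 * (N * (J * c)))
    eq₁ = solve-∀
    eq₂ : ∀ N θ k → 32 * (N * (θ * k)) + 7 * (θ * k) ≡ θ * ((32 * N + 7) * k)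
    eq₂ = solve-∀
    eq₃ : ∀ θ N J q → θ * (32 * N * (J * q)) ≡ 32 * N * (J * (θ * q))
    eq₃ = solve-∀
    J+4θ : J + 4 * θ ≡ suc (2 * s)
    J+4θ = trans (eq κ θ) (cong (λ x → suc (2 * x)) hκ)
      where
      eq : ∀ κ θ → suc (2 * κ) + 4 * θ ≡ suc (2 * (κ + 2 * θ))
      eq = solve-∀
    J≤2s : J ≤ 2 * s
    J≤2s = +-cancelʳ-≤ 1 J (2 * s) (≤-trans (+-monoʳ-≤ J (≤-trans θ>0 (m≤n*m θ 4))) (≤-trans (≤-reflexive J+4θ) (≤-reflexive (+-comm 1 (2 * s)))))
    cover : (4 * N + 1) * k ≤ 8 * (N * (s * q))
    cover = +-cancelʳ-≤ k _ _ (begin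
      (4 * N + 1) * k + k ≡⟨ e₁ N k ⟩
      2 * ((2 * N + 1) * k) ≤⟨ *-monoʳ-≤ 2 (≤-trans hd (*-monoʳ-≤ (4 * N) hcov)) ⟩
      2 * (4 * N * (s * q + 3 * t)) ≡⟨ e₂ N (s * q) t ⟩
      8 * (N * (s * q)) + 24 * (N * t) ≤⟨ +-monoʳ-≤ (8 * (N * (s * q))) ht ⟩
      8 * (N * (s * q)) + k ∎)
      where
      e₁ : ∀ N k → (4 * N + 1) * k + k ≡ 2 * ((2 * N + 1) * k)
      e₁ = solve-∀
      e₂ : ∀ N y t → 2 * (4 * N * (y + 3 * t)) ≡ 8 * (N * y) + 24 * (N * t)
      e₂ = solve-∀
    waste : 128 * (N * (θ * q)) ≤ k
    waste = *-cancelˡ-≤ N (≤-trans (≤-reflexive (e N θ q)) (≤-trans hq hn))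
      where
      e : ∀ N θ q → N * (128 * (N * (θ * q))) ≡ q * (2 * (64 * (N * N * θ)))
      e = solve-∀
    supply : (32 * N + 7) * k ≤ 32 * N * (J * q)
    supply = +-cancelʳ-≤ k _ _ (begin
      (32 * N + 7) * k + k ≡⟨ e₁ N k ⟩
      8 * ((4 * N + 1) * k) ≤⟨ *-monoʳ-≤ 8 cover ⟩
      8 * (8 * (N * (s * q))) ≡⟨ e₂ N s q ⟩
      32 * N * (2 * s * q) ≤⟨ *-monoʳ-≤ (32 * N) (*-monoˡ-≤ q (≤-trans (n≤1+n (2 * s)) (≤-reflexive (sym J+4θ)))) ⟩
      32 * N * ((J + 4 * θ) * q) ≡⟨ e₃ N J θ q ⟩
      32 * N * (J * q) + 128 * (N * (θ * q)) ≤⟨ +-monoʳ-≤ (32 * N * (J * q)) waste ⟩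
      32 * N * (J * q) + k ∎)
      where
      e₁ : ∀ N k → (32 * N + 7) * k + k ≡ 8 * ((4 * N + 1) * k)
      e₁ = solve-∀
      e₂ : ∀ N s q → 8 * (8 * (N * (s * q))) ≡ 32 * N * (2 * s * q)
      e₂ = solve-∀
      e₃ : ∀ N J θ q → 32 * N * ((J + 4 * θ) * q) ≡ 32 * N * (J * q) + 128 * (N * (θ * q))
      e₃ = solve-∀
    spare : 8 * (N * (J * cap)) < θ * k
    spare = *-cancelˡ-< N _ _ (begin-strict
      N * (8 * (N * (J * cap))) ≤⟨ *-monoʳ-≤ N (*-monoʳ-≤ 8 (*-monoʳ-≤ N (*-monoˡ-≤ cap J≤2s))) ⟩
      N * (8 * (N * (2 * s * cap))) ≡⟨ e₁ N θ cap ⟩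
      θ * (1024 * (N * N * N * N * cap)) <⟨ *-monoʳ-< θ {{>-nonZero θ>0}} (<-≤-trans hcap hn) ⟩
      θ * (N * k) ≡⟨ e₂ θ N k ⟩
      N * (θ * k) ∎)
      where
      e₁ : ∀ N θ c → N * (8 * (N * (2 * (64 * (N * N * θ)) * c))) ≡ θ * (1024 * (N * N * N * N * c))
      e₁ = solve-∀
      e₂ : ∀ θ N k → θ * (N * k) ≡ N * (θ * k)
      e₂ = solve-∀

  -- Half of `J * cap` pays for connections to tiles, using `s ≤ J`, and the other half for the
  -- steps outside the tiles.
  rooms-bound : ∀ L k n J s cap h → k ≤ 2 * n → 4 * ((L + 2) * n) ≤ s * cap → s ≤ J → 4 * ((2 * L + J + 4) * (h * h)) ≤ cap →
    (L + 2) * k + J * ((2 * L + J + 4) * (h + h * h)) ≤ J * cap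
  rooms-bound L k n J s cap h hk h₁ sJ h₂ = *-cancelˡ-≤ 2 (begin
    2 * ((L + 2) * k + J * (c * (h + h * h))) ≡⟨ eq₁ L k J c (h + h * h) ⟩
    2 * ((L + 2) * k) + J * (2 * (c * (h + h * h))) ≤⟨ +-mono-≤ (*-monoʳ-≤ 2 (*-monoʳ-≤ (L + 2) hk)) (*-monoʳ-≤ J (*-monoʳ-≤ 2 (*-monoʳ-≤ c (+-monoˡ-≤ (h * h) (square h))))) ⟩
    2 * ((L + 2) * (2 * n)) + J * (2 * (c * (h * h + h * h))) ≡⟨ eq₂ L n J c (h * h) ⟩
    4 * ((L + 2) * n) + J * (4 * (c * (h * h))) ≤⟨ +-mono-≤ (≤-trans h₁ (*-monoˡ-≤ cap sJ)) (*-monoʳ-≤ J h₂) ⟩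
    J * cap + J * cap ≡⟨ eq₃ (J * cap) ⟩
    2 * (J * cap) ∎)
    where
    open ≤-Reasoning
    c = 2 * L + J + 4
    square : ∀ h → h ≤ h * h
    square zero = z≤n
    square (suc h) = m≤m*n (suc h) (suc h)
    eq₁ : ∀ L k J c x → 2 * ((L + 2) * k + J * (c * x)) ≡ 2 * ((L + 2) * k) + J * (2 * (c * x))
    eq₁ = solve-∀
    eq₂ : ∀ L n J c x → 2 * ((L + 2) * (2 * n)) + J * (2 * (c * (x + x))) ≡ 4 * ((L + 2) * n) + J * (4 * (c * x))
    eq₂ = solve-∀
    eq₃ : ∀ x → x + x ≡ 2 * x
    eq₃ = solve-∀

  record Constants (N n σ L f cap θ κ J s t m M Smax g r : ℕ) : Set where
    field
      connect-steps : n + n < L * σ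
      connect-avoid : f + L ≤ σ
      hub-size : (let ρ = 12 * N ; j = 4 * (ρ * ρ) ; K = 2 * N * j in ρ * f * (2 * N * (2 * K) ^ suc K) ≤ n)
      σ-small : 64 * (N * (N * (N * σ))) ≤ n
      n>0 : 0 < n
      θ>0 : 0 < θ
      L≤θ : L + 2 ≤ θ
      s≡ : s ≡ 64 * (N * N * θ)
      κ≡ : κ + 2 * θ ≡ s
      J≡ : J ≡ suc (2 * κ)
      s≤J : s ≤ J
      avoid-fits : θ * (cap + 2) + 2 * s * cap ≤ θ * f
      cap-small : 1024 * (N * N * N * N * cap) < n
      cap-large : 4 * ((L + 2) * n) ≤ s * cap
      t-small : 24 * (N * (N * t)) ≤ n
      tiles-m : 2 * n ≤ suc m * t
      tiles-s : 2 * (Smax * 2 ^ M) ≤ t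
      tiles-t : M ≤ t
      tiles-M : 4 * Smax * 2 ^ (2 * Smax) ≤ M
      tiles-g : (g + Smax) * (2 + m) ≤ t
      tiles-S : Smax ≡ suc m ^ r * s
      tiles-r : n ≤ r * g

  module Core {N n σ L f cap θ κ J s t m M Smax g r : ℕ} .{{_ : NonZero N}} (constants : Constants N n σ L f cap θ κ J s t m M Smax g r)
    (D : Digraph n) (oriented : Oriented D) (k δ : ℕ) (n≤Nk : n ≤ N * k) (large : suc N * k < 2 * N * δ)
    (out : ∀ v → δ ≤ outdeg D v) (inn : ∀ v → δ ≤ indeg D v)
    {h : ℕ} (h-small : 4 * ((2 * L + J + 4) * (h * h)) ≤ cap) (gap : EdgeFun h) {mH : ℕ} (H : Digraph mH) (anti : IsLongAntisubdivision h k gap H) where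
    open Constants constants
    open Graph D
    open IsLongAntisubdivision anti renaming (anti to subdivision)

    σ≤k : 64 * (N * (N * σ)) ≤ k
    σ≤k = *-cancelˡ-≤ N (≤-trans (≤-reflexive (eq N σ)) (≤-trans σ-small n≤Nk))
      where
      eq : ∀ N σ → N * (64 * (N * (N * σ))) ≡ 64 * (N * (N * (N * σ)))
      eq = solve-∀

    t≤k : 24 * (N * t) ≤ k
    t≤k = *-cancelˡ-≤ N (≤-trans (≤-reflexive (eq N t)) (≤-trans t-small n≤Nk))
      where
      eq : ∀ N t → N * (24 * (N * t)) ≡ 24 * (N * (N * t))
      eq = solve-∀

    d : ℕ
    d = δ ∸ 8 * N * (σ + σ)

    d-large : (2 * N + 1) * k ≤ 4 * N * d
    d-large = proj₂ (degree-loss N k δ σ large σ≤k)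

    2n≤4Nd : 2 * n ≤ 4 * N * d
    2n≤4Nd = ≤-trans (*-monoʳ-≤ 2 n≤Nk) (≤-trans (≤-reflexive (sym (*-assoc 2 N k))) (≤-trans (*-monoˡ-≤ k (m≤m+n (2 * N) 1)) d-large))

    n≤2Nd : n ≤ 2 * N * d
    n≤2Nd = *-cancelˡ-≤ 2 (≤-trans 2n≤4Nd (≤-reflexive (eq N d)))
      where
      eq : ∀ N d → 4 * N * d ≡ 2 * (2 * N * d)
      eq = solve-∀

    whole : Pair
    whole _ _ = true

    whole-degree : MinDeg (d + 8 * N * (σ + σ)) whole
    whole-degree true v _ = ≤-trans (proj₁ (degree-loss N k δ σ large σ≤k)) (≤-trans (out v) (outdeg≤deg D v))
    whole-degree false v _ = ≤-trans (proj₁ (degree-loss N k δ σ large σ≤k)) (≤-trans (inn v) (indeg≤deg D v))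

    whole-size : size whole ≤ 8 * N * d
    whole-size = ≤-trans (size≤ whole) (≤-trans (≤-reflexive (eq n)) (≤-trans 2n≤4Nd (*-monoˡ-≤ d (*-monoˡ-≤ N (m≤m+n 4 4)))))
      where
      eq : ∀ n → n + n ≡ 2 * n
      eq = solve-∀

    robust : ∃ λ Z → NonEmpty Z × MinDeg d Z × Robust d (σ + σ) Z
    robust = robust-subpair (8 * N) d (σ + σ) whole (true , fromℕ< n>0 , refl) whole-degree whole-size

    Z : Pair
    Z = proj₁ robust

    nonempty : NonEmpty Z
    nonempty = proj₁ (proj₂ robust)

    mindeg : MinDeg d Z
    mindeg = proj₁ (proj₂ (proj₂ robust))

    connection : ∀ b u c v → Z b u ≡ true → Z c v ≡ true → ∀ F → length F ≤ f →
      ∃ λ ps → Walk c v ps b u × length ps ≤ L × Unique ps × All (_∉ F) ps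
    connection b u c v zu zv F lF = Connect.connect Z d σ (proj₂ (proj₂ (proj₂ robust))) mindeg b u zu L connect-steps c v zv F (≤-trans (+-monoˡ-≤ L lF) connect-avoid)

    hub : Hubs.Hub D Z f
    hub = Hubs.robust⇒hub D N d Z f nonempty mindeg n≤2Nd n>0 hub-size

    d>0 : 0 < d
    d>0 = positive-factor d (≤-trans n>0 n≤2Nd)
      where
      positive-factor : ∀ x → 0 < 2 * N * x → 0 < x
      positive-factor zero h = ⊥-elim (<⇒≱ h (≤-reflexive (*-zeroʳ (2 * N))))
      positive-factor (suc x) _ = s≤s z≤n

    sides-large : ∀ b → d ≤ ∣ Z b ∣
    sides-large = side-large nonempty mindeg d>0

    open Tiles D Z using (Tile; verts*; length-verts*)

    s>0 : 0 < s
    s>0 = subst (0 <_) κ≡ (≤-trans (≤-trans θ>0 (m≤n*m θ 2)) (m≤n+m (2 * θ) κ))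

    module R = Tiling.Rounds D oriented Z d mindeg sides-large m t M Smax g s s>0 tiles-m tiles-s tiles-t tiles-M tiles-g

    scale≡ : ∀ i → R.scale i ≡ suc m ^ i * s
    scale≡ zero = sym (+-identityʳ s)
    scale≡ (suc i) = trans (cong (suc m *_) (scale≡ i)) (sym (*-assoc (suc m) (suc m ^ i) s))

    tiling : ∃ λ (Us : List (Tile s)) → Unique (verts* Us) × d ≤ s * length Us + 3 * t
    tiling = R.tiling r (≤-reflexive (trans (scale≡ r) (sym tiles-S))) (≤-trans (≤-trans (sides-large true) (∣∣≤n (Z true))) tiles-r)

    Us : List (Tile s)
    Us = proj₁ tiling

    Us-few : length Us * (2 * s) ≤ n
    Us-few = ≤-trans (≤-reflexive (sym (length-verts* Us))) (unique-length (verts* Us) (proj₁ (proj₂ tiling)))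

    k≤2n : k ≤ 2 * n
    k≤2n = *-cancelˡ-≤ N (≤-trans (≤-trans (*-monoˡ-≤ k (n≤1+n N)) (<⇒≤ large)) (≤-trans (*-monoʳ-≤ (2 * N) δ≤n) (≤-reflexive (eq N n))))
      where
      δ≤n : δ ≤ n
      δ≤n = ≤-trans (≤-trans (out (fromℕ< n>0)) (outdeg≤deg D (fromℕ< n>0))) (∣∣≤n _)
      eq : ∀ N n → 2 * N * n ≡ N * (2 * n)
      eq = solve-∀

    open Assembly subdivision using (side; side-parity; contains)

    setup : Setup D
    setup = record
      { oriented = oriented ; Z = Z ; L = L ; f = f ; conn = connection ; hub = hub
      ; s = s ; θ = θ ; κ = κ ; J = J ; q = length Us ; J≡ = J≡ ; tile = lookup Us
      ; tile-disjoint = TileFamily.lookup-disjoint D Z Us (proj₁ (proj₂ tiling))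
      ; tile-unique = TileFamily.lookup-unique D Z Us (proj₁ (proj₂ tiling))
      ; θ>0 = θ>0 ; Lθ = L≤θ ; κs = ≤-reflexive κ≡ ; k = k ; cap = cap ; fits = avoid-fits
      ; tiles-suffice = tile-supply N k d n t s θ κ J (length Us) cap θ>0 d-large (proj₂ (proj₂ tiling)) t≤k Us-few n≤Nk s≡ κ≡ J≡ cap-small
      }

    system : PathSystem D gap side
    system = Routing.Embed.path-system setup {g = gap} {side = side} (record
      { positive = positive ; forest = long ; total = total ; parity = side-parity
      ; rooms = rooms-bound L k n J s cap h k≤2n cap-large s≤J h-small })

    result : Contains D H
    result = contains system

  -- Choice of the constants.

  record Floor (K n x : ℕ) : Set where
    field
      K>0 : 0 < K
      lower : K * x ≤ n
      upper : n < K * suc x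
      pos : 0 < x

    double : n ≤ 2 * K * x
    double = ≤-trans (<⇒≤ upper) (≤-trans (≤-reflexive (*-suc K x)) (≤-trans (+-monoˡ-≤ (K * x) (m≤m*n K x {{>-nonZero pos}})) (≤-reflexive (eq K x))))
      where
      eq : ∀ K x → K * x + K * x ≡ 2 * K * x
      eq = solve-∀

    at-least : ∀ T → K * T ≤ n → T ≤ x
    at-least T h = ≮⇒≥ λ x<T → <⇒≱ upper (≤-trans (*-monoʳ-≤ K x<T) h)

  <-suc-quotient : ∀ n K .{{_ : NonZero K}} → n < K * suc (n / K)
  <-suc-quotient n K = ≤-trans (s≤s (≤-reflexive (m≡m%n+[m/n]*n n K))) (≤-trans (+-monoˡ-≤ (n / K * K) (m%n<n n K)) (≤-reflexive (*-comm (suc (n / K)) K)))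

  floor : ∀ K n → 0 < K → K ≤ n → ∃ (Floor K n)
  floor K n K>0 K≤n = x , record
    { K>0 = K>0
    ; lower = ≤-trans (≤-reflexive (*-comm K x)) (m/n*n≤m n K)
    ; upper = up
    ; pos = pos′ x up
    }
    where
    instance
      K≢0 : NonZero K
      K≢0 = >-nonZero K>0
    x : ℕ
    x = n / K
    up : n < K * suc x
    up = <-suc-quotient n K
    pos′ : ∀ x → n < K * suc x → 0 < x
    pos′ zero h = ⊥-elim (<⇒≱ h (≤-trans (≤-reflexive (*-identityʳ K)) K≤n))
    pos′ (suc x) _ = s≤s z≤n

  record Suitable (N n C : ℕ) : Set where
    field
      {σ L f cap θ κ J s t m M Smax g r} : ℕ
      constants : Constants N n σ L f cap θ κ J s t m M Smax g r
      order-bound : ∀ h → C * (h * h) ≤ n → 4 * ((2 * L + J + 4) * (h * h)) ≤ cap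

  -- The coefficient of `f` in the size condition for hubs: `r * (2 * N * (2 * K) ^ suc K)` with the
  -- values of `r` and `K` inserted.
  hub-constant : ℕ → ℕ
  hub-constant N = 12 * N * (2 * N * (2 * K) ^ suc K)
    where
    K : ℕ
    K = 2 * N * (4 * (12 * N * (12 * N)))

  hub-constant>0 : ∀ N .{{_ : NonZero N}} → 0 < hub-constant N
  hub-constant>0 N = *-mono-≤ {1} {12 * N} {1} (>-nonZero⁻¹ (12 * N) {{m*n≢0 12 N}})
    (*-mono-≤ {1} {2 * N} {1} (>-nonZero⁻¹ (2 * N) {{m*n≢0 2 N}}) (m^n>0 (2 * K) {{m*n≢0 2 K {{_}} {{K≢0}}}} (suc K)))
    where
    K : ℕ
    K = 2 * N * (4 * (12 * N * (12 * N)))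
    K≢0 : NonZero K
    K≢0 = m*n≢0 (2 * N) (4 * (12 * N * (12 * N))) {{m*n≢0 2 N}} {{m*n≢0 4 (12 * N * (12 * N)) {{_}} {{m*n≢0 (12 * N) (12 * N) {{m*n≢0 12 N}} {{m*n≢0 12 N}}}}}}

  -- K₁, K₂, Kc, Q and Kg are the divisors with σ = n / K₁, f = n / K₂, cap = n / Kc, t = n / Q and g = n / Kg.
  module Choose (N : ℕ) .{{N≢0 : NonZero N}} (K₁ L Hc K₂ Kc θ s Q m Kg r Smax M n₀ : ℕ)
    (K₁≡ : K₁ ≡ 64 * (N * (N * N))) (L≡ : L ≡ 5 * K₁)
    (Hc≡ : Hc ≡ hub-constant N) (Hc>0 : 0 < Hc)
    (K₂≡ : K₂ ≡ 2 * K₁ * Hc) (Kc≡ : Kc ≡ 2048 * (N * N * N * N) * K₂) (θ≡ : θ ≡ 8 * ((L + 2) * Kc)) (s≡ : s ≡ 64 * (N * N * θ))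
    (Q≡ : Q ≡ 24 * (N * N)) (m≡ : m ≡ 4 * Q) (Kg≡ : Kg ≡ 4 * (Q * (2 + m))) (r≡ : r ≡ 2 * Kg)
    (Smax≡ : Smax ≡ suc m ^ r * s) (M≡ : M ≡ 4 * Smax * 2 ^ (2 * Smax))
    (n₀≡ : n₀ ≡ K₁ + (2 * K₁ * L + (K₂ + (Kc + (Q + (Q * (2 * (Smax * 2 ^ M)) + (Q * M + (Q * (2 * (Smax * (2 + m))) + Kg)))))))) where

    private
      N>0 : 0 < N
      N>0 = >-nonZero⁻¹ N

      product>0 : ∀ x y → 0 < x → 0 < y → 0 < x * y
      product>0 x y p q = *-mono-≤ p q

      K₁>0 : 0 < K₁
      K₁>0 = subst (0 <_) (sym K₁≡) (product>0 64 (N * (N * N)) (s≤s z≤n) (product>0 N (N * N) N>0 (product>0 N N N>0 N>0)))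

      K₂>0 : 0 < K₂
      K₂>0 = subst (0 <_) (sym K₂≡) (product>0 (2 * K₁) Hc (product>0 2 K₁ (s≤s z≤n) K₁>0) Hc>0)

      N⁴>0 : 0 < N * N * N * N
      N⁴>0 = product>0 (N * N * N) N (product>0 (N * N) N (product>0 N N N>0 N>0) N>0) N>0

      Kc>0 : 0 < Kc
      Kc>0 = subst (0 <_) (sym Kc≡) (product>0 (2048 * (N * N * N * N)) K₂ (product>0 2048 (N * N * N * N) (s≤s z≤n) N⁴>0) K₂>0)

      θ>0 : 0 < θ
      θ>0 = subst (0 <_) (sym θ≡) (product>0 8 ((L + 2) * Kc) (s≤s z≤n) (product>0 (L + 2) Kc (≤-trans (s≤s z≤n) (m≤n+m 2 L)) Kc>0))

      Q>0 : 0 < Q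
      Q>0 = subst (0 <_) (sym Q≡) (product>0 24 (N * N) (s≤s z≤n) (product>0 N N N>0 N>0))

      Kg>0 : 0 < Kg
      Kg>0 = subst (0 <_) (sym Kg≡) (product>0 4 (Q * (2 + m)) (s≤s z≤n) (product>0 Q (2 + m) Q>0 (s≤s z≤n)))

    J C : ℕ
    J = suc (2 * (s ∸ 2 * θ))
    -- The bound on `h` turns into a bound by `cap`, which is `n / Kc`.
    C = Kc * (4 * (2 * L + J + 4))

    C≢0 : NonZero C
    C≢0 = >-nonZero (product>0 Kc (4 * (2 * L + J + 4)) Kc>0 (product>0 4 (2 * L + J + 4) (s≤s z≤n) (≤-trans (s≤s z≤n) (m≤n+m 4 (2 * L + J)))))

    module At (n : ℕ) (n₀≤n : n₀ ≤ n) where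

      private
        bound : ∀ x y → x + y ≤ n → x ≤ n × y ≤ n
        bound x y h = ≤-trans (m≤m+n x y) h , ≤-trans (m≤n+m y x) h

        b₁ = bound K₁ _ (subst (_≤ n) n₀≡ n₀≤n)
        b₂ = bound (2 * K₁ * L) _ (proj₂ b₁)
        b₃ = bound K₂ _ (proj₂ b₂)
        b₄ = bound Kc _ (proj₂ b₃)
        b₅ = bound Q _ (proj₂ b₄)
        b₆ = bound (Q * (2 * (Smax * 2 ^ M))) _ (proj₂ b₅)
        b₇ = bound (Q * M) _ (proj₂ b₆)
        b₈ = bound (Q * (2 * (Smax * (2 + m)))) Kg (proj₂ b₇)

      σF = floor K₁ n K₁>0 (proj₁ b₁)
      fF = floor K₂ n K₂>0 (proj₁ b₃)
      cF = floor Kc n Kc>0 (proj₁ b₄)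
      tF = floor Q n Q>0 (proj₁ b₅)
      gF = floor Kg n Kg>0 (proj₂ b₈)

      σ f cap t g κ : ℕ
      σ = proj₁ σF
      f = proj₁ fF
      cap = proj₁ cF
      t = proj₁ tF
      g = proj₁ gF
      κ = s ∸ 2 * θ

      private
        module σ = Floor (proj₂ σF)
        module f = Floor (proj₂ fF)
        module c = Floor (proj₂ cF)
        module t = Floor (proj₂ tF)
        module g = Floor (proj₂ gF)

        open ≤-Reasoning

        -- Rounding down costs a factor 2, so `n + n` is at most `4 * K₁ * σ`; hence the 5 in `L`.
        connect-steps : n + n < L * σ
        connect-steps = begin-strict
          n + n ≤⟨ +-mono-≤ σ.double σ.double ⟩
          2 * K₁ * σ + 2 * K₁ * σ ≡⟨ eq K₁ σ ⟩
          4 * (K₁ * σ) <⟨ m<n+m (4 * (K₁ * σ)) (product>0 K₁ σ K₁>0 σ.pos) ⟩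
          K₁ * σ + 4 * (K₁ * σ) ≡⟨ eq' K₁ σ ⟩
          5 * K₁ * σ ≡⟨ cong (_* σ) (sym L≡) ⟩
          L * σ ∎
          where
          eq : ∀ K x → 2 * K * x + 2 * K * x ≡ 4 * (K * x)
          eq = solve-∀
          eq' : ∀ K x → K * x + 4 * (K * x) ≡ 5 * K * x
          eq' = solve-∀

        connect-avoid : f + L ≤ σ
        connect-avoid = σ.at-least (f + L) (*-cancelˡ-≤ 2 (begin
          2 * (K₁ * (f + L)) ≡⟨ eq K₁ f L ⟩
          2 * K₁ * f + 2 * K₁ * L ≤⟨ +-mono-≤ (*-monoˡ-≤ f (≤-trans (m≤m*n (2 * K₁) Hc {{>-nonZero Hc>0}}) (≤-reflexive (sym K₂≡)))) (proj₁ b₂) ⟩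
          K₂ * f + n ≤⟨ +-monoˡ-≤ n f.lower ⟩
          n + n ≡⟨ cong (n +_) (sym (+-identityʳ n)) ⟩
          2 * n ∎))
          where
          eq : ∀ K f L → 2 * (K * (f + L)) ≡ 2 * K * f + 2 * K * L
          eq = solve-∀

        hub-size : (let ρ = 12 * N ; j = 4 * (ρ * ρ) ; K = 2 * N * j in ρ * f * (2 * N * (2 * K) ^ suc K) ≤ n)
        hub-size = go (12 * N) (2 * N * (2 * (2 * N * (4 * (12 * N * (12 * N))))) ^ suc (2 * N * (4 * (12 * N * (12 * N))))) Hc≡
          where
          go : ∀ ρ y → Hc ≡ ρ * y → ρ * f * y ≤ n
          go ρ y e = begin
            ρ * f * y ≡⟨ eq ρ f y ⟩
            ρ * y * f ≡⟨ cong (_* f) (sym e) ⟩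
            Hc * f ≤⟨ *-monoˡ-≤ f (≤-trans (m≤n*m Hc (2 * K₁) {{>-nonZero (product>0 2 K₁ (s≤s z≤n) K₁>0)}}) (≤-reflexive (sym K₂≡))) ⟩
            K₂ * f ≤⟨ f.lower ⟩
            n ∎
            where
            eq : ∀ a b c → a * b * c ≡ a * c * b
            eq = solve-∀

        scaled-cap : 2048 * (N * N * N * N * cap) ≤ f
        scaled-cap = f.at-least _ (≤-trans (≤-reflexive (trans (eq N K₂ cap) (cong (_* cap) (sym Kc≡)))) c.lower)
          where
          eq : ∀ N K c → K * (2048 * (N * N * N * N * c)) ≡ 2048 * (N * N * N * N) * K * c
          eq = solve-∀

        cap-small : 1024 * (N * N * N * N * cap) < n
        cap-small = begin-strict
          1024 * (N * N * N * N * cap) <⟨ *-monoˡ-< (N * N * N * N * cap) {{>-nonZero (product>0 (N * N * N * N) cap N⁴>0 c.pos)}} (m<m+n 1024 {1024} (s≤s z≤n)) ⟩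
          2048 * (N * N * N * N * cap) ≤⟨ scaled-cap ⟩
          f ≤⟨ m≤n*m f K₂ {{>-nonZero K₂>0}} ⟩
          K₂ * f ≤⟨ f.lower ⟩
          n ∎

        -- With `s = 64 * N * N * θ` the factor `θ` cancels, and what remains is a bound on `cap` in
        -- terms of `f` and `N` alone.
        avoid-fits : θ * (cap + 2) + 2 * s * cap ≤ θ * f
        avoid-fits = begin
          θ * (cap + 2) + 2 * s * cap ≡⟨ cong (λ x → θ * (cap + 2) + 2 * x * cap) s≡ ⟩
          θ * (cap + 2) + 2 * (64 * (N * N * θ)) * cap ≡⟨ eq₁ θ cap N ⟩
          θ * (cap + 2 + 128 * (N * N * cap)) ≤⟨ *-monoʳ-≤ θ (≤-trans (+-mono-≤ (+-mono-≤ cap≤ (*-monoʳ-≤ 2 1≤)) (*-monoʳ-≤ 128 N²≤)) (≤-trans (≤-reflexive (eq₂ N⁴c)) (≤-trans (*-monoˡ-≤ N⁴c (m≤m+n 131 1917)) scaled-cap))) ⟩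
          θ * f ∎
          where
          N⁴c = N * N * N * N * cap
          cap≤ : cap ≤ N⁴c
          cap≤ = m≤n*m cap (N * N * N * N) {{>-nonZero N⁴>0}}
          1≤ : 1 ≤ N⁴c
          1≤ = product>0 (N * N * N * N) cap N⁴>0 c.pos
          N²≤ : N * N * cap ≤ N⁴c
          N²≤ = *-monoˡ-≤ cap (≤-trans (m≤m*n (N * N) N) (m≤m*n (N * N * N) N))
          eq₁ : ∀ θ c N → θ * (c + 2) + 2 * (64 * (N * N * θ)) * c ≡ θ * (c + 2 + 128 * (N * N * c))
          eq₁ = solve-∀
          eq₂ : ∀ x → x + 2 * x + 128 * x ≡ 131 * x
          eq₂ = solve-∀

        4θ≤s : 4 * θ ≤ s
        4θ≤s = ≤-trans (*-monoˡ-≤ θ (m≤m+n 4 60)) (≤-trans (*-monoʳ-≤ 64 (m≤n*m θ (N * N) {{m*n≢0 N N}})) (≤-reflexive (sym s≡)))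

        κ≡ : κ + 2 * θ ≡ s
        κ≡ = m∸n+n≡m (≤-trans (*-monoˡ-≤ θ (m≤m+n 2 2)) 4θ≤s)

        s≤J : s ≤ J
        s≤J = ≤-trans (+-cancelʳ-≤ (4 * θ) s (2 * κ) (begin
          s + 4 * θ ≤⟨ +-monoʳ-≤ s 4θ≤s ⟩
          s + s ≡⟨ cong (s +_) (sym (+-identityʳ s)) ⟩
          2 * s ≡⟨ cong (2 *_) (sym κ≡) ⟩
          2 * (κ + 2 * θ) ≡⟨ eq κ θ ⟩
          2 * κ + 4 * θ ∎)) (n≤1+n (2 * κ))
          where
          eq : ∀ κ θ → 2 * (κ + 2 * θ) ≡ 2 * κ + 4 * θ
          eq = solve-∀

        -- This determines `θ`: tiles must be so large that connections of `L + 2` vertices, one per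
        -- tile, stay within half of `cap`.
        cap-large : 4 * ((L + 2) * n) ≤ s * cap
        cap-large = begin
          4 * ((L + 2) * n) ≤⟨ *-monoʳ-≤ 4 (*-monoʳ-≤ (L + 2) c.double) ⟩
          4 * ((L + 2) * (2 * Kc * cap)) ≡⟨ eq (L + 2) Kc cap ⟩
          8 * ((L + 2) * Kc) * cap ≡⟨ cong (_* cap) (sym θ≡) ⟩
          θ * cap ≤⟨ *-monoˡ-≤ cap (≤-trans (m≤n*m θ 4) 4θ≤s) ⟩
          s * cap ∎
          where
          eq : ∀ l K c → 4 * (l * (2 * K * c)) ≡ 8 * (l * K) * c
          eq = solve-∀

        tiles-m : 2 * n ≤ suc m * t
        tiles-m = begin
          2 * n ≤⟨ *-monoʳ-≤ 2 t.double ⟩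
          2 * (2 * Q * t) ≡⟨ eq Q t ⟩
          4 * Q * t ≡⟨ cong (_* t) (sym m≡) ⟩
          m * t ≤⟨ *-monoˡ-≤ t (n≤1+n m) ⟩
          suc m * t ∎
          where
          eq : ∀ Q t → 2 * (2 * Q * t) ≡ 4 * Q * t
          eq = solve-∀

        tiles-g : (g + Smax) * (2 + m) ≤ t
        tiles-g = *-cancelˡ-≤ 2 (begin
          2 * ((g + Smax) * (2 + m)) ≡⟨ eq₁ g Smax (2 + m) ⟩
          2 * (g * (2 + m)) + 2 * (Smax * (2 + m)) ≤⟨ +-mono-≤ small (t.at-least _ (proj₁ b₈)) ⟩
          t + t ≡⟨ cong (t +_) (sym (+-identityʳ t)) ⟩
          2 * t ∎)
          where
          eq₁ : ∀ g S m → 2 * ((g + S) * m) ≡ 2 * (g * m) + 2 * (S * m)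
          eq₁ = solve-∀
          eq₂ : ∀ Q g m → 2 * Q * (2 * (g * m)) ≡ 4 * (Q * m) * g
          eq₂ = solve-∀
          small : 2 * (g * (2 + m)) ≤ t
          small = *-cancelˡ-≤ (2 * Q) {{>-nonZero (product>0 2 Q (s≤s z≤n) Q>0)}} (begin
            2 * Q * (2 * (g * (2 + m))) ≡⟨ eq₂ Q g (2 + m) ⟩
            4 * (Q * (2 + m)) * g ≡⟨ cong (_* g) (sym Kg≡) ⟩
            Kg * g ≤⟨ g.lower ⟩
            n ≤⟨ t.double ⟩
            2 * Q * t ∎)

      constants : Constants N n σ L f cap θ κ J s t m M Smax g r
      constants = record
        { connect-steps = connect-steps
        ; connect-avoid = connect-avoid
        ; hub-size = hub-size
        ; σ-small = ≤-trans (≤-reflexive (trans (eq₁ N σ) (cong (_* σ) (sym K₁≡)))) σ.lower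
        ; n>0 = ≤-trans K₁>0 (proj₁ b₁)
        ; θ>0 = θ>0
        ; L≤θ = ≤-trans (≤-trans (m≤m*n (L + 2) Kc {{>-nonZero Kc>0}}) (m≤n*m _ 8)) (≤-reflexive (sym θ≡))
        ; s≡ = s≡
        ; κ≡ = κ≡
        ; J≡ = refl
        ; s≤J = s≤J
        ; avoid-fits = avoid-fits
        ; cap-small = cap-small
        ; cap-large = cap-large
        ; t-small = ≤-trans (≤-reflexive (trans (eq₂ N t) (cong (_* t) (sym Q≡)))) t.lower
        ; tiles-m = tiles-m
        ; tiles-s = t.at-least _ (proj₁ b₆)
        ; tiles-t = t.at-least _ (proj₁ b₇)
        ; tiles-M = ≤-reflexive (sym M≡)
        ; tiles-g = tiles-g
        ; tiles-S = Smax≡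
        ; tiles-r = ≤-trans g.double (≤-reflexive (cong (_* g) (sym r≡)))
        }
        where
        eq₁ : ∀ N x → 64 * (N * (N * (N * x))) ≡ 64 * (N * (N * N)) * x
        eq₁ = solve-∀
        eq₂ : ∀ N t → 24 * (N * (N * t)) ≡ 24 * (N * N) * t
        eq₂ = solve-∀

      order-bound : ∀ h → Kc * (4 * (2 * L + J + 4)) * (h * h) ≤ n → 4 * ((2 * L + J + 4) * (h * h)) ≤ cap
      order-bound h hyp = c.at-least _ (≤-trans (≤-reflexive (eq Kc (2 * L + J + 4) (h * h))) hyp)
        where
        eq : ∀ K c x → K * (4 * (c * x)) ≡ K * (4 * c) * x
        eq = solve-∀

      suitable : Suitable N n C
      suitable = record { constants = constants ; order-bound = order-bound }

  bind : ∀ {X : Set} x → (∀ (y : ℕ) → y ≡ x → X) → X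
  bind x k = k x refl

  -- Naming each constant by an equation, and hiding the result, keeps these huge numerals folded.
  abstract
    thresholds : ∀ N .{{_ : NonZero N}} → ∃ λ n₀ → ∃ λ C → NonZero C × (∀ n → n₀ ≤ n → Suitable N n C)
    thresholds N =
      bind (64 * (N * (N * N))) λ K₁ K₁≡ →
      bind (5 * K₁) λ L L≡ →
      bind (hub-constant N) λ Hc Hc≡ →
      bind (2 * K₁ * Hc) λ K₂ K₂≡ →
      bind (2048 * (N * N * N * N) * K₂) λ Kc Kc≡ →
      bind (8 * ((L + 2) * Kc)) λ θ θ≡ →
      bind (64 * (N * N * θ)) λ s s≡ →
      bind (24 * (N * N)) λ Q Q≡ →
      bind (4 * Q) λ m m≡ →
      bind (4 * (Q * (2 + m))) λ Kg Kg≡ →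
      bind (2 * Kg) λ r r≡ →
      bind (suc m ^ r * s) λ Smax Smax≡ →
      bind (4 * Smax * 2 ^ (2 * Smax)) λ M M≡ →
      bind (K₁ + (2 * K₁ * L + (K₂ + (Kc + (Q + (Q * (2 * (Smax * 2 ^ M)) + (Q * M + (Q * (2 * (Smax * (2 + m))) + Kg)))))))) λ n₀ n₀≡ →
      let module T = Choose N K₁ L Hc K₂ Kc θ s Q m Kg r Smax M n₀ K₁≡ L≡ Hc≡ (subst (0 <_) (sym Hc≡) (hub-constant>0 N)) K₂≡ Kc≡ θ≡ s≡ Q≡ m≡ Kg≡ r≡ Smax≡ M≡ n₀≡
      in n₀ , T.C , T.C≢0 , T.At.suitable

-- Clearing denominators.

module Rationals where
  open import Data.Integer using (+_)
  open import Data.Rational using (ℚ; mkℚ; 0ℚ; 1ℚ; ½; _+_; _*_; _≤_; _<_; NonNegative; toℚᵘ; ↧ₙ_; *<*; _/_)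
  open import Data.Rational.Unnormalised using (mkℚᵘ; *≡*; *≤*; *<*)

  ℕ→ℚᵘ : ∀ a → toℚᵘ (ℕ→ℚ a) ℚᵘ.≃ mkℚᵘ (+ a) 0
  ℕ→ℚᵘ a = ℚₚ.toℚᵘ-fromℚᵘ (mkℚᵘ (+ a) 0)

  ℕ→ℚ-* : ∀ a b → ℕ→ℚ (a ℕ.* b) ≡ ℕ→ℚ a * ℕ→ℚ b
  ℕ→ℚ-* a b = ℚₚ.toℚᵘ-injective (ℚᵘₚ.≃-trans (ℕ→ℚᵘ (a ℕ.* b)) (ℚᵘₚ.≃-sym (ℚᵘₚ.≃-trans (ℚₚ.toℚᵘ-homo-* (ℕ→ℚ a) (ℕ→ℚ b))
    (ℚᵘₚ.≃-trans (ℚᵘₚ.*-cong (ℕ→ℚᵘ a) (ℕ→ℚᵘ b)) (*≡* (cong (ℤ._* + 1) (sym (ℤₚ.pos-* a b))))))))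

  ℕ→ℚ-+ : ∀ a b → ℕ→ℚ (a ℕ.+ b) ≡ ℕ→ℚ a + ℕ→ℚ b
  ℕ→ℚ-+ a b = ℚₚ.toℚᵘ-injective (ℚᵘₚ.≃-trans (ℕ→ℚᵘ (a ℕ.+ b)) (ℚᵘₚ.≃-sym (ℚᵘₚ.≃-trans (ℚₚ.toℚᵘ-homo-+ (ℕ→ℚ a) (ℕ→ℚ b))
    (ℚᵘₚ.≃-trans (ℚᵘₚ.+-cong (ℕ→ℚᵘ a) (ℕ→ℚᵘ b)) (*≡* (cong (ℤ._* + 1) (cong₂ ℤ._+_ (ℤₚ.*-identityʳ (+ a)) (ℤₚ.*-identityʳ (+ b)))))))))

  ℕ→ℚ-≤⁻ : ∀ a b → ℕ→ℚ a ≤ ℕ→ℚ b → a ℕ.≤ b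
  ℕ→ℚ-≤⁻ a b h with ℚᵘₚ.≤-trans (ℚᵘₚ.≤-reflexive (ℚᵘₚ.≃-sym (ℕ→ℚᵘ a))) (ℚᵘₚ.≤-trans (ℚₚ.toℚᵘ-mono-≤ h) (ℚᵘₚ.≤-reflexive (ℕ→ℚᵘ b)))
  ... | *≤* l = ℤₚ.drop‿+≤+ (subst₂ ℤ._≤_ (ℤₚ.*-identityʳ (+ a)) (ℤₚ.*-identityʳ (+ b)) l)

  ℕ→ℚ-<⁻ : ∀ a b → ℕ→ℚ a < ℕ→ℚ b → a ℕ.< b
  ℕ→ℚ-<⁻ a b h with ℚᵘₚ.<-respˡ-≃ (ℕ→ℚᵘ a) (ℚᵘₚ.<-respʳ-≃ (ℕ→ℚᵘ b) (ℚₚ.toℚᵘ-mono-< h))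
  ... | *<* l = ℤₚ.drop‿+<+ (subst₂ ℤ._<_ (ℤₚ.*-identityʳ (+ a)) (ℤₚ.*-identityʳ (+ b)) l)

  ℕ→ℚ-nonNegative : ∀ a → NonNegative (ℕ→ℚ a)
  ℕ→ℚ-nonNegative a = ℚₚ.normalize-nonNeg a 1

  ℕ→ℚ-positive : ∀ a .{{_ : ℕ.NonZero a}} → Data.Rational.Positive (ℕ→ℚ a)
  ℕ→ℚ-positive a = ℚₚ.normalize-pos a 1

  clear-denominator : ∀ η → 0ℚ < η → ∃ λ P → 1 ℕ.≤ P × η * ℕ→ℚ (↧ₙ η) ≡ ℕ→ℚ P
  clear-denominator η@(mkℚ (+ suc p) d-1 c) _ = suc p , ℕ.s≤s ℕ.z≤n , ℚₚ.toℚᵘ-injective (ℚᵘₚ.≃-trans (ℚₚ.toℚᵘ-homo-* η (ℕ→ℚ (suc d-1)))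
    (ℚᵘₚ.≃-trans (ℚᵘₚ.*-cong (ℚᵘₚ.≃-refl {toℚᵘ η}) (ℕ→ℚᵘ (suc d-1))) (ℚᵘₚ.≃-trans (*≡* eq) (ℚᵘₚ.≃-sym (ℕ→ℚᵘ (suc p))))))
    where
    eq : (+ suc p ℤ.* + suc d-1) ℤ.* + 1 ≡ + suc p ℤ.* + (suc d-1 ℕ.* 1)
    eq = trans (ℤₚ.*-identityʳ _) (cong (λ x → + suc p ℤ.* + x) (sym (ℕₚ.*-identityʳ (suc d-1))))
  clear-denominator (mkℚ (+ 0) d-1 c) (*<* (ℤ.+<+ ()))
  clear-denominator (mkℚ ℤ.-[1+ p ] d-1 c) (*<* ())

  module _ (η : ℚ) (P : ℕ) (P≥1 : 1 ℕ.≤ P) (ηN : η * ℕ→ℚ (↧ₙ η) ≡ ℕ→ℚ P) where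

    private
      N : ℕ
      N = ↧ₙ η

    -- Here `η = P / N`; bounding `P` below by 1 replaces η by `1 / N`.
    clear-≤ : ∀ n k → η * ℕ→ℚ n ≤ ℕ→ℚ k → n ℕ.≤ N ℕ.* k
    clear-≤ n k h = ℕₚ.≤-trans (ℕₚ.m≤n*m n P {{ℕ.>-nonZero P≥1}}) (ℕ→ℚ-≤⁻ (P ℕ.* n) (N ℕ.* k)
      (subst₂ _≤_ left (sym (ℕ→ℚ-* N k)) (ℚₚ.*-monoˡ-≤-nonNeg (ℕ→ℚ N) {{ℕ→ℚ-nonNegative N}} h)))
      where
      open +-*-Solver
      left : ℕ→ℚ N * (η * ℕ→ℚ n) ≡ ℕ→ℚ (P ℕ.* n)
      left = trans (solve 3 (λ a b c → a :* (b :* c) := (b :* a) :* c) refl (ℕ→ℚ N) η (ℕ→ℚ n))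
        (trans (cong (_* ℕ→ℚ n) ηN) (sym (ℕ→ℚ-* P n)))

    clear-< : ∀ k o → (1ℚ + η) * ℕ→ℚ k * ½ < ℕ→ℚ o → suc N ℕ.* k ℕ.< 2 ℕ.* N ℕ.* o
    clear-< k o h = ℕₚ.≤-<-trans (ℕₚ.*-monoˡ-≤ k (ℕₚ.+-monoˡ-≤ N P≥1)) (ℕ→ℚ-<⁻ ((P ℕ.+ N) ℕ.* k) (2 ℕ.* N ℕ.* o)
      (subst₂ _<_ left (sym (ℕ→ℚ-* (2 ℕ.* N) o)) (ℚₚ.*-monoʳ-<-pos (ℕ→ℚ (2 ℕ.* N)) {{ℕ→ℚ-positive (2 ℕ.* N) {{ℕₚ.m*n≢0 2 N}}}} h)))
      where
      open +-*-Solver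
      left : ℕ→ℚ (2 ℕ.* N) * ((1ℚ + η) * ℕ→ℚ k * ½) ≡ ℕ→ℚ ((P ℕ.+ N) ℕ.* k)
      left = trans (cong (_* ((1ℚ + η) * ℕ→ℚ k * ½)) (ℕ→ℚ-* 2 N))
        (trans (solve 5 (λ a b c d e → (a :* b) :* ((con 1ℚ :+ c) :* d :* e) := (a :* e) :* ((c :* b :+ b) :* d)) refl (ℕ→ℚ 2) (ℕ→ℚ N) η (ℕ→ℚ k) ½)
        (trans (ℚₚ.*-identityˡ ((η * ℕ→ℚ N + ℕ→ℚ N) * ℕ→ℚ k))
        (trans (cong (_* ℕ→ℚ k) (trans (cong (_+ ℕ→ℚ N) ηN) (sym (ℕ→ℚ-+ P N)))) (sym (ℕ→ℚ-* (P ℕ.+ N) k)))))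

  reciprocal : ∀ C .{{_ : ℕ.NonZero C}} → ℚ
  reciprocal C = + 1 / C

  reciprocal-positive : ∀ C .{{_ : ℕ.NonZero C}} → 0ℚ < reciprocal C
  reciprocal-positive C = ℚₚ.positive⁻¹ (reciprocal C) {{ℚₚ.normalize-pos 1 C}}

  -- The bound on `h` by a multiple of a square root enters squared. With `γ = 1 / C` it reads
  -- `C * C * h * h ≤ n`, which implies the bound with a single `C`.
  clear-square : ∀ C .{{_ : ℕ.NonZero C}} h n → ℕ→ℚ h * ℕ→ℚ h ≤ reciprocal C * reciprocal C * ℕ→ℚ n → C ℕ.* (h ℕ.* h) ℕ.≤ n
  clear-square C h n hyp = ℕₚ.≤-trans (ℕₚ.m≤n*m (C ℕ.* (h ℕ.* h)) C) (ℕ→ℚ-≤⁻ (C ℕ.* (C ℕ.* (h ℕ.* h))) n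
    (subst₂ _≤_ left right (ℚₚ.*-monoˡ-≤-nonNeg (ℕ→ℚ C) {{ℕ→ℚ-nonNegative C}} (ℚₚ.*-monoˡ-≤-nonNeg (ℕ→ℚ C) {{ℕ→ℚ-nonNegative C}} hyp))))
    where
    open +-*-Solver
    γ : ℚ
    γ = reciprocal C
    inverse : ∀ C .{{_ : ℕ.NonZero C}} → ℕ→ℚ C * reciprocal C ≡ 1ℚ
    inverse (suc c) = ℚₚ.toℚᵘ-injective (ℚᵘₚ.≃-trans (ℚₚ.toℚᵘ-homo-* (ℕ→ℚ (suc c)) (+ 1 / suc c))
      (ℚᵘₚ.≃-trans (ℚᵘₚ.*-cong (ℕ→ℚᵘ (suc c)) (ℚₚ.toℚᵘ-fromℚᵘ (mkℚᵘ (+ 1) c))) (*≡* eq)))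
      where
      eq : (+ suc c ℤ.* + 1) ℤ.* + 1 ≡ + 1 ℤ.* + (1 ℕ.* suc c)
      eq = trans (ℤₚ.*-identityʳ _) (trans (ℤₚ.*-identityʳ (+ suc c)) (sym (trans (ℤₚ.*-identityˡ _) (cong +_ (ℕₚ.*-identityˡ (suc c))))))
    left : ℕ→ℚ C * (ℕ→ℚ C * (ℕ→ℚ h * ℕ→ℚ h)) ≡ ℕ→ℚ (C ℕ.* (C ℕ.* (h ℕ.* h)))
    left = sym (trans (ℕ→ℚ-* C (C ℕ.* (h ℕ.* h))) (cong (ℕ→ℚ C *_) (trans (ℕ→ℚ-* C (h ℕ.* h)) (cong (ℕ→ℚ C *_) (ℕ→ℚ-* h h)))))
    right : ℕ→ℚ C * (ℕ→ℚ C * (γ * γ * ℕ→ℚ n)) ≡ ℕ→ℚ n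
    right = trans (solve 3 (λ c g n → c :* (c :* (g :* g :* n)) := (c :* g) :* ((c :* g) :* n)) refl (ℕ→ℚ C) γ (ℕ→ℚ n))
      (trans (cong (_* ((ℕ→ℚ C * γ) * ℕ→ℚ n)) (inverse C)) (trans (ℚₚ.*-identityˡ _) (trans (cong (_* ℕ→ℚ n) (inverse C)) (ℚₚ.*-identityˡ (ℕ→ℚ n)))))

open Combinatorics
open Rationals
open import Data.Rational using (ℚ; 0ℚ; 1ℚ; ½; _+_; _*_; _≤_; _<_; ↧ₙ_)

theorem3 : ∀ (η : ℚ) → 0ℚ < η → η < 1ℚ →
    Σ ℕ λ n₀ → Σ ℚ λ γ → 0ℚ < γ ×
    (∀ (n : ℕ) → n₀ Data.Nat.≤ n →
    ∀ (h : ℕ) → ℕ→ℚ h * ℕ→ℚ h ≤ γ * γ * ℕ→ℚ n →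
    ∀ (k : ℕ) → η * ℕ→ℚ n ≤ ℕ→ℚ k →
    ∀ (D : Digraph n) → Oriented D →
    MinSemidegreeAbove D ((1ℚ + η) * ℕ→ℚ k * ½) →
    ∀ (g : EdgeFun h) (m : ℕ) (H : Digraph m) →
    IsLongAntisubdivision h k g H → Contains D H)
theorem3 η η>0 η<1 = n₀ , reciprocal C , reciprocal-positive C , contains
  where
  N P n₀ C : ℕ
  N = ↧ₙ η
  P = proj₁ (clear-denominator η η>0)
  n₀ = proj₁ (thresholds N)
  C = proj₁ (proj₂ (thresholds N))
  instance
    2N≢0 : NonZero (2 ℕ.* N)
    2N≢0 = ℕₚ.m*n≢0 2 N
    C≢0 : NonZero C
    C≢0 = proj₁ (proj₂ (proj₂ (thresholds N)))
  P≥1 : 1 ℕ.≤ P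
  P≥1 = proj₁ (proj₂ (clear-denominator η η>0))
  ηN : η * ℕ→ℚ N ≡ ℕ→ℚ P
  ηN = proj₂ (proj₂ (clear-denominator η η>0))
  contains : ∀ n → n₀ ℕ.≤ n → ∀ h → ℕ→ℚ h * ℕ→ℚ h ≤ reciprocal C * reciprocal C * ℕ→ℚ n → ∀ k → η * ℕ→ℚ n ≤ ℕ→ℚ k →
    ∀ D → Oriented D → MinSemidegreeAbove D ((1ℚ + η) * ℕ→ℚ k * ½) → ∀ (g : EdgeFun h) m (H : Digraph m) → IsLongAntisubdivision h k g H → Contains D H
  contains n n₀≤n h h² k ηn D oriented degrees g m H long =
    Core.result constants D oriented k δ (clear-≤ η P P≥1 ηN n k ηn) (<-suc-quotient (suc N ℕ.* k) (2 ℕ.* N))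
      (λ v → quotient (proj₁ (degrees v))) (λ v → quotient (proj₂ (degrees v))) (order-bound h (clear-square C h n h²)) g H long
    where
    open Suitable (proj₂ (proj₂ (proj₂ (thresholds N))) n n₀≤n) using (constants; order-bound)
    δ : ℕ
    -- The least integer above `(1 + 1/N) * k / 2`, hence a lower bound for all in- and outdegrees.
    δ = suc ((suc N ℕ.* k) ℕ./ (2 ℕ.* N))
    quotient : ∀ {o} → (1ℚ + η) * ℕ→ℚ k * ½ < ℕ→ℚ o → δ ℕ.≤ o
    quotient {o} lt = m<n*o⇒m/o<n {n = o} (ℕₚ.<-≤-trans (clear-< η P P≥1 ηN k o lt) (ℕₚ.≤-reflexive (ℕₚ.*-comm (2 ℕ.* N) o)))
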